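{- The set $S_0^{3,tr}$ includes a primitive element (over $\mathbb{Q}$) of any totally real cubic field. The same is true of $S_{ -3}^{3,tr}$.
   Context: A totally real cubic field is a subfield of $\mathbb{R}$ of degree three over $\mathbb{Q}$ all of whose embeddings into $\mathbb{C}$ have image in $\mathbb{R}$. For integers $m, n$ satisfying $n \le -m-3$, define $$I_{m,n}^{3,tr} := \{\alpha \in (0,1) \mid \alpha^3+m\alpha^2+n\alpha+d=0 \text{ for some } d \in \mathbb{Z},\ 1 \le d \le -m-n-2\}.$$ For $m \in \{0,-1,-2,-3\}$, define $$S_m^{3,tr} := \bigcup_{n \le -m-3} I_{m,n}^{3,tr}.$$ -}

module Defs where

open import Algebra.Bundles.Raw using (RawRing)
import Algebra.Definitions.RawMonoid as RawMonoidDefinitions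
import Algebra.Definitions.RawSemiring as RawSemiringDefinitions
open import Algebra.Morphism.Structures using (module RingMorphisms)
open import Data.Fin.Base using (Fin)
open import Data.Integer.Base as ℤ using (ℤ; +_; 1ℤ)
open import Data.Nat.Base as ℕ using (ℕ; _⊔_)
import Data.Nat.Properties as ℕ
open import Data.Product.Base using (Σ; ∃-syntax; _×_; _,_; proj₁)
open import Data.Rational.Base as ℚ using (ℚ; 0ℚ; 1ℚ; ½; ∣_∣)
import Data.Rational.Properties as ℚ
open import Data.Rational.Solver using (module +-*-Solver)
open import Data.Vec.Functional using (Vector)
open import Level using (Level; 0ℓ)
open import Relation.Binary.PropositionalEquality
  using (_≡_; refl; sym; trans; cong; subst)
open import Relation.Unary using (Pred; _∈_; _≐_)

private variable
  ℓ : Level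

-- Real numbers: Cauchy sequences of rationals, compared by the relation _≈_
-- below (there are no quotient types, so ℝ is a setoid).

IsCauchy : (ℕ → ℚ) → Set
IsCauchy x = ∀ ε → 0ℚ ℚ.< ε →
  ∃[ N ] (∀ m n → N ℕ.≤ m → N ℕ.≤ n → ∣ x m ℚ.- x n ∣ ℚ.< ε)

record ℝ : Set where
  no-eta-equality
  field
    seq    : ℕ → ℚ
    cauchy : IsCauchy seq

open ℝ public

infix 4 _≈_ _<_

_≈_ : ℝ → ℝ → Set
x ≈ y = ∀ ε → 0ℚ ℚ.< ε →
  ∃[ N ] (∀ n → N ℕ.≤ n → ∣ seq x n ℚ.- seq y n ∣ ℚ.< ε)

_<_ : ℝ → ℝ → Set
x < y = ∃[ ε ] (0ℚ ℚ.< ε ×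
  ∃[ N ] (∀ n → N ℕ.≤ n → seq x n ℚ.+ ε ℚ.≤ seq y n))

private
  left : ∀ M N {n} → M ⊔ N ℕ.≤ n → M ℕ.≤ n
  left M N = ℕ.m⊔n≤o⇒m≤o M N

  right : ∀ M N {n} → M ⊔ N ℕ.≤ n → N ℕ.≤ n
  right M N = ℕ.m⊔n≤o⇒n≤o M N

  halve : ∀ ε → 0ℚ ℚ.< ε → ∃[ δ ] (0ℚ ℚ.< δ × δ ℚ.+ δ ≡ ε)
  halve ε 0<ε =
    ½ ℚ.* ε ,
    subst (ℚ._< ½ ℚ.* ε) (ℚ.*-zeroʳ ½) (ℚ.*-monoʳ-<-pos ½ {0ℚ} {ε} 0<ε) ,
    trans (sym (ℚ.*-distribʳ-+ ε ½ ½)) (ℚ.*-identityˡ ε)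

  divide : ∀ B ε → 0ℚ ℚ.< B → 0ℚ ℚ.< ε → ∃[ δ ] (0ℚ ℚ.< δ × B ℚ.* δ ≡ ε)
  divide B ε 0<B 0<ε =
    B⁻¹ ℚ.* ε ,
    subst (ℚ._< B⁻¹ ℚ.* ε) (ℚ.*-zeroʳ B⁻¹)
      (ℚ.*-monoʳ-<-pos B⁻¹ {{ℚ.1/pos⇒pos B}} {0ℚ} {ε} 0<ε) ,
    trans (sym (ℚ.*-assoc B B⁻¹ ε))
      (trans (cong (ℚ._* ε) (ℚ.*-inverseʳ B)) (ℚ.*-identityˡ ε))
    where
    instance
      B-pos : ℚ.Positive B
      B-pos = ℚ.positive 0<B
      B-nonZero : ℚ.NonZero B
      B-nonZero = ℚ.pos⇒nonZero B
    B⁻¹ : ℚ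
    B⁻¹ = ℚ.1/ B

  bounded : ∀ x → IsCauchy x →
    ∃[ B ] (0ℚ ℚ.< B × ∃[ N ] (∀ n → N ℕ.≤ n → ∣ x n ∣ ℚ.≤ B))
  bounded x cx with cx 1ℚ (ℚ.positive⁻¹ 1ℚ)
  ... | N , near =
    1ℚ ℚ.+ ∣ x N ∣ ,
    ℚ.+-mono-<-≤ (ℚ.positive⁻¹ 1ℚ) (ℚ.0≤∣p∣ (x N)) ,
    N ,
    λ n N≤n → begin
      ∣ x n ∣                          ≡⟨ cong ∣_∣ (split (x n) (x N)) ⟩
      ∣ (x n ℚ.- x N) ℚ.+ x N ∣        ≤⟨ ℚ.∣p+q∣≤∣p∣+∣q∣ (x n ℚ.- x N) (x N) ⟩
      ∣ x n ℚ.- x N ∣ ℚ.+ ∣ x N ∣      ≤⟨ ℚ.+-monoˡ-≤ ∣ x N ∣ (ℚ.<⇒≤ (near n N N≤n ℕ.≤-refl)) ⟩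
      1ℚ ℚ.+ ∣ x N ∣                   ∎
    where
    open ℚ.≤-Reasoning
    split : ∀ p q → p ≡ (p ℚ.- q) ℚ.+ q
    split = solve 2 (λ p q → p := (p :- q) :+ q) refl
      where open +-*-Solver

  const-cauchy : ∀ q → IsCauchy (λ _ → q)
  const-cauchy q ε 0<ε =
    0 , λ _ _ _ _ → subst (λ p → ∣ p ∣ ℚ.< ε) (sym (ℚ.+-inverseʳ q)) 0<ε

  +-cauchy : ∀ x y → IsCauchy x → IsCauchy y → IsCauchy (λ n → x n ℚ.+ y n)
  +-cauchy x y cx cy ε 0<ε
    with halve ε 0<ε
  ... | δ , 0<δ , δ+δ≡ε
    with cx δ 0<δ | cy δ 0<δ
  ... | N₁ , near₁ | N₂ , near₂ = N₁ ⊔ N₂ , λ m n ≤m ≤n → begin-strict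
      ∣ (x m ℚ.+ y m) ℚ.- (x n ℚ.+ y n) ∣
        ≡⟨ cong ∣_∣ (regroup (x m) (y m) (x n) (y n)) ⟩
      ∣ (x m ℚ.- x n) ℚ.+ (y m ℚ.- y n) ∣
        ≤⟨ ℚ.∣p+q∣≤∣p∣+∣q∣ (x m ℚ.- x n) (y m ℚ.- y n) ⟩
      ∣ x m ℚ.- x n ∣ ℚ.+ ∣ y m ℚ.- y n ∣
        <⟨ ℚ.+-mono-<
             (near₁ m n (left N₁ N₂ ≤m) (left N₁ N₂ ≤n))
             (near₂ m n (right N₁ N₂ ≤m) (right N₁ N₂ ≤n)) ⟩
      δ ℚ.+ δ
        ≡⟨ δ+δ≡ε ⟩
      ε ∎
    where
    open ℚ.≤-Reasoning
    regroup : ∀ a b c d → (a ℚ.+ b) ℚ.- (c ℚ.+ d) ≡ (a ℚ.- c) ℚ.+ (b ℚ.- d)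
    regroup = solve 4 (λ a b c d → (a :+ b) :- (c :+ d) := (a :- c) :+ (b :- d)) refl
      where open +-*-Solver

  neg-cauchy : ∀ x → IsCauchy x → IsCauchy (λ n → ℚ.- x n)
  neg-cauchy x cx ε 0<ε with cx ε 0<ε
  ... | N , near = N , λ m n ≤m ≤n →
    subst (ℚ._< ε)
      (sym (trans (cong ∣_∣ (regroup (x m) (x n))) (ℚ.∣-p∣≡∣p∣ (x m ℚ.- x n))))
      (near m n ≤m ≤n)
    where
    regroup : ∀ a b → (ℚ.- a) ℚ.- (ℚ.- b) ≡ ℚ.- (a ℚ.- b)
    regroup = solve 2 (λ a b → (:- a) :- (:- b) := :- (a :- b)) refl
      where open +-*-Solver

  product-bound : ∀ {B δ η} → 0ℚ ℚ.< B → B ℚ.* δ ≡ η →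
    ∀ p q → ∣ p ∣ ℚ.≤ B → ∣ q ∣ ℚ.< δ → ∣ p ℚ.* q ∣ ℚ.< η
  product-bound {B} {δ} {η} 0<B Bδ≡η p q p≤B q<δ = begin-strict
    ∣ p ℚ.* q ∣        ≡⟨ ℚ.∣p*q∣≡∣p∣*∣q∣ p q ⟩
    ∣ p ∣ ℚ.* ∣ q ∣    ≤⟨ ℚ.*-monoʳ-≤-nonNeg ∣ q ∣ {{ℚ.nonNegative (ℚ.0≤∣p∣ q)}} p≤B ⟩
    B ℚ.* ∣ q ∣        <⟨ ℚ.*-monoʳ-<-pos B {{ℚ.positive 0<B}} q<δ ⟩
    B ℚ.* δ            ≡⟨ Bδ≡η ⟩
    η                  ∎
    where open ℚ.≤-Reasoning

  difference-of-products : ∀ {η ε} → η ℚ.+ η ≡ ε → ∀ a b c d →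
    ∣ a ℚ.* (b ℚ.- d) ∣ ℚ.< η → ∣ d ℚ.* (a ℚ.- c) ∣ ℚ.< η →
    ∣ a ℚ.* b ℚ.- c ℚ.* d ∣ ℚ.< ε
  difference-of-products {η} {ε} η+η≡ε a b c d p<η q<η = begin-strict
    ∣ a ℚ.* b ℚ.- c ℚ.* d ∣                          ≡⟨ cong ∣_∣ (regroup a b c d) ⟩
    ∣ a ℚ.* (b ℚ.- d) ℚ.+ d ℚ.* (a ℚ.- c) ∣          ≤⟨ ℚ.∣p+q∣≤∣p∣+∣q∣ (a ℚ.* (b ℚ.- d)) (d ℚ.* (a ℚ.- c)) ⟩
    ∣ a ℚ.* (b ℚ.- d) ∣ ℚ.+ ∣ d ℚ.* (a ℚ.- c) ∣      <⟨ ℚ.+-mono-< p<η q<η ⟩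
    η ℚ.+ η                                          ≡⟨ η+η≡ε ⟩
    ε                                                ∎
    where
    open ℚ.≤-Reasoning
    regroup : ∀ a b c d →
      a ℚ.* b ℚ.- c ℚ.* d ≡ a ℚ.* (b ℚ.- d) ℚ.+ d ℚ.* (a ℚ.- c)
    regroup = solve 4
      (λ a b c d → a :* b :- c :* d := a :* (b :- d) :+ d :* (a :- c)) refl
      where open +-*-Solver

  *-cauchy : ∀ x y → IsCauchy x → IsCauchy y → IsCauchy (λ n → x n ℚ.* y n)
  *-cauchy x y cx cy ε 0<ε =
    let Bx , 0<Bx , M₁ , x≤Bx = bounded x cx
        By , 0<By , M₂ , y≤By = bounded y cy
        η , 0<η , η+η≡ε = halve ε 0<ε
        δy , 0<δy , Bxδy≡η = divide Bx η 0<Bx 0<η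
        δx , 0<δx , Byδx≡η = divide By η 0<By 0<η
        N₁ , near₁ = cx δx 0<δx
        N₂ , near₂ = cy δy 0<δy
        first  = λ n (p : M₁ ⊔ M₂ ⊔ (N₁ ⊔ N₂) ℕ.≤ n) → left (M₁ ⊔ M₂) (N₁ ⊔ N₂) p
        second = λ n (p : M₁ ⊔ M₂ ⊔ (N₁ ⊔ N₂) ℕ.≤ n) → right (M₁ ⊔ M₂) (N₁ ⊔ N₂) p
    in M₁ ⊔ M₂ ⊔ (N₁ ⊔ N₂) , λ m n ≤m ≤n →
      difference-of-products η+η≡ε (x m) (y m) (x n) (y n)
        (product-bound 0<Bx Bxδy≡η (x m) (y m ℚ.- y n)
          (x≤Bx m (left M₁ M₂ (first m ≤m)))
          (near₂ m n (right N₁ N₂ (second m ≤m)) (right N₁ N₂ (second n ≤n))))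
        (product-bound 0<By Byδx≡η (y n) (x m ℚ.- x n)
          (y≤By n (right M₁ M₂ (first n ≤n)))
          (near₁ m n (left N₁ N₂ (second m ≤m)) (left N₁ N₂ (second n ≤n))))

infix  8 -_
infixl 7 _*_
infixl 6 _+_

_+_ _*_ : ℝ → ℝ → ℝ
seq    (x + y) n = seq x n ℚ.+ seq y n
cauchy (x + y)   = +-cauchy (seq x) (seq y) (cauchy x) (cauchy y)
seq    (x * y) n = seq x n ℚ.* seq y n
cauchy (x * y)   = *-cauchy (seq x) (seq y) (cauchy x) (cauchy y)

-_ : ℝ → ℝ
seq    (- x) n = ℚ.- seq x n
cauchy (- x)   = neg-cauchy (seq x) (cauchy x)

fromℚ : ℚ → ℝ
seq    (fromℚ q) _ = q
cauchy (fromℚ q)   = const-cauchy q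

fromℤ : ℤ → ℝ
fromℤ i = fromℚ (i ℚ./ 1)

0ℝ 1ℝ : ℝ
0ℝ = fromℚ 0ℚ
1ℝ = fromℚ 1ℚ

ℝ-rawRing : RawRing 0ℓ 0ℓ
ℝ-rawRing = record
  { Carrier = ℝ
  ; _≈_     = _≈_
  ; _+_     = _+_
  ; _*_     = _*_
  ; -_      = -_
  ; 0#      = 0ℝ
  ; 1#      = 1ℝ
  }

open RawMonoidDefinitions (RawRing.+-rawMonoid ℝ-rawRing) public using (sum)
open RawSemiringDefinitions (RawRing.rawSemiring ℝ-rawRing) public using (_^_)

record ℂ : Set where
  constructor _+i_
  field
    re : ℝ
    im : ℝ

open ℂ public

ℂ-rawRing : RawRing 0ℓ 0ℓ
ℂ-rawRing = record
  { Carrier = ℂ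
  ; _≈_     = λ z w → re z ≈ re w × im z ≈ im w
  ; _+_     = λ z w → (re z + re w) +i (im z + im w)
  ; _*_     = λ z w → (re z * re w + - (im z * im w)) +i (re z * im w + im z * re w)
  ; -_      = λ z → (- re z) +i (- im z)
  ; 0#      = 0ℝ +i 0ℝ
  ; 1#      = 1ℝ +i 0ℝ
  }

record IsSubfield (K : Pred ℝ ℓ) : Set ℓ where
  field
    resp       : ∀ {x y} → x ≈ y → x ∈ K → y ∈ K
    0-closed   : 0ℝ ∈ K
    1-closed   : 1ℝ ∈ K
    +-closed   : ∀ {x y} → x ∈ K → y ∈ K → x + y ∈ K
    *-closed   : ∀ {x y} → x ∈ K → y ∈ K → x * y ∈ K
    neg-closed : ∀ {x} → x ∈ K → - x ∈ K
    -- y is the inverse of x, so x is automatically nonzero.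
    inv-closed : ∀ {x y} → x ∈ K → x * y ≈ 1ℝ → y ∈ K

  rawRing : RawRing ℓ 0ℓ
  rawRing = record
    { Carrier = Σ ℝ K
    ; _≈_     = λ x y → proj₁ x ≈ proj₁ y
    ; _+_     = λ (x , x∈K) (y , y∈K) → x + y , +-closed x∈K y∈K
    ; _*_     = λ (x , x∈K) (y , y∈K) → x * y , *-closed x∈K y∈K
    ; -_      = λ (x , x∈K) → - x , neg-closed x∈K
    ; 0#      = 0ℝ , 0-closed
    ; 1#      = 1ℝ , 1-closed
    }

-- The subfield ℚ(α) of ℝ: the closure of {α} under the field operations.
data ℚ⟨_⟩ (α : ℝ) : Pred ℝ 0ℓ where
  gen        : α ∈ ℚ⟨ α ⟩
  resp       : ∀ {x y} → x ≈ y → x ∈ ℚ⟨ α ⟩ → y ∈ ℚ⟨ α ⟩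
  0-closed   : 0ℝ ∈ ℚ⟨ α ⟩
  1-closed   : 1ℝ ∈ ℚ⟨ α ⟩
  +-closed   : ∀ {x y} → x ∈ ℚ⟨ α ⟩ → y ∈ ℚ⟨ α ⟩ → x + y ∈ ℚ⟨ α ⟩
  *-closed   : ∀ {x y} → x ∈ ℚ⟨ α ⟩ → y ∈ ℚ⟨ α ⟩ → x * y ∈ ℚ⟨ α ⟩
  neg-closed : ∀ {x} → x ∈ ℚ⟨ α ⟩ → - x ∈ ℚ⟨ α ⟩
  inv-closed : ∀ {x y} → x ∈ ℚ⟨ α ⟩ → x * y ≈ 1ℝ → y ∈ ℚ⟨ α ⟩

IsPrimitiveElement : Pred ℝ ℓ → ℝ → Set ℓ
IsPrimitiveElement K α = K ≐ ℚ⟨ α ⟩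

linComb : ∀ {n} → Vector ℚ n → Vector ℝ n → ℝ
linComb q b = sum (λ i → fromℚ (q i) * b i)

record IsℚBasis (K : Pred ℝ ℓ) {n : ℕ} (b : Vector ℝ n) : Set ℓ where
  field
    member      : ∀ i → b i ∈ K
    spanning    : ∀ {x} → x ∈ K → ∃[ q ] x ≈ linComb q b
    independent : ∀ q → linComb q b ≈ 0ℝ → ∀ i → q i ≡ 0ℚ

HasDegree : Pred ℝ ℓ → ℕ → Set ℓ
HasDegree K n = ∃[ b ] IsℚBasis K {n} b

record IsTotallyRealCubic (K : Pred ℝ ℓ) : Set ℓ where
  field
    isSubfield : IsSubfield K
    degree     : HasDegree K 3

  open IsSubfield isSubfield using (rawRing)
  open RingMorphisms rawRing ℂ-rawRing using (IsRingMonomorphism)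

  field
    embeddings-real : ∀ (σ : Σ ℝ K → ℂ) → IsRingMonomorphism σ →
                      ∀ x → im (σ x) ≈ 0ℝ

I³ᵗʳ : ℤ → ℤ → Pred ℝ 0ℓ
I³ᵗʳ m n α =
  (0ℝ < α × α < 1ℝ) ×
  ∃[ d ] (1ℤ ℤ.≤ d × d ℤ.≤ ℤ.- m ℤ.- n ℤ.- + 2 ×
    α ^ 3 + fromℤ m * α ^ 2 + fromℤ n * α + fromℤ d ≈ 0ℝ)

S³ᵗʳ : ℤ → Pred ℝ 0ℓ
S³ᵗʳ m α = ∃[ n ] (n ℤ.≤ ℤ.- m ℤ.- + 3 × α ∈ I³ᵗʳ m n)

{-# OPTIONS --safe #-}
-- Let θ be an integral element of trace 0 generating K over ℚ. The elements
-- w = aθ + b(3θ² + 2n) with a, b ∈ ℤ are integral of trace 0, and since they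
-- form a subgroup of rank 2 of ℝ, Euclid's algorithm finds one in (0,1). It is
-- irrational, so it generates K (3 is prime), and it is a root of some
-- f = X³ + nX + d over ℤ. If n ≥ 1, then f has a nonreal root, which yields a
-- nonreal embedding of K; the values n = 0, -1, -2 leave no root of an
-- irreducible f in (0,1). Hence n ≤ -3, and then f(0) > 0 > f(1). Replacing w by
-- 1 - w turns f(X) into -f(1 - X), which passes from m = 0 to m = -3.

module Submission where

open import Defs
open import Algebra.Bundles using (CommutativeRing)
open import Algebra.Morphism.Structures using (module RingMorphisms)
import Algebra.Solver.Ring as RingSolver
import Algebra.Solver.Ring.AlmostCommutativeRing as ACR
open import Data.Empty using (⊥-elim)
open import Data.Fin.Base using (Fin; zero; suc)
open import Data.Integer.Base as ℤ using (ℤ; +_; -[1+_])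
import Data.Integer.Properties as ℤ
open import Data.Integer.Solver using () renaming (module +-*-Solver to ℤ-Solver)
open import Data.Maybe.Base using (Maybe; just; nothing)
open import Data.Nat.Base as ℕ using (ℕ; zero; suc; _⊔_)
import Data.Nat.Properties as ℕ
open import Data.Nat.Coprimality using (1-coprimeTo) renaming (sym to coprime-sym)
open import Data.Product.Base using (Σ; ∃-syntax; _×_; _,_; proj₁; proj₂)
open import Data.Rational.Base as ℚ using (ℚ; mkℚ; 0ℚ; 1ℚ; ½; ∣_∣)
import Data.Rational.Properties as ℚ
open import Data.Rational.Solver using (module +-*-Solver)
import Data.Rational.Unnormalised.Base as ℚᵘ
open import Data.Sum.Base using (_⊎_; inj₁; inj₂; [_,_]′)
open import Data.Vec.Functional using (Vector; []; _∷_; tail)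
open import Function.Base using (_∘_; case_of_)
open import Level using (0ℓ)
open import Relation.Binary.Definitions using (tri<; tri≈; tri>)
open import Relation.Binary.PropositionalEquality
  using (_≡_; _≢_; refl; sym; trans; cong; cong₂; subst; subst₂)
open import Relation.Nullary using (¬_; Dec; yes; no)
open import Relation.Unary using (Pred; _∈_)

-- The commutative ring ℝ

-- The order on ℝ is not decidable, yet Euclid's algorithm has to compare numbers. Two substitutes
-- make it run. An irrational element of K satisfies a cubic relation that exhibits its inverse, and
-- an invertible real has a sign; nonzero lattice elements are irrational because 1, θ, θ² are
-- independent over ℚ, so the comparisons in the division step all concern invertible numbers. Where
-- a remainder should be compared with half of the divisor, cotransitivity of the order is enough.
--
-- Rank 2 is essential: a cyclic group of reals may miss (0,1), while two independent generators
-- leave a nonzero remainder at every stage, so the descent can go on until it falls below 1.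
--
-- Total reality speaks about all embeddings, so a nonreal one has to be produced as an actual map
-- on K. It is defined through coordinates with respect to 1, w, w², and its imaginary part needs a
-- square root constructed as a Cauchy sequence.

Eventually : (ℕ → Set) → Set
Eventually P = ∃[ N ] (∀ n → N ℕ.≤ n → P n)

eventually-map : ∀ {P Q : ℕ → Set} → (∀ n → P n → Q n) → Eventually P → Eventually Q
eventually-map f (N , p) = N , λ n N≤n → f n (p n N≤n)

eventually-zip : ∀ {P Q R : ℕ → Set} → (∀ n → P n → Q n → R n) →
                 Eventually P → Eventually Q → Eventually R
eventually-zip f (M , p) (N , q) = M ⊔ N , λ n ≤n →
  f n (p n (ℕ.m⊔n≤o⇒m≤o M N ≤n)) (q n (ℕ.m⊔n≤o⇒n≤o M N ≤n))

eventually-const : ∀ {A : Set} → Eventually (λ _ → A) → A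
eventually-const (N , p) = p N ℕ.≤-refl

divide : ∀ B ε → 0ℚ ℚ.< B → 0ℚ ℚ.< ε → ∃[ δ ] (0ℚ ℚ.< δ × B ℚ.* δ ≡ ε)
divide B ε 0<B 0<ε =
  B⁻¹ ℚ.* ε ,
  subst (ℚ._< B⁻¹ ℚ.* ε) (ℚ.*-zeroʳ B⁻¹)
    (ℚ.*-monoʳ-<-pos B⁻¹ {{ℚ.1/pos⇒pos B}} {0ℚ} {ε} 0<ε) ,
  trans (sym (ℚ.*-assoc B B⁻¹ ε))
    (trans (cong (ℚ._* ε) (ℚ.*-inverseʳ B)) (ℚ.*-identityˡ ε))
  where
  instance
    B-pos : ℚ.Positive B
    B-pos = ℚ.positive 0<B
    B-nonZero : ℚ.NonZero B
    B-nonZero = ℚ.pos⇒nonZero B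
  B⁻¹ : ℚ
  B⁻¹ = ℚ.1/ B

halve : ∀ ε → 0ℚ ℚ.< ε → ∃[ δ ] (0ℚ ℚ.< δ × δ ℚ.+ δ ≡ ε)
halve ε 0<ε =
  let δ , 0<δ , eq = divide (1ℚ ℚ.+ 1ℚ) ε (ℚ.positive⁻¹ (1ℚ ℚ.+ 1ℚ)) 0<ε
  in δ , 0<δ , trans (sym (double δ)) eq
  where
  double : ∀ δ → (1ℚ ℚ.+ 1ℚ) ℚ.* δ ≡ δ ℚ.+ δ
  double = solve 1 (λ δ → con (1ℚ ℚ.+ 1ℚ) :* δ := δ :+ δ) refl
    where open +-*-Solver

bounded : ∀ x → ∃[ B ] (0ℚ ℚ.< B × Eventually (λ n → ∣ seq x n ∣ ℚ.≤ B))
bounded x =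
  let N , near = cauchy x 1ℚ (ℚ.positive⁻¹ 1ℚ) in
  1ℚ ℚ.+ ∣ seq x N ∣ ,
  ℚ.+-mono-<-≤ (ℚ.positive⁻¹ 1ℚ) (ℚ.0≤∣p∣ (seq x N)) ,
  N ,
  λ n N≤n → begin
    ∣ seq x n ∣                                  ≡⟨ cong ∣_∣ (split (seq x n) (seq x N)) ⟩
    ∣ (seq x n ℚ.- seq x N) ℚ.+ seq x N ∣        ≤⟨ ℚ.∣p+q∣≤∣p∣+∣q∣ (seq x n ℚ.- seq x N) (seq x N) ⟩
    ∣ seq x n ℚ.- seq x N ∣ ℚ.+ ∣ seq x N ∣      ≤⟨ ℚ.+-monoˡ-≤ ∣ seq x N ∣ (ℚ.<⇒≤ (near n N N≤n ℕ.≤-refl)) ⟩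
    1ℚ ℚ.+ ∣ seq x N ∣                           ∎
  where
  open ℚ.≤-Reasoning
  split : ∀ p q → p ≡ (p ℚ.- q) ℚ.+ q
  split = solve 2 (λ p q → p := (p :- q) :+ q) refl
    where open +-*-Solver

-- `x ≈ y` is by definition nullity of the termwise difference, so the ring congruences reduce to
-- closure properties of null sequences.
Null : (ℕ → ℚ) → Set
Null f = ∀ ε → 0ℚ ℚ.< ε → Eventually (λ n → ∣ f n ∣ ℚ.< ε)

null-ext : ∀ {f g} → (∀ n → f n ≡ g n) → Null f → Null g
null-ext f≡g nf ε 0<ε = eventually-map (λ n → subst (λ p → ∣ p ∣ ℚ.< ε) (f≡g n)) (nf ε 0<ε)

null-+ : ∀ {f g} → Null f → Null g → Null (λ n → f n ℚ.+ g n)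
null-+ {f} {g} nf ng ε 0<ε =
  let δ , 0<δ , δ+δ≡ε = halve ε 0<ε in eventually-zip
  (λ n f<δ g<δ → subst (∣ f n ℚ.+ g n ∣ ℚ.<_) δ+δ≡ε
    (ℚ.≤-<-trans (ℚ.∣p+q∣≤∣p∣+∣q∣ (f n) (g n)) (ℚ.+-mono-< f<δ g<δ)))
  (nf δ 0<δ) (ng δ 0<δ)

null-neg : ∀ {f} → Null f → Null (λ n → ℚ.- f n)
null-neg {f} nf ε 0<ε = eventually-map
  (λ n → subst (ℚ._< ε) (sym (ℚ.∣-p∣≡∣p∣ (f n)))) (nf ε 0<ε)

null-* : ∀ x {f} → Null f → Null (λ n → seq x n ℚ.* f n)
null-* x {f} nf ε 0<ε =
  let B , 0<B , x≤B = bounded x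
      δ , 0<δ , Bδ≡ε = divide B ε 0<B 0<ε
  in eventually-zip (λ n → step B δ 0<B Bδ≡ε (seq x n) (f n)) x≤B (nf δ 0<δ)
  where
  open ℚ.≤-Reasoning
  step : ∀ B δ → 0ℚ ℚ.< B → B ℚ.* δ ≡ ε → ∀ p q →
         ∣ p ∣ ℚ.≤ B → ∣ q ∣ ℚ.< δ → ∣ p ℚ.* q ∣ ℚ.< ε
  step B δ 0<B Bδ≡ε p q p≤B q<δ = begin-strict
    ∣ p ℚ.* q ∣        ≡⟨ ℚ.∣p*q∣≡∣p∣*∣q∣ p q ⟩
    ∣ p ∣ ℚ.* ∣ q ∣    ≤⟨ ℚ.*-monoʳ-≤-nonNeg ∣ q ∣ {{ℚ.nonNegative (ℚ.0≤∣p∣ q)}} p≤B ⟩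
    B ℚ.* ∣ q ∣        <⟨ ℚ.*-monoʳ-<-pos B {{ℚ.positive 0<B}} q<δ ⟩
    B ℚ.* δ            ≡⟨ Bδ≡ε ⟩
    ε                  ∎

-- _≈_ unfolds to a Π-type that does not determine x and y; the wrapper makes
-- them inferable.
infix 4 _≃_

record _≃_ (x y : ℝ) : Set where
  constructor wrap
  field unwrap : x ≈ y

open _≃_ public

pointwise : ∀ {x y} → (∀ n → seq x n ≡ seq y n) → x ≃ y
pointwise {x} {y} x≡y = wrap λ ε 0<ε → 0 , λ n _ →
  subst (λ p → ∣ p ∣ ℚ.< ε)
    (sym (trans (cong (ℚ._- seq y n) (x≡y n)) (ℚ.+-inverseʳ (seq y n)))) 0<ε

≃-sym : ∀ {x y} → x ≃ y → y ≃ x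
≃-sym {x} {y} (wrap x≈y) =
  wrap (null-ext (λ n → flip-difference (seq x n) (seq y n)) (null-neg x≈y))
  where
  flip-difference : ∀ a b → ℚ.- (a ℚ.- b) ≡ b ℚ.- a
  flip-difference = solve 2 (λ a b → :- (a :- b) := b :- a) refl
    where open +-*-Solver

≃-trans : ∀ {x y z} → x ≃ y → y ≃ z → x ≃ z
≃-trans {x} {y} {z} (wrap x≈y) (wrap y≈z) =
  wrap (null-ext (λ n → telescope (seq x n) (seq y n) (seq z n)) (null-+ x≈y y≈z))
  where
  telescope : ∀ a b c → (a ℚ.- b) ℚ.+ (b ℚ.- c) ≡ a ℚ.- c
  telescope = solve 3 (λ a b c → (a :- b) :+ (b :- c) := a :- c) refl
    where open +-*-Solver

+-cong : ∀ {x x′ y y′} → x ≃ x′ → y ≃ y′ → x + y ≃ x′ + y′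
+-cong {x} {x′} {y} {y′} (wrap x≈x′) (wrap y≈y′) = wrap (null-ext
  (λ n → regroup (seq x n) (seq x′ n) (seq y n) (seq y′ n)) (null-+ x≈x′ y≈y′))
  where
  regroup : ∀ a a′ b b′ → (a ℚ.- a′) ℚ.+ (b ℚ.- b′) ≡ (a ℚ.+ b) ℚ.- (a′ ℚ.+ b′)
  regroup = solve 4 (λ a a′ b b′ → (a :- a′) :+ (b :- b′) := (a :+ b) :- (a′ :+ b′)) refl
    where open +-*-Solver

-‿cong : ∀ {x y} → x ≃ y → - x ≃ - y
-‿cong {x} {y} (wrap x≈y) =
  wrap (null-ext (λ n → regroup (seq x n) (seq y n)) (null-neg x≈y))
  where
  regroup : ∀ a b → ℚ.- (a ℚ.- b) ≡ (ℚ.- a) ℚ.- (ℚ.- b)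
  regroup = solve 2 (λ a b → :- (a :- b) := (:- a) :- (:- b)) refl
    where open +-*-Solver

*-cong : ∀ {x x′ y y′} → x ≃ x′ → y ≃ y′ → x * y ≃ x′ * y′
*-cong {x} {x′} {y} {y′} (wrap x≈x′) (wrap y≈y′) = wrap (null-ext
  (λ n → regroup (seq x n) (seq x′ n) (seq y n) (seq y′ n))
  (null-+ (null-* x y≈y′) (null-* y′ x≈x′)))
  where
  regroup : ∀ a a′ b b′ →
    a ℚ.* (b ℚ.- b′) ℚ.+ b′ ℚ.* (a ℚ.- a′) ≡ a ℚ.* b ℚ.- a′ ℚ.* b′
  regroup = solve 4
    (λ a a′ b b′ → a :* (b :- b′) :+ b′ :* (a :- a′) := a :* b :- a′ :* b′) refl
    where open +-*-Solver

ℝ-commutativeRing : CommutativeRing 0ℓ 0ℓ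
ℝ-commutativeRing = record
  { Carrier = ℝ ; _≈_ = _≃_ ; _+_ = _+_ ; _*_ = _*_ ; -_ = -_ ; 0# = 0ℝ ; 1# = 1ℝ
  ; isCommutativeRing = record
    { isRing = record
      { +-isAbelianGroup = record
        { isGroup = record
          { isMonoid = record
            { isSemigroup = record
              { isMagma = record
                { isEquivalence = record
                  { refl = pointwise (λ _ → refl) ; sym = ≃-sym ; trans = ≃-trans }
                ; ∙-cong = +-cong
                }
              ; assoc = λ x y z → pointwise (λ n → ℚ.+-assoc (seq x n) (seq y n) (seq z n))
              }
            ; identity =
                (λ x → pointwise (λ n → ℚ.+-identityˡ (seq x n))) ,
                (λ x → pointwise (λ n → ℚ.+-identityʳ (seq x n)))
            }
          ; inverse =
              (λ x → pointwise (λ n → ℚ.+-inverseˡ (seq x n))) ,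
              (λ x → pointwise (λ n → ℚ.+-inverseʳ (seq x n)))
          ; ⁻¹-cong = -‿cong
          }
        ; comm = λ x y → pointwise (λ n → ℚ.+-comm (seq x n) (seq y n))
        }
      ; *-cong = *-cong
      ; *-assoc = λ x y z → pointwise (λ n → ℚ.*-assoc (seq x n) (seq y n) (seq z n))
      ; *-identity =
          (λ x → pointwise (λ n → ℚ.*-identityˡ (seq x n))) ,
          (λ x → pointwise (λ n → ℚ.*-identityʳ (seq x n)))
      ; distrib =
          (λ x y z → pointwise (λ n → ℚ.*-distribˡ-+ (seq x n) (seq y n) (seq z n))) ,
          (λ x y z → pointwise (λ n → ℚ.*-distribʳ-+ (seq x n) (seq y n) (seq z n)))
      }
    ; *-comm = λ x y → pointwise (λ n → ℚ.*-comm (seq x n) (seq y n))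
    }
  }

module R = CommutativeRing ℝ-commutativeRing

fromℚ-cong : ∀ {p q} → p ≡ q → fromℚ p ≃ fromℚ q
fromℚ-cong refl = R.refl

-- The operations of ℝ act termwise, so on constant sequences both sides compute to the same
-- rational. The same argument `pointwise (λ _ → refl)` later converts between a rational expression
-- inside `fromℚ` and the real expression that the solver handles.
fromℚ-+ : ∀ p q → fromℚ (p ℚ.+ q) ≃ fromℚ p + fromℚ q
fromℚ-+ p q = pointwise (λ _ → refl)

fromℚ-* : ∀ p q → fromℚ (p ℚ.* q) ≃ fromℚ p * fromℚ q
fromℚ-* p q = pointwise (λ _ → refl)

fromℚ-neg : ∀ p → fromℚ (ℚ.- p) ≃ - fromℚ p
fromℚ-neg p = pointwise (λ _ → refl)

fromℚ-morphism :
  ℚ.+-*-rawRing ACR.-Raw-AlmostCommutative⟶ ACR.fromCommutativeRing ℝ-commutativeRing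
fromℚ-morphism = record
  { ⟦_⟧ = fromℚ ; +-homo = fromℚ-+ ; *-homo = fromℚ-* ; -‿homo = fromℚ-neg
  ; 0-homo = R.refl ; 1-homo = R.refl }

fromℚ≟ : ∀ p q → Maybe (fromℚ p ≃ fromℚ q)
fromℚ≟ p q with p ℚ.≟ q
... | yes p≡q = just (fromℚ-cong p≡q)
... | no  _   = nothing

module ℝ-Solver = RingSolver ℚ.+-*-rawRing
  (ACR.fromCommutativeRing ℝ-commutativeRing) fromℚ-morphism fromℚ≟

-- Order on ℝ

-- The solver proves only equations. An estimate is therefore obtained from a known inequality with
-- the same difference of sides, and equality of the differences is left to the solver.
≤-by : ∀ {p q s t} → p ℚ.≤ q → t ≡ s ℚ.+ (q ℚ.- p) → s ℚ.≤ t
≤-by {p} {q} {s} {t} p≤q t≡ = subst₂ ℚ._≤_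
  (cancel s p) (sym t≡)
  (ℚ.+-monoʳ-≤ s (ℚ.+-monoˡ-≤ (ℚ.- p) p≤q))
  where
  cancel : ∀ s p → s ℚ.+ (p ℚ.- p) ≡ s
  cancel = solve 2 (λ s p → s :+ (p :- p) := s) refl
    where open +-*-Solver

<-by : ∀ {p q s t} → p ℚ.< q → t ≡ s ℚ.+ (q ℚ.- p) → s ℚ.< t
<-by {p} {q} {s} {t} p<q t≡ = subst₂ ℚ._<_
  (cancel s p) (sym t≡)
  (ℚ.+-monoʳ-< s (ℚ.+-monoˡ-< (ℚ.- p) p<q))
  where
  cancel : ∀ s p → s ℚ.+ (p ℚ.- p) ≡ s
  cancel = solve 2 (λ s p → s :+ (p :- p) := s) refl
    where open +-*-Solver

p≤∣p∣ : ∀ p → p ℚ.≤ ∣ p ∣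
p≤∣p∣ p with ℚ.≤-total 0ℚ p
... | inj₁ 0≤p = ℚ.≤-reflexive (sym (ℚ.0≤p⇒∣p∣≡p 0≤p))
... | inj₂ p≤0 = ℚ.≤-trans p≤0 (ℚ.0≤∣p∣ p)

-p≤∣p∣ : ∀ p → ℚ.- p ℚ.≤ ∣ p ∣
-p≤∣p∣ p = subst (ℚ.- p ℚ.≤_) (ℚ.∣-p∣≡∣p∣ p) (p≤∣p∣ (ℚ.- p))

∣p∣<q : ∀ {p q} → p ℚ.< q → ℚ.- p ℚ.< q → ∣ p ∣ ℚ.< q
∣p∣<q {p} {q} p<q -p<q with ℚ.∣p∣≡p∨∣p∣≡-p p
... | inj₁ eq = subst (ℚ._< q) (sym eq) p<q
... | inj₂ eq = subst (ℚ._< q) (sym eq) -p<q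

-- Inequalities are carried as positivity of a difference: a bound is then proved by writing the
-- difference, through a ring identity, as a sum of products of positive elements.
record Pos (x : ℝ) : Set where
  constructor mkPos
  field
    gap     : ℚ
    0<gap   : 0ℚ ℚ.< gap
    gap≤    : Eventually (λ n → gap ℚ.≤ seq x n)

pos⇒< : ∀ {x y} → Pos (y + - x) → x < y
pos⇒< {x} {y} (mkPos ε 0<ε ε≤) = ε , 0<ε ,
  eventually-map (λ n le → ≤-by le (regroup (seq x n) (seq y n) ε)) ε≤
  where
  regroup : ∀ x y ε → y ≡ (x ℚ.+ ε) ℚ.+ ((y ℚ.+ (ℚ.- x)) ℚ.- ε)
  regroup = solve 3 (λ x y ε → y := (x :+ ε) :+ ((y :+ (:- x)) :- ε)) refl
    where open +-*-Solver

pos-resp : ∀ {x y} → x ≃ y → Pos x → Pos y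
pos-resp {x} {y} (wrap x≈y) (mkPos ε 0<ε ε≤) =
  let δ , 0<δ , δ+δ≡ε = halve ε 0<ε in
  mkPos δ 0<δ (eventually-zip
    (λ n ε≤x ∣x-y∣<δ → ≤-by
      (ℚ.+-mono-≤ ε≤x (ℚ.≤-trans (p≤∣p∣ (seq x n ℚ.- seq y n)) (ℚ.<⇒≤ ∣x-y∣<δ)))
      (trans (regroup (seq x n) (seq y n) δ)
        (cong (λ e → δ ℚ.+ ((seq x n ℚ.+ δ) ℚ.- (e ℚ.+ (seq x n ℚ.- seq y n)))) δ+δ≡ε)))
    ε≤ (x≈y δ 0<δ))
  where
  regroup : ∀ x y δ → y ≡ δ ℚ.+ ((x ℚ.+ δ) ℚ.- ((δ ℚ.+ δ) ℚ.+ (x ℚ.- y)))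
  regroup = solve 3 (λ x y δ → y := δ :+ ((x :+ δ) :- ((δ :+ δ) :+ (x :- y)))) refl
    where open +-*-Solver

pos-+ : ∀ {x y} → Pos x → Pos y → Pos (x + y)
pos-+ (mkPos δ 0<δ δ≤) (mkPos ε 0<ε ε≤) =
  mkPos (δ ℚ.+ ε) (ℚ.+-mono-< 0<δ 0<ε)
    (eventually-zip (λ n → ℚ.+-mono-≤) δ≤ ε≤)

pos-* : ∀ {x y} → Pos x → Pos y → Pos (x * y)
pos-* {x} {y} (mkPos δ 0<δ δ≤) (mkPos ε 0<ε ε≤) =
  mkPos (δ ℚ.* ε)
    (ℚ.positive⁻¹ (δ ℚ.* ε) {{ℚ.pos*pos⇒pos δ {{ℚ.positive 0<δ}} ε {{ℚ.positive 0<ε}}}})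
    (eventually-zip
      (λ n δ≤x ε≤y → ℚ.≤-trans
        (ℚ.*-monoʳ-≤-nonNeg ε {{ℚ.nonNegative (ℚ.<⇒≤ 0<ε)}} δ≤x)
        (ℚ.*-monoˡ-≤-nonNeg (seq x n)
          {{ℚ.nonNegative (ℚ.≤-trans (ℚ.<⇒≤ 0<δ) δ≤x)}} ε≤y))
      δ≤ ε≤)

pos-fromℚ : ∀ {q} → 0ℚ ℚ.< q → Pos (fromℚ q)
pos-fromℚ {q} 0<q = mkPos q 0<q (0 , λ _ _ → ℚ.≤-refl)

pos-fromℚ⁻¹ : ∀ {q} → Pos (fromℚ q) → 0ℚ ℚ.< q
pos-fromℚ⁻¹ (mkPos ε 0<ε ε≤) = ℚ.<-≤-trans 0<ε (eventually-const ε≤)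

pos-1 : Pos 1ℝ
pos-1 = pos-fromℚ (ℚ.positive⁻¹ 1ℚ)

pos⇒≄0 : ∀ {x} → Pos x → ¬ x ≃ 0ℝ
pos⇒≄0 px x≃0 = ℚ.<-irrefl refl (pos-fromℚ⁻¹ (pos-resp x≃0 px))

pos-asym : ∀ {x} → Pos x → ¬ Pos (- x)
pos-asym {x} px p-x = pos⇒≄0 (pos-+ px p-x) (R.-‿inverseʳ x)

-- The constructive substitute for trichotomy. With ε = 2δ and δ = 2η, two rationals are compared at
-- one late index M: either the term of x is at least δ, or that of y is. Later terms move by less
-- than η, so the chosen number stays above η.
pos-cotrans : ∀ {x y} → Pos (x + y) → Pos x ⊎ Pos y
pos-cotrans {x} {y} (mkPos ε 0<ε (N , ε≤)) =
  let δ , 0<δ , δ+δ≡ε = halve ε 0<ε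
      η , 0<η , η+η≡δ = halve δ 0<δ
      M₁ , near₁ = cauchy x η 0<η
      M₂ , near₂ = cauchy y η 0<η
      M = N ⊔ (M₁ ⊔ M₂)
      M₁≤M = ℕ.≤-trans (ℕ.m≤m⊔n M₁ M₂) (ℕ.m≤n⊔m N (M₁ ⊔ M₂))
      M₂≤M = ℕ.≤-trans (ℕ.m≤n⊔m M₁ M₂) (ℕ.m≤n⊔m N (M₁ ⊔ M₂))
  in split δ η 0<η δ+δ≡ε η+η≡δ M
       (λ n M≤n → near₁ M n M₁≤M (ℕ.≤-trans M₁≤M M≤n))
       (λ n M≤n → near₂ M n M₂≤M (ℕ.≤-trans M₂≤M M≤n))
       (ε≤ M (ℕ.m≤m⊔n N (M₁ ⊔ M₂)))
  where
  regroup₁ : ∀ a b η → b ≡ η ℚ.+ ((a ℚ.+ η) ℚ.- ((η ℚ.+ η) ℚ.+ (a ℚ.- b)))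
  regroup₁ = solve 3 (λ a b η → b := η :+ ((a :+ η) :- ((η :+ η) :+ (a :- b)))) refl
    where open +-*-Solver
  stays : ∀ z δ η → 0ℚ ℚ.< η → η ℚ.+ η ≡ δ → ∀ M →
          (∀ n → M ℕ.≤ n → ∣ seq z M ℚ.- seq z n ∣ ℚ.< η) →
          δ ℚ.≤ seq z M → Pos z
  stays z δ η 0<η η+η≡δ M near δ≤z = mkPos η 0<η (M , λ n M≤n → ≤-by
    (ℚ.+-mono-≤ δ≤z (ℚ.≤-trans (p≤∣p∣ (seq z M ℚ.- seq z n)) (ℚ.<⇒≤ (near n M≤n))))
    (trans (regroup₁ (seq z M) (seq z n) η)
      (cong (λ e → η ℚ.+ ((seq z M ℚ.+ η) ℚ.- (e ℚ.+ (seq z M ℚ.- seq z n)))) η+η≡δ)))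
  regroup₂ : ∀ a b δ → b ≡ δ ℚ.+ ((δ ℚ.+ (a ℚ.+ b)) ℚ.- (a ℚ.+ (δ ℚ.+ δ)))
  regroup₂ = solve 3 (λ a b δ → b := δ :+ ((δ :+ (a :+ b)) :- (a :+ (δ :+ δ)))) refl
    where open +-*-Solver
  split : ∀ δ η → 0ℚ ℚ.< η → δ ℚ.+ δ ≡ ε → η ℚ.+ η ≡ δ → ∀ M →
          (∀ n → M ℕ.≤ n → ∣ seq x M ℚ.- seq x n ∣ ℚ.< η) →
          (∀ n → M ℕ.≤ n → ∣ seq y M ℚ.- seq y n ∣ ℚ.< η) →
          ε ℚ.≤ seq x M ℚ.+ seq y M → Pos x ⊎ Pos y
  split δ η 0<η δ+δ≡ε η+η≡δ M near₁ near₂ ε≤x+y with ℚ.≤-total δ (seq x M)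
  ... | inj₁ δ≤x = inj₁ (stays x δ η 0<η η+η≡δ M near₁ δ≤x)
  ... | inj₂ x≤δ = inj₂ (stays y δ η 0<η η+η≡δ M near₂
    (≤-by (ℚ.+-mono-≤ x≤δ (subst (ℚ._≤ seq x M ℚ.+ seq y M) (sym δ+δ≡ε) ε≤x+y))
      (regroup₂ (seq x M) (seq y M) δ)))

-- For each ε > 0, cotransitivity applied to ε = z + (ε - z) leaves only ε - z > 0, since z > 0 is
-- excluded; this is used for z = x and z = -x. As a result an equation with 0 may be proved by
-- contradiction.
tight : ∀ {x} → ¬ Pos x → ¬ Pos (- x) → x ≃ 0ℝ
tight {x} ¬px ¬p-x = wrap λ ε 0<ε →
  eventually-zip (λ n → near n ε)
    (bound ε (below x ε 0<ε ¬px)) (bound ε (below (- x) ε 0<ε ¬p-x))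
  where
  open ℝ-Solver
  split : ∀ e z → e ≃ z + (e + - z)
  split = solve 2 (λ e z → e := z :+ (e :+ (:- z))) R.refl
  below : ∀ z ε → 0ℚ ℚ.< ε → ¬ Pos z → Pos (fromℚ ε + - z)
  below z ε 0<ε ¬pz = [ (λ pz → ⊥-elim (¬pz pz)) , (λ p → p) ]′
    (pos-cotrans (pos-resp (split (fromℚ ε) z) (pos-fromℚ 0<ε)))
  strict : ∀ {g p ε} → 0ℚ ℚ.< g → g ℚ.≤ ε ℚ.+ (ℚ.- p) → p ℚ.< ε
  strict {g} {p} {ε} 0<g g≤ = <-by (ℚ.<-≤-trans 0<g g≤) (regroup p ε)
    where
    regroup : ∀ p ε → ε ≡ p ℚ.+ ((ε ℚ.+ (ℚ.- p)) ℚ.- 0ℚ)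
    regroup = S.solve 2 (λ p ε → ε S.:= p S.:+ ((ε S.:+ (S.:- p)) S.:- S.con 0ℚ)) refl
      where module S = +-*-Solver
  bound : ∀ {z} ε → Pos (fromℚ ε + - z) → Eventually (λ n → seq z n ℚ.< ε)
  bound {z} ε (mkPos g 0<g g≤) = eventually-map (λ n → strict 0<g) g≤
  minus0 : ∀ p → p ≡ p ℚ.- 0ℚ
  minus0 = S.solve 1 (λ p → p S.:= p S.:- S.con 0ℚ) refl
    where module S = +-*-Solver
  near : ∀ n ε → seq x n ℚ.< ε → ℚ.- seq x n ℚ.< ε → ∣ seq x n ℚ.- 0ℚ ∣ ℚ.< ε
  near n ε x<ε -x<ε = subst (λ p → ∣ p ∣ ℚ.< ε) (minus0 (seq x n)) (∣p∣<q x<ε -x<ε)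

-- The signs of x and y cannot be decided. By tightness it suffices to refute y > 0 and -y > 0;
-- under either, both signs of x would make a product positive, so x would be 0 by tightness again.
x*y≃0⇒y≃0 : ∀ {x y} → x * y ≃ 0ℝ → ¬ x ≃ 0ℝ → y ≃ 0ℝ
x*y≃0⇒y≃0 {x} {y} xy≃0 x≄0 = tight
  (λ py → x≄0 (tight
    (λ px → pos⇒≄0 (pos-* px py) xy≃0)
    (λ p-x → pos⇒≄0 (pos-* p-x py) (R.trans (negˡ x y) neg0))))
  (λ p-y → x≄0 (tight
    (λ px → pos⇒≄0 (pos-* px p-y) (R.trans (negʳ x y) neg0))
    (λ p-x → pos⇒≄0 (pos-* p-x p-y) (R.trans (negneg x y) xy≃0))))
  where
  open ℝ-Solver
  negˡ : ∀ x y → - x * y ≃ - (x * y)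
  negˡ = solve 2 (λ x y → (:- x) :* y := :- (x :* y)) R.refl
  negʳ : ∀ x y → x * - y ≃ - (x * y)
  negʳ = solve 2 (λ x y → x :* (:- y) := :- (x :* y)) R.refl
  negneg : ∀ x y → - x * - y ≃ x * y
  negneg = solve 2 (λ x y → (:- x) :* (:- y) := x :* y) R.refl
  neg0 : - (x * y) ≃ 0ℝ
  neg0 = R.trans (R.-‿cong xy≃0) (solve 0 (:- con 0ℚ := con 0ℚ) R.refl)

bounds : ∀ x → ∃[ B ] (0ℚ ℚ.< B × Pos (fromℚ B + - x) × Pos (fromℚ B + x))
bounds x =
  let B , 0<B , ∣x∣≤B = bounded x in
  B ℚ.+ 1ℚ , ℚ.+-mono-< 0<B 0<1 ,
  mkPos 1ℚ 0<1 (eventually-map (λ n le →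
    ≤-by (ℚ.≤-trans (p≤∣p∣ (seq x n)) le) (regroup₁ (seq x n) B)) ∣x∣≤B) ,
  mkPos 1ℚ 0<1 (eventually-map (λ n le →
    ≤-by (ℚ.≤-trans (-p≤∣p∣ (seq x n)) le) (regroup₂ (seq x n) B)) ∣x∣≤B)
  where
  open +-*-Solver
  0<1 = ℚ.positive⁻¹ 1ℚ
  regroup₁ : ∀ x B → (B ℚ.+ 1ℚ) ℚ.+ (ℚ.- x) ≡ 1ℚ ℚ.+ (B ℚ.- x)
  regroup₁ = solve 2 (λ x B → (B :+ con 1ℚ) :+ (:- x) := con 1ℚ :+ (B :- x)) refl
  regroup₂ : ∀ x B → (B ℚ.+ 1ℚ) ℚ.+ x ≡ 1ℚ ℚ.+ (B ℚ.- (ℚ.- x))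
  regroup₂ = solve 2 (λ x B → (B :+ con 1ℚ) :+ x := con 1ℚ :+ (B :- (:- x))) refl

-- If |y| < B and |x| < a with 2aB = 1, then (a - x)(B + y) + (a + x)(B - y) > 0
-- says 2xy < 1.
unit⇒sign : ∀ {x y} → x * y ≃ 1ℝ → Pos x ⊎ Pos (- x)
unit⇒sign {x} {y} xy≃1 =
  let B , 0<B , y<B , -B<y = bounds y
      a , 0<a , 2Ba≡1 = divide (B ℚ.+ B) 1ℚ (ℚ.+-mono-< 0<B 0<B) (ℚ.positive⁻¹ 1ℚ)
  in decide B a y<B -B<y 2Ba≡1
       (pos-cotrans (pos-resp (split₁ (fromℚ a) x) (pos-fromℚ 0<a)))
       (pos-cotrans (pos-resp (split₂ (fromℚ a) x) (pos-fromℚ 0<a)))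
  where
  open ℝ-Solver
  split₁ : ∀ a x → a ≃ x + (a + - x)
  split₁ = solve 2 (λ a x → a := x :+ (a :+ (:- x))) R.refl
  split₂ : ∀ a x → a ≃ - x + (a + x)
  split₂ = solve 2 (λ a x → a := (:- x) :+ (a :+ x)) R.refl
  expand : ∀ a B x y → (a + - x) * (B + y) + (a + x) * (B + - y) ≃
                       (B + B) * a + - (x * y + x * y)
  expand = solve 4 (λ a B x y →
    (a :+ (:- x)) :* (B :+ y) :+ (a :+ x) :* (B :+ (:- y)) :=
    (B :+ B) :* a :+ (:- (x :* y :+ x :* y))) R.refl
  1-2 : 1ℝ + - (1ℝ + 1ℝ) ≃ - 1ℝ
  1-2 = solve 0 (con 1ℚ :+ (:- (con 1ℚ :+ con 1ℚ)) := :- con 1ℚ) R.refl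
  decide : ∀ B a → Pos (fromℚ B + - y) → Pos (fromℚ B + y) → (B ℚ.+ B) ℚ.* a ≡ 1ℚ →
           Pos x ⊎ Pos (fromℚ a + - x) → Pos (- x) ⊎ Pos (fromℚ a + x) → Pos x ⊎ Pos (- x)
  decide B a y<B -B<y eq (inj₁ px) _ = inj₁ px
  decide B a y<B -B<y eq (inj₂ _) (inj₁ p-x) = inj₂ p-x
  decide B a y<B -B<y eq (inj₂ x<a) (inj₂ -a<x) = ⊥-elim (pos-asym pos-1 (pos-resp
    (R.trans (expand (fromℚ a) (fromℚ B) x y)
      (R.trans (R.+-cong 2Ba (R.-‿cong (R.+-cong xy≃1 xy≃1))) 1-2))
    (pos-+ (pos-* x<a -B<y) (pos-* -a<x y<B))))
    where
    2Ba : (fromℚ B + fromℚ B) * fromℚ a ≃ 1ℝ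
    2Ba = pointwise (λ _ → eq)

-- `i / 1` is normalised by a gcd, which is stuck on a variable i; the right side is a constructor
-- form on which the operations and the order of ℚ compute.
i/1≡mkℚ : ∀ i → i ℚ./ 1 ≡ mkℚ i 0 (coprime-sym (1-coprimeTo ℤ.∣ i ∣))
i/1≡mkℚ i = ℚ.↥p/↧p≡p (mkℚ i 0 (coprime-sym (1-coprimeTo ℤ.∣ i ∣)))

fromℤ-+ : ∀ i j → fromℤ (i ℤ.+ j) ≃ fromℤ i + fromℤ j
fromℤ-+ i j = R.trans (fromℚ-cong eq) (fromℚ-+ (i ℚ./ 1) (j ℚ./ 1))
  where
  eq : (i ℤ.+ j) ℚ./ 1 ≡ i ℚ./ 1 ℚ.+ j ℚ./ 1
  eq = trans (cong (ℚ._/ 1) (sym (cong₂ ℤ._+_ (ℤ.*-identityʳ i) (ℤ.*-identityʳ j))))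
    (sym (cong₂ ℚ._+_ (i/1≡mkℚ i) (i/1≡mkℚ j)))

fromℤ-* : ∀ i j → fromℤ (i ℤ.* j) ≃ fromℤ i * fromℤ j
fromℤ-* i j = R.trans (fromℚ-cong eq) (fromℚ-* (i ℚ./ 1) (j ℚ./ 1))
  where
  eq : (i ℤ.* j) ℚ./ 1 ≡ (i ℚ./ 1) ℚ.* (j ℚ./ 1)
  eq = sym (cong₂ ℚ._*_ (i/1≡mkℚ i) (i/1≡mkℚ j))

neg-/1 : ∀ i → (ℤ.- i) ℚ./ 1 ≡ ℚ.- (i ℚ./ 1)
neg-/1 (+ zero)  = refl
neg-/1 (+ suc n) = refl
neg-/1 -[1+ n ]  = sym (ℚ-neg-involutive _)
  where
  ℚ-neg-involutive : ∀ p → ℚ.- (ℚ.- p) ≡ p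
  ℚ-neg-involutive = solve 1 (λ p → :- (:- p) := p) refl
    where open +-*-Solver

fromℤ-neg : ∀ i → fromℤ (ℤ.- i) ≃ - fromℤ i
fromℤ-neg i = R.trans (fromℚ-cong (neg-/1 i)) (fromℚ-neg (i ℚ./ 1))

pos-fromℤ⁻¹ : ∀ {i} → Pos (fromℤ i) → + 0 ℤ.< i
pos-fromℤ⁻¹ {i} pi with subst (0ℚ ℚ.<_) (i/1≡mkℚ i) (pos-fromℚ⁻¹ pi)
... | ℚ.*<* lt = subst (+ 0 ℤ.<_) (ℤ.*-identityʳ i) lt

pos-fromℤ : ∀ {i} → + 0 ℤ.< i → Pos (fromℤ i)
pos-fromℤ {i} 0<i = pos-fromℚ (subst (0ℚ ℚ.<_) (sym (i/1≡mkℚ i))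
  (ℚ.*<* (subst (+ 0 ℤ.<_) (sym (ℤ.*-identityʳ i)) 0<i)))

/1-injective : ∀ {i j} → i ℚ./ 1 ≡ j ℚ./ 1 → i ≡ j
/1-injective {i} {j} eq =
  cong ℚ.↥_ (trans (sym (i/1≡mkℚ i)) (trans eq (i/1≡mkℚ j)))

i<1+∣i∣ : ∀ i → i ℤ.< + suc ℤ.∣ i ∣
i<1+∣i∣ (+ n)    = ℤ.+<+ (ℕ.n<1+n n)
i<1+∣i∣ -[1+ n ] = ℤ.-<+

archimedean-ℚ : ∀ q → ∃[ n ] q ℚ.< + n ℚ./ 1
archimedean-ℚ q@(mkℚ i d c) = suc ℤ.∣ i ∣ , subst (q ℚ.<_) (sym (i/1≡mkℚ (+ suc ℤ.∣ i ∣)))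
  (ℚ.*<* (subst (ℤ._< + suc ℤ.∣ i ∣ ℤ.* + suc d) (sym (ℤ.*-identityʳ i))
    (ℤ.<-≤-trans (i<1+∣i∣ i)
      (subst (ℤ._≤ + suc ℤ.∣ i ∣ ℤ.* + suc d) (ℤ.*-identityʳ (+ suc ℤ.∣ i ∣))
        (ℤ.*-monoˡ-≤-nonNeg (+ suc ℤ.∣ i ∣) (ℤ.+≤+ (ℕ.s≤s ℕ.z≤n)))))))

archimedean : ∀ x → ∃[ n ] Pos (fromℤ (+ n) + - x)
archimedean x =
  let B , 0<B , x<B , _ = bounds x
      n , B<n = archimedean-ℚ B
  in n , pos-resp (regroup (fromℚ B) (fromℤ (+ n)) x)
    (pos-+ (pos-resp (R.trans (fromℚ-+ (+ n ℚ./ 1) (ℚ.- B)) (R.+-congˡ (fromℚ-neg B)))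
      (pos-fromℚ (subst (ℚ._< (+ n ℚ./ 1) ℚ.- B) (ℚ.+-inverseʳ B) (ℚ.+-monoˡ-< (ℚ.- B) B<n)))) x<B)
  where
  open ℝ-Solver
  regroup : ∀ B n x → (n + - B) + (B + - x) ≃ n + - x
  regroup = solve 3 (λ B n x → (n :+ (:- B)) :+ (B :+ (:- x)) := n :+ (:- x)) R.refl

-- Linear dependence over ℚ

-- The way to use the solver modulo a relation z = 0: the identity is stated with an explicit
-- multiple of z on the right, and this lemma removes that multiple. It accounts for summands such
-- as a multiple of `D * r + - 1ℝ` or of the defining cubic in the identities below.
≃0⇒≃ : ∀ {x y z k} → z ≃ 0ℝ → x ≃ y + k * z → x ≃ y
≃0⇒≃ {x} {y} {z} {k} z≃0 eq = R.trans eq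
  (R.trans (R.+-congˡ (R.trans (R.*-congˡ z≃0) (R.zeroʳ k))) (R.+-identityʳ y))

≃⇒-≃0 : ∀ {x y} → x ≃ y → x + - y ≃ 0ℝ
≃⇒-≃0 {x} {y} x≃y = R.trans (R.+-congʳ x≃y) (R.-‿inverseʳ y)

fromℚ≃0 : ∀ {q} → fromℚ q ≃ 0ℝ → q ≡ 0ℚ
fromℚ≃0 {q} q≃0 with ℚ.<-cmp q 0ℚ
... | tri≈ _ q≡0 _ = q≡0
... | tri> _ _ 0<q = ⊥-elim (pos⇒≄0 (pos-fromℚ 0<q) q≃0)
... | tri< q<0 _ _ = ⊥-elim (pos⇒≄0 (pos-fromℚ (ℚ.neg-antimono-< q<0))
  (R.trans (fromℚ-neg q) (R.trans (R.-‿cong q≃0) (R.sym (fromℚ-neg 0ℚ)))))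

recip : ∀ {q} → q ≢ 0ℚ → ∃[ r ] q ℚ.* r ≡ 1ℚ
recip {q} q≢0 = (ℚ.1/ q) , ℚ.*-inverseʳ q
  where instance
    q-nonZero : ℚ.NonZero q
    q-nonZero = ℚ.≢-nonZero q≢0

p*q≡0⇒q≡0 : ∀ {p q} → p ≢ 0ℚ → p ℚ.* q ≡ 0ℚ → q ≡ 0ℚ
p*q≡0⇒q≡0 {p} {q} p≢0 pq≡0 = fromℚ≃0
  (x*y≃0⇒y≃0 (pointwise (λ _ → pq≡0)) (λ p≃0 → p≢0 (fromℚ≃0 p≃0)))

InSpan : ∀ {n} → Vector ℝ n → ℝ → Set
InSpan b x = ∃[ q ] x ≃ linComb q b

NonTrivial : ∀ {n} → Vector ℚ n → Set
NonTrivial c = ∃[ i ] c i ≢ 0ℚ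

Dependent : ∀ {n} → Vector ℝ n → Set
Dependent x = ∃[ c ] (NonTrivial c × linComb c x ≃ 0ℝ)

linComb-+ : ∀ {n} (p q : Vector ℚ n) b →
            linComb (λ i → p i ℚ.+ q i) b ≃ linComb p b + linComb q b
linComb-+ {zero}  p q b = R.sym (R.+-identityʳ 0ℝ)
linComb-+ {suc n} p q b = R.trans
  (R.+-congˡ (linComb-+ (tail p) (tail q) (tail b)))
  (R.trans (R.+-congʳ (R.*-congʳ (fromℚ-+ (p zero) (q zero))))
    (regroup (fromℚ (p zero)) (fromℚ (q zero)) (b zero) _ _))
  where
  open ℝ-Solver
  regroup : ∀ p q b s t → (p + q) * b + (s + t) ≃ (p * b + s) + (q * b + t)
  regroup = solve 5 (λ p q b s t →
    (p :+ q) :* b :+ (s :+ t) := (p :* b :+ s) :+ (q :* b :+ t)) R.refl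

linComb-* : ∀ {n} c (q : Vector ℚ n) b →
            linComb (λ i → c ℚ.* q i) b ≃ fromℚ c * linComb q b
linComb-* {zero}  c q b = R.sym (R.zeroʳ (fromℚ c))
linComb-* {suc n} c q b = R.trans
  (R.+-congˡ (linComb-* c (tail q) (tail b)))
  (R.trans (R.+-congʳ (R.*-congʳ (fromℚ-* c (q zero))))
    (regroup (fromℚ c) (fromℚ (q zero)) (b zero) _))
  where
  open ℝ-Solver
  regroup : ∀ c q b s → (c * q) * b + c * s ≃ c * (q * b + s)
  regroup = solve 4 (λ c q b s → (c :* q) :* b :+ c :* s := c :* (q :* b :+ s)) R.refl

linComb-zero : ∀ {n} (b : Vector ℝ n) → linComb (λ _ → 0ℚ) b ≃ 0ℝ
linComb-zero {zero}  b = R.refl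
linComb-zero {suc n} b = R.trans (R.+-cong (R.zeroˡ (b zero)) (linComb-zero (tail b)))
  (R.+-identityʳ 0ℝ)

-- Subtracting multiples of a pivot x changes a relation only in the coefficient of x. The
-- coefficients of the other vectors are kept, so a nontrivial relation stays nontrivial.
linComb-shear : ∀ {n} (c r : Vector ℚ n) (y : Vector ℝ n) x →
  ∃[ s ] linComb c (λ i → y i + fromℚ (r i) * x) ≃ fromℚ s * x + linComb c y
linComb-shear {zero}  c r y x = 0ℚ , R.sym (R.trans (R.+-identityʳ _) (R.zeroˡ x))
linComb-shear {suc n} c r y x =
  let s , eq = linComb-shear (tail c) (tail r) (tail y) x in
  c zero ℚ.* r zero ℚ.+ s ,
  R.trans (R.+-congˡ eq)
    (R.trans (regroup (fromℚ (c zero)) (fromℚ (r zero)) (y zero) (fromℚ s) x _)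
      (R.+-congʳ (R.*-congʳ {x} (pointwise {fromℚ (c zero) * fromℚ (r zero) + fromℚ s} (λ _ → refl)))))
  where
  open ℝ-Solver
  regroup : ∀ c r y s x t →
    c * (y + r * x) + (s * x + t) ≃ (c * r + s) * x + (c * y + t)
  regroup = solve 6 (λ c r y s x t →
    c :* (y :+ r :* x) :+ (s :* x :+ t) := (c :* r :+ s) :* x :+ (c :* y :+ t)) R.refl

Lifts : ∀ {m n} → Vector ℝ m → Vector ℝ n → Set
Lifts x′ x = ∀ c → ∃[ c′ ] (linComb c′ x ≃ linComb c x′ × (NonTrivial c → NonTrivial c′))

-- One round of Gaussian elimination. The first vector with a nonzero leading coordinate is the
-- pivot and is cleared from those after it; the vectors before it already lie in the span of
-- `tail b`. `Lifts` carries relations back to the original family.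
eliminate : ∀ {n} (b : Vector ℝ (suc n)) k (x : Vector ℝ (suc k)) →
  (∀ i → InSpan b (x i)) →
  ∃[ x′ ] ((∀ (i : Fin k) → InSpan (tail b) (x′ i)) × Lifts x′ x)
eliminate {n} b k x x∈b = go k x x∈b (proj₁ (x∈b zero) zero ℚ.≟ 0ℚ)
  where
  open ℝ-Solver
  go : ∀ k (x : Vector ℝ (suc k)) (x∈b : ∀ i → InSpan b (x i)) →
       Dec (proj₁ (x∈b zero) zero ≡ 0ℚ) →
       ∃[ x′ ] ((∀ (i : Fin k) → InSpan (tail b) (x′ i)) × Lifts x′ x)
  -- If no pivot turns up, the last vector is simply dropped, so that the family loses one member in
  -- every case.
  go zero x x∈b (yes _) = [] , (λ ()) , λ c → (λ _ → 0ℚ) , linComb-zero x , λ ()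
  go (suc k) x x∈b (yes q≡0) =
    let x′ , x′∈b , lifts = go k (tail x) (x∈b ∘ suc) (proj₁ (x∈b (suc zero)) zero ℚ.≟ 0ℚ)
        q , x₀≃ = x∈b zero
    in x zero ∷ x′ ,
       (λ { zero → tail q , R.trans x₀≃ (R.trans
              (R.+-congʳ (R.trans (R.*-congʳ (fromℚ-cong q≡0)) (R.zeroˡ (b zero))))
              (R.+-identityˡ _))
          ; (suc i) → x′∈b i }) ,
       λ c → let c′ , eq , nt = lifts (tail c) in
         c zero ∷ c′ , R.+-congˡ eq ,
         λ { (zero , c₀≢0) → zero , c₀≢0
           ; (suc i , cᵢ≢0) → let j , c′ⱼ≢0 = nt (i , cᵢ≢0) in suc j , c′ⱼ≢0 }
  go k x x∈b (no q≢0) =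
    x′ , x′∈b , λ c → let s , eq = linComb-shear c r (tail x) (x zero) in
      s ∷ c , R.sym eq , λ { (i , cᵢ≢0) → suc i , cᵢ≢0 }
    where
    q = proj₁ (x∈b zero)
    p⁻¹ = proj₁ (recip q≢0)
    r : Vector ℚ k
    r i = ℚ.- (proj₁ (x∈b (suc i)) zero ℚ.* p⁻¹)
    x′ : Vector ℝ k
    x′ i = x (suc i) + fromℚ (r i) * x zero
    regroup : ∀ f p p⁻¹ b t t₀ →
      (f * b + t) + - (f * p⁻¹) * (p * b + t₀) ≃
      (t + - (f * p⁻¹) * t₀) + - (f * b) * (p * p⁻¹ + - 1ℝ)
    regroup = solve 6 (λ f p p⁻¹ b t t₀ →
      (f :* b :+ t) :+ (:- (f :* p⁻¹)) :* (p :* b :+ t₀) :=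
      (t :+ (:- (f :* p⁻¹)) :* t₀) :+ (:- (f :* b)) :* (p :* p⁻¹ :+ (:- con 1ℚ))) R.refl
    x′∈b : ∀ i → InSpan (tail b) (x′ i)
    x′∈b i =
      let f , x≃ = x∈b (suc i)
          _ , x₀≃ = x∈b zero
          rᵢ≃ : fromℚ (r i) ≃ - (fromℚ (f zero) * fromℚ p⁻¹)
          rᵢ≃ = pointwise (λ _ → refl)
      in (λ j → tail f j ℚ.+ r i ℚ.* tail q j) ,
         R.trans (R.+-cong x≃ (R.*-cong rᵢ≃ x₀≃))
           (R.trans
             (≃0⇒≃ (≃⇒-≃0 {fromℚ (q zero) * fromℚ p⁻¹} {1ℝ} (pointwise (λ _ → proj₂ (recip q≢0))))
               (regroup (fromℚ (f zero)) (fromℚ (q zero)) (fromℚ p⁻¹) (b zero) _ _))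
             (R.sym (R.trans (linComb-+ (tail f) (λ j → r i ℚ.* tail q j) (tail b))
               (R.+-congˡ (R.trans (linComb-* (r i) (tail q) (tail b)) (R.*-congʳ rᵢ≃))))))

dependent : ∀ n (b : Vector ℝ n) (x : Vector ℝ (suc n)) →
            (∀ i → InSpan b (x i)) → Dependent x
dependent zero b x x∈b =
  (λ _ → 1ℚ) , (zero , λ ()) ,
  R.trans (R.+-identityʳ _) (R.trans (R.*-identityˡ (x zero)) (proj₂ (x∈b zero)))
dependent (suc n) b x x∈b =
  let x′ , x′∈b , lifts = eliminate b (suc n) x x∈b
      c , nt , c≃0 = dependent n (tail b) x′ x′∈b
      c′ , eq , lift-nt = lifts c
  in c′ , lift-nt nt , R.trans eq c≃0

Irrational : ℝ → Set
Irrational x = ∀ q → ¬ x ≃ fromℚ q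

quadratic : ℚ → ℚ → ℚ → ℝ → ℝ
quadratic a b c x = fromℚ a + fromℚ b * x + fromℚ c * (x * x)

linear-independent : ∀ {x a b} → Irrational x →
                     fromℚ a + fromℚ b * x ≃ 0ℝ → a ≡ 0ℚ × b ≡ 0ℚ
linear-independent {x} {a} {b} irr eq = conclude (b ℚ.≟ 0ℚ)
  where
  open ℝ-Solver
  solve-x : ∀ x a b r → x ≃ - (a * r) + (r * (a + b * x) + - x * (b * r + - 1ℝ))
  solve-x = solve 4 (λ x a b r → x :=
    (:- (a :* r)) :+ (r :* (a :+ b :* x) :+ (:- x) :* (b :* r :+ (:- con 1ℚ)))) R.refl
  solve-a : ∀ x a b → a ≃ (a + b * x) + - x * b
  solve-a = solve 3 (λ x a b → a := (a :+ b :* x) :+ (:- x) :* b) R.refl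
  conclude : Dec (b ≡ 0ℚ) → a ≡ 0ℚ × b ≡ 0ℚ
  conclude (yes b≡0) =
    fromℚ≃0 (R.trans (≃0⇒≃ (fromℚ-cong b≡0) (solve-a x (fromℚ a) (fromℚ b))) eq) , b≡0
  conclude (no b≢0) =
    let r , br≡1 = recip b≢0 in
    ⊥-elim (irr (ℚ.- (a ℚ.* r)) (R.trans (solve-x x (fromℚ a) (fromℚ b) (fromℚ r))
      (R.trans
        (R.+-congˡ (R.trans
          (R.+-cong (R.trans (R.*-congˡ eq) (R.zeroʳ (fromℚ r)))
            (R.trans (R.*-congˡ {x = - x} (≃⇒-≃0 {fromℚ b * fromℚ r} {1ℝ} (pointwise (λ _ → br≡1))))
              (R.zeroʳ (- x))))
          (R.+-identityʳ 0ℝ)))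
        (R.trans (R.+-identityʳ _) (pointwise (λ _ → refl))))))

↧≢0 : ∀ q → ℚ.↧ q ℚ./ 1 ≢ 0ℚ
↧≢0 (mkℚ _ d _) eq = case /1-injective {+ suc d} {+ 0} eq of λ ()

*-↧ : ∀ q → q ℚ.* (ℚ.↧ q ℚ./ 1) ≡ ℚ.↥ q ℚ./ 1
*-↧ q@(mkℚ i d c) = trans (cong (q ℚ.*_) (i/1≡mkℚ (+ suc d)))
  (ℚ.fromℚᵘ-cong {ℚᵘ.mkℚᵘ (i ℤ.* + suc d) (d ℕ.* 1)} {ℚᵘ.mkℚᵘ i 0} (ℚᵘ.*≡* (trans
    (ℤ.*-identityʳ (i ℤ.* + suc d))
    (cong (λ m → i ℤ.* + suc m) (sym (ℕ.*-identityʳ d))))))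

fromℚ∈ : ∀ {ℓ} {P : Pred ℝ ℓ} → IsSubfield P → ∀ q → fromℚ q ∈ P
fromℚ∈ {P = P} isSubfield q@(mkℚ i d c) =
  F.resp (unwrap n*d⁻¹≃q) (F.*-closed (fromℤ∈ i) d⁻¹∈P)
  where
  module F = IsSubfield isSubfield
  open ℝ-Solver
  fromℕ∈ : ∀ n → fromℤ (+ n) ∈ P
  fromℕ∈ zero    = F.0-closed
  fromℕ∈ (suc n) = F.resp (unwrap (R.sym (fromℤ-+ (+ 1) (+ n)))) (F.+-closed F.1-closed (fromℕ∈ n))
  fromℤ∈ : ∀ i → fromℤ i ∈ P
  fromℤ∈ (+ n)    = fromℕ∈ n
  fromℤ∈ -[1+ n ] = F.resp (unwrap (R.sym (fromℤ-neg (+ suc n)))) (F.neg-closed (fromℕ∈ (suc n)))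
  D : ℚ
  D = + suc d ℚ./ 1
  D⁻¹ : ℚ
  D⁻¹ = proj₁ (recip (↧≢0 q))
  d⁻¹∈P : fromℚ D⁻¹ ∈ P
  d⁻¹∈P = F.inv-closed (fromℕ∈ (suc d)) (unwrap {fromℚ D * fromℚ D⁻¹} {1ℝ} (pointwise (λ _ → proj₂ (recip (↧≢0 q)))))
  regroup : ∀ q D r → (q * D) * r ≃ q + q * (D * r + - 1ℝ)
  regroup = solve 3 (λ q D r → (q :* D) :* r := q :+ q :* (D :* r :+ (:- con 1ℚ))) R.refl
  n*d⁻¹≃q : fromℤ i * fromℚ D⁻¹ ≃ fromℚ q
  n*d⁻¹≃q = R.trans (R.*-congʳ (R.trans (fromℚ-cong (sym (*-↧ q))) (fromℚ-* q D)))
    (≃0⇒≃ (≃⇒-≃0 {fromℚ D * fromℚ D⁻¹} {1ℝ} (pointwise (λ _ → proj₂ (recip (↧≢0 q)))))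
      (regroup (fromℚ q) (fromℚ D) (fromℚ D⁻¹)))

-- Fields of degree 3

module CubicField {ℓ} (K : Pred ℝ ℓ) (isSubfield : IsSubfield K)
                  (b : Vector ℝ 3) (isBasis : IsℚBasis K b) where
  private
    module K = IsSubfield isSubfield
    module B = IsℚBasis isBasis

  ℚ⊆K : ∀ q → fromℚ q ∈ K
  ℚ⊆K = fromℚ∈ isSubfield

  dependent₄ : ∀ {w x y z} → w ∈ K → x ∈ K → y ∈ K → z ∈ K →
    ∃[ c₀ ] ∃[ c₁ ] ∃[ c₂ ] ∃[ c₃ ]
      (¬ (c₀ ≡ 0ℚ × c₁ ≡ 0ℚ × c₂ ≡ 0ℚ × c₃ ≡ 0ℚ) ×
       fromℚ c₀ * w + fromℚ c₁ * x + fromℚ c₂ * y + fromℚ c₃ * z ≃ 0ℝ)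
  dependent₄ {w} {x} {y} {z} w∈K x∈K y∈K z∈K =
    let c , nt , c≃0 = dependent 3 b (w ∷ x ∷ y ∷ z ∷ []) in-span
    in c zero , c (suc zero) , c (suc (suc zero)) , c (suc (suc (suc zero))) ,
       nontrivial c nt , R.trans (regroup _ _ _ _ w x y z) c≃0
    where
    span : ∀ {u} → u ∈ K → InSpan b u
    span u∈K = let q , u≈ = B.spanning u∈K in q , wrap u≈
    in-span : ∀ i → InSpan b ((w ∷ x ∷ y ∷ z ∷ []) i)
    in-span zero = span w∈K
    in-span (suc zero) = span x∈K
    in-span (suc (suc zero)) = span y∈K
    in-span (suc (suc (suc zero))) = span z∈K
    nontrivial : ∀ (c : Vector ℚ 4) → NonTrivial c →
      ¬ (c zero ≡ 0ℚ × c (suc zero) ≡ 0ℚ × c (suc (suc zero)) ≡ 0ℚ × c (suc (suc (suc zero))) ≡ 0ℚ)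
    nontrivial c (zero , c≢0) (c≡0 , _) = c≢0 c≡0
    nontrivial c (suc zero , c≢0) (_ , c≡0 , _) = c≢0 c≡0
    nontrivial c (suc (suc zero) , c≢0) (_ , _ , c≡0 , _) = c≢0 c≡0
    nontrivial c (suc (suc (suc zero)) , c≢0) (_ , _ , _ , c≡0) = c≢0 c≡0
    open ℝ-Solver
    regroup : ∀ p q r s w x y z →
      p * w + q * x + r * y + s * z ≃ p * w + (q * x + (r * y + (s * z + 0ℝ)))
    regroup = solve 8 (λ p q r s w x y z →
      p :* w :+ q :* x :+ r :* y :+ s :* z :=
      p :* w :+ (q :* x :+ (r :* y :+ (s :* z :+ con 0ℚ)))) R.refl

  -- If x were quadratic, every y ∈ K would lie in ℚ(x) = ℚ + ℚx, by a relation
  -- among 1, x, y, xy, and K would have dimension at most 2.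
  not-quadratic : ∀ {x p q r} → x ∈ K → Irrational x →
                  quadratic p q r x ≃ 0ℝ → r ≡ 0ℚ
  not-quadratic {x} {p} {q} {r} x∈K irr eq = conclude (r ℚ.≟ 0ℚ)
    where
    open ℝ-Solver
    module S = +-*-Solver
    P = fromℚ p
    Q = fromℚ q
    T = fromℚ r
    -- This is r times the norm of c + d x from ℚ(x), and (r c - q d) - r d x is r times the
    -- conjugate of c + d x.
    norm : ℚ → ℚ → ℚ
    norm c d = r ℚ.* c ℚ.* c ℚ.- q ℚ.* c ℚ.* d ℚ.+ p ℚ.* d ℚ.* d
    norm-factors : ∀ p q r c d x →
      (c + d * x) * ((r * c + - (q * d)) + - (r * d) * x) ≃
      (r * c * c + - (q * c * d) + p * d * d) + - (d * d) * (p + q * x + r * (x * x))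
    norm-factors = solve 6 (λ p q r c d x →
      (c :+ d :* x) :* ((r :* c :+ (:- (q :* d))) :+ (:- (r :* d)) :* x) :=
      (r :* c :* c :+ (:- (q :* c :* d)) :+ p :* d :* d)
        :+ (:- (d :* d)) :* (p :+ q :* x :+ r :* (x :* x))) R.refl
    -- As x is irrational, c + d x is not 0. A vanishing norm would thus kill the conjugate factor,
    -- and its coefficients give r d = 0 and r c = q d, whence c = d = 0.
    norm≢0 : r ≢ 0ℚ → ∀ c d → ¬ (c ≡ 0ℚ × d ≡ 0ℚ) → norm c d ≢ 0ℚ
    norm≢0 r≢0 c d c,d≢0 n≡0 =
      let rc-qd≡0 , -rd≡0 = linear-independent irr (R.trans
            (pointwise {fromℚ (r ℚ.* c ℚ.- q ℚ.* d) + fromℚ (ℚ.- (r ℚ.* d)) * x} (λ _ → refl))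
            (x*y≃0⇒y≃0
              (R.trans (≃0⇒≃ eq (norm-factors P Q T (fromℚ c) (fromℚ d) x)) (pointwise (λ _ → n≡0)))
              (λ c+dx≃0 → c,d≢0 (linear-independent irr c+dx≃0))))
          d≡0 = p*q≡0⇒q≡0 r≢0 (trans (neg-neg (r ℚ.* d)) (cong ℚ.-_ -rd≡0))
      in c,d≢0 (p*q≡0⇒q≡0 r≢0 (trans (drop r c q d)
                 (trans (cong₂ (λ s t → s ℚ.+ q ℚ.* t) rc-qd≡0 d≡0) (zero′ q))) , d≡0)
      where
      neg-neg : ∀ a → a ≡ ℚ.- (ℚ.- a)
      neg-neg = S.solve 1 (λ a → a S.:= S.:- (S.:- a)) refl
      drop : ∀ r c q d → r ℚ.* c ≡ (r ℚ.* c ℚ.- q ℚ.* d) ℚ.+ q ℚ.* d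
      drop = S.solve 4 (λ r c q d → r S.:* c S.:= (r S.:* c S.:- q S.:* d) S.:+ q S.:* d) refl
      zero′ : ∀ q → 0ℚ ℚ.+ q ℚ.* 0ℚ ≡ 0ℚ
      zero′ = S.solve 1 (λ q → S.con 0ℚ S.:+ q S.:* S.con 0ℚ S.:= S.con 0ℚ) refl
    -- The first summand is y = -(e + f x) / (c + d x) with the denominator cleared by the
    -- conjugate, s being the inverse of the norm. The rest consists of multiples of the relation
    -- for y, of the quadratic for x, and of norm times s minus 1.
    solve-y : ∀ p q r c d e f x y s →
      y ≃ (- (s * (e * (r * c + - (q * d)) + f * d * p))
            + - (s * (f * r * c + - (e * r * d))) * x)
          + (s * ((r * c + - (q * d)) + - (r * d) * x) * (e * 1ℝ + f * x + c * y + d * (x * y))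
             + (s * (f * d + d * d * y)) * (p + q * x + r * (x * x))
             + - y * ((r * c * c + - (q * c * d) + p * d * d) * s + - 1ℝ))
    solve-y = solve 10 (λ p q r c d e f x y s →
      y := ((:- (s :* (e :* (r :* c :+ (:- (q :* d))) :+ f :* d :* p)))
            :+ (:- (s :* (f :* r :* c :+ (:- (e :* r :* d))))) :* x)
          :+ (s :* ((r :* c :+ (:- (q :* d))) :+ (:- (r :* d)) :* x)
                :* (e :* con 1ℚ :+ f :* x :+ c :* y :+ d :* (x :* y))
             :+ (s :* (f :* d :+ d :* d :* y)) :* (p :+ q :* x :+ r :* (x :* x))
             :+ (:- y) :* ((r :* c :* c :+ (:- (q :* c :* d)) :+ p :* d :* d) :* s :+ (:- con 1ℚ)))) R.refl
    zeros : ∀ {i j k u v w} → u ≃ 0ℝ → v ≃ 0ℝ → w ≃ 0ℝ → i * u + j * v + k * w ≃ 0ℝ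
    zeros {i} {j} {k} u≃0 v≃0 w≃0 = R.trans
      (R.+-cong (R.+-cong (R.*-congˡ u≃0) (R.*-congˡ v≃0)) (R.*-congˡ w≃0))
      (solve 3 (λ i j k → i :* con 0ℚ :+ j :* con 0ℚ :+ k :* con 0ℚ := con 0ℚ) R.refl i j k)
    in-span : r ≢ 0ℚ → ∀ {y} → y ∈ K → InSpan (1ℝ ∷ x ∷ []) y
    in-span r≢0 {y} y∈K =
      let e , f , c , d , nt , rel = dependent₄ K.1-closed x∈K y∈K (K.*-closed x∈K y∈K)
          c,d≢0 : ¬ (c ≡ 0ℚ × d ≡ 0ℚ)
          c,d≢0 = λ { (c≡0 , d≡0) →
            let e≡0 , f≡0 = linear-independent irr (R.trans (drop-y c≡0 d≡0) rel)
            in nt (e≡0 , f≡0 , c≡0 , d≡0) }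
          s , ns≡1 = recip (norm≢0 r≢0 c d c,d≢0)
          u : ℚ
          u = ℚ.- (s ℚ.* (e ℚ.* (r ℚ.* c ℚ.- q ℚ.* d) ℚ.+ f ℚ.* d ℚ.* p))
          v : ℚ
          v = ℚ.- (s ℚ.* (f ℚ.* r ℚ.* c ℚ.- e ℚ.* r ℚ.* d))
      in (u ∷ v ∷ []) , R.trans
           (solve-y P Q T (fromℚ c) (fromℚ d) (fromℚ e) (fromℚ f) x y (fromℚ s))
           (R.trans (R.+-congˡ (zeros rel eq
               (≃⇒-≃0 {y = 1ℝ} (pointwise (λ _ → ns≡1)))))
             (R.trans (R.+-congʳ {y = fromℚ u + fromℚ v * x} (pointwise (λ _ → refl)))
               (pad (fromℚ u) (fromℚ v) x)))
      where
      pad : ∀ u v x → (u + v * x) + 0ℝ ≃ u * 1ℝ + (v * x + 0ℝ)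
      pad = solve 3 (λ u v x → (u :+ v :* x) :+ con 0ℚ := u :* con 1ℚ :+ (v :* x :+ con 0ℚ)) R.refl
      rearrange : ∀ e f c d x y →
        e + f * x ≃ (e * 1ℝ + f * x + c * y + d * (x * y)) + (- y * c + - (x * y) * d)
      rearrange = solve 6 (λ e f c d x y → e :+ f :* x :=
        (e :* con 1ℚ :+ f :* x :+ c :* y :+ d :* (x :* y)) :+ ((:- y) :* c :+ (:- (x :* y)) :* d)) R.refl
      drop-y : ∀ {e f c d} → c ≡ 0ℚ → d ≡ 0ℚ →
        fromℚ e + fromℚ f * x ≃ fromℚ e * 1ℝ + fromℚ f * x + fromℚ c * y + fromℚ d * (x * y)
      drop-y {e} {f} {c} {d} c≡0 d≡0 = R.trans
        (rearrange (fromℚ e) (fromℚ f) (fromℚ c) (fromℚ d) x y)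
        (R.trans (R.+-congˡ (R.trans
          (R.+-cong (R.trans (R.*-congˡ (fromℚ-cong c≡0)) (R.zeroʳ (- y)))
                    (R.trans (R.*-congˡ (fromℚ-cong d≡0)) (R.zeroʳ (- (x * y)))))
          (R.+-identityʳ 0ℝ))) (R.+-identityʳ _))
    conclude : Dec (r ≡ 0ℚ) → r ≡ 0ℚ
    conclude (yes r≡0) = r≡0
    conclude (no r≢0) =
      let c , (i , cᵢ≢0) , c≃0 = dependent 2 (1ℝ ∷ x ∷ []) b (λ i → in-span r≢0 (B.member i))
      in ⊥-elim (cᵢ≢0 (B.independent c (unwrap c≃0) i))

  quadratic-independent : ∀ {x p q r} → x ∈ K → Irrational x →
    quadratic p q r x ≃ 0ℝ → p ≡ 0ℚ × q ≡ 0ℚ × r ≡ 0ℚ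
  quadratic-independent {x} {p} {q} {r} x∈K irr eq =
    let p≡0 , q≡0 = linear-independent irr (R.trans
          (≃0⇒≃ (fromℚ-cong r≡0) (drop (fromℚ p) (fromℚ q) (fromℚ r) x)) eq)
    in p≡0 , q≡0 , r≡0
    where
    open ℝ-Solver
    r≡0 = not-quadratic x∈K irr eq
    drop : ∀ p q r x → p + q * x ≃ (p + q * x + r * (x * x)) + - (x * x) * r
    drop = solve 4 (λ p q r x →
      p :+ q :* x := (p :+ q :* x :+ r :* (x :* x)) :+ (:- (x :* x)) :* r) R.refl

  -- The four elements 1, x, x², y are dependent, and 1, x, x² are not, so y has a nonzero
  -- coefficient and can be solved for.
  representation : ∀ {x y} → x ∈ K → Irrational x → y ∈ K →
    ∃[ p ] ∃[ q ] ∃[ r ] y ≃ quadratic p q r x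
  representation {x} {y} x∈K irr y∈K =
    let c₀ , c₁ , c₂ , c₃ , nt , rel = dependent₄ K.1-closed x∈K (K.*-closed x∈K x∈K) y∈K
    in divide-by c₀ c₁ c₂ c₃ nt rel (c₃ ℚ.≟ 0ℚ)
    where
    open ℝ-Solver
    drop : ∀ a b c d x y →
      a + b * x + c * (x * x) ≃ (a * 1ℝ + b * x + c * (x * x) + d * y) + - y * d
    drop = solve 6 (λ a b c d x y → a :+ b :* x :+ c :* (x :* x) :=
      (a :* con 1ℚ :+ b :* x :+ c :* (x :* x) :+ d :* y) :+ (:- y) :* d) R.refl
    solve-y : ∀ a b c d s x y → y ≃
      ((- (a * s) + - (b * s) * x + - (c * s) * (x * x))
        + s * (a * 1ℝ + b * x + c * (x * x) + d * y)) + - y * (d * s + - 1ℝ)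
    solve-y = solve 7 (λ a b c d s x y → y :=
      (((:- (a :* s)) :+ (:- (b :* s)) :* x :+ (:- (c :* s)) :* (x :* x))
        :+ s :* (a :* con 1ℚ :+ b :* x :+ c :* (x :* x) :+ d :* y))
        :+ (:- y) :* (d :* s :+ (:- con 1ℚ))) R.refl
    divide-by : ∀ a b c d → ¬ (a ≡ 0ℚ × b ≡ 0ℚ × c ≡ 0ℚ × d ≡ 0ℚ) →
      fromℚ a * 1ℝ + fromℚ b * x + fromℚ c * (x * x) + fromℚ d * y ≃ 0ℝ →
      Dec (d ≡ 0ℚ) → ∃[ p ] ∃[ q ] ∃[ r ] y ≃ quadratic p q r x
    divide-by a b c d nt rel (yes d≡0) =
      let a≡0 , b≡0 , c≡0 = quadratic-independent x∈K irr (R.trans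
            (≃0⇒≃ (fromℚ-cong d≡0)
              (drop (fromℚ a) (fromℚ b) (fromℚ c) (fromℚ d) x y)) rel)
      in ⊥-elim (nt (a≡0 , b≡0 , c≡0 , d≡0))
    divide-by a b c d nt rel (no d≢0) =
      let s , ds≡1 = recip d≢0 in
      ℚ.- (a ℚ.* s) , ℚ.- (b ℚ.* s) , ℚ.- (c ℚ.* s) ,
      R.trans (≃0⇒≃ (≃⇒-≃0 {y = 1ℝ} (pointwise (λ _ → ds≡1)))
          (solve-y (fromℚ a) (fromℚ b) (fromℚ c) (fromℚ d) (fromℚ s) x y))
        (R.trans (≃0⇒≃ rel R.refl) (pointwise (λ _ → refl)))

  -- Let u be the coordinates of 1. If a basis vector equals a rational r, then r u is the
  -- corresponding unit vector. When u₁ = 0 this is impossible for b₁, since r u₁ would be 1; when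
  -- u₁ is nonzero it is impossible for b₀, since r u₁ = 0 gives r = 0 while r u₀ = 1.
  irrational-element : ∃[ x ] (x ∈ K × Irrational x)
  irrational-element = choose (u₁ ℚ.≟ 0ℚ) (u₂ ℚ.≟ 0ℚ)
    where
    open ℝ-Solver
    module S = +-*-Solver
    u = proj₁ (B.spanning K.1-closed)
    u₀ = u zero
    u₁ = u (suc zero)
    u₂ = u (suc (suc zero))
    1≃u : 1ℝ ≃ linComb u b
    1≃u = wrap (proj₂ (B.spanning K.1-closed))
    b₀ = b zero
    b₁ = b (suc zero)
    b₂ = b (suc (suc zero))
    coordinates : ∀ {z} (w : Vector ℚ 3) r → z ≃ fromℚ r → z ≃ linComb w b →
      ∀ i → r ℚ.* u i ℚ.- w i ≡ 0ℚ
    coordinates {z} w r z≃r z≃w = B.independent (λ i → r ℚ.* u i ℚ.+ (ℚ.- w i)) (unwrap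
      (R.trans (linComb-+ (λ i → r ℚ.* u i) (λ i → ℚ.- w i) b)
        (R.trans (R.+-cong
            (R.trans (linComb-* r u b) (R.trans (R.*-congˡ (R.sym 1≃u)) (R.*-identityʳ _)))
            (negate w z≃w))
          (≃⇒-≃0 (R.sym z≃r)))))
      where
      negate : ∀ w → z ≃ linComb w b → linComb (λ i → ℚ.- w i) b ≃ - z
      negate w z≃w = R.trans
        (pointwise {y = - W₀ * b₀ + (- W₁ * b₁ + (- W₂ * b₂ + 0ℝ))} (λ _ → refl))
        (R.trans (neg3 W₀ W₁ W₂ b₀ b₁ b₂) (R.-‿cong (R.sym z≃w)))
        where
        W₀ = fromℚ (w zero)
        W₁ = fromℚ (w (suc zero))
        W₂ = fromℚ (w (suc (suc zero)))
        neg3 : ∀ p q r b c d → - p * b + (- q * c + (- r * d + 0ℝ)) ≃ - (p * b + (q * c + (r * d + 0ℝ)))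
        neg3 = solve 6 (λ p q r b c d → (:- p) :* b :+ ((:- q) :* c :+ ((:- r) :* d :+ con 0ℚ)) :=
          :- (p :* b :+ (q :* c :+ (r :* d :+ con 0ℚ)))) R.refl
    choose : Dec (u₁ ≡ 0ℚ) → Dec (u₂ ≡ 0ℚ) → ∃[ x ] (x ∈ K × Irrational x)
    choose (yes u₁≡0) _ = b₁ , B.member (suc zero) , λ r b₁≃r →
      contradiction₁ r (coordinates (0ℚ ∷ 1ℚ ∷ 0ℚ ∷ []) r b₁≃r unit₁ (suc zero))
      where
      unit₁ : b₁ ≃ linComb (0ℚ ∷ 1ℚ ∷ 0ℚ ∷ []) b
      unit₁ = solve 3 (λ b c d → c := con 0ℚ :* b :+ (con 1ℚ :* c :+ (con 0ℚ :* d :+ con 0ℚ))) R.refl b₀ b₁ b₂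
      lhs : ∀ r → r ℚ.* 0ℚ ℚ.- 1ℚ ≡ ℚ.- 1ℚ
      lhs = S.solve 1 (λ r → r S.:* S.con 0ℚ S.:- S.con 1ℚ S.:= S.:- S.con 1ℚ) refl
      contradiction₁ : ∀ r → ¬ (r ℚ.* u₁ ℚ.- 1ℚ ≡ 0ℚ)
      contradiction₁ r eq = case trans (sym (lhs r)) (trans (cong (λ t → r ℚ.* t ℚ.- 1ℚ) (sym u₁≡0)) eq) of λ ()
    choose (no u₁≢0) _ = b₀ , B.member zero , λ r b₀≃r →
      contradiction₀ r (coordinates (1ℚ ∷ 0ℚ ∷ 0ℚ ∷ []) r b₀≃r unit₀ (suc zero))
        (coordinates (1ℚ ∷ 0ℚ ∷ 0ℚ ∷ []) r b₀≃r unit₀ zero)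
      where
      unit₀ : b₀ ≃ linComb (1ℚ ∷ 0ℚ ∷ 0ℚ ∷ []) b
      unit₀ = solve 3 (λ b c d → b := con 1ℚ :* b :+ (con 0ℚ :* c :+ (con 0ℚ :* d :+ con 0ℚ))) R.refl b₀ b₁ b₂
      swap : ∀ r t → t ℚ.* r ≡ r ℚ.* t ℚ.- 0ℚ
      swap = S.solve 2 (λ r t → t S.:* r S.:= r S.:* t S.:- S.con 0ℚ) refl
      lhs : ∀ t → 0ℚ ℚ.* t ℚ.- 1ℚ ≡ ℚ.- 1ℚ
      lhs = S.solve 1 (λ t → S.con 0ℚ S.:* t S.:- S.con 1ℚ S.:= S.:- S.con 1ℚ) refl
      contradiction₀ : ∀ r → r ℚ.* u₁ ℚ.- 0ℚ ≡ 0ℚ → ¬ (r ℚ.* u₀ ℚ.- 1ℚ ≡ 0ℚ)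
      contradiction₀ r eq₁ eq₀ =
        let r≡0 = p*q≡0⇒q≡0 u₁≢0 (trans (swap r u₁) eq₁) in
        case trans (sym (lhs u₀)) (trans (cong (λ t → t ℚ.* u₀ ℚ.- 1ℚ) (sym r≡0)) eq₀) of λ ()

  primitive-element : ∀ {x} → x ∈ K → Irrational x → IsPrimitiveElement K x
  primitive-element {x} x∈K irr = K⊆ℚx , ℚx⊆K
    where
    module G = ℚ⟨_⟩
    generated : IsSubfield ℚ⟨ x ⟩
    generated = record
      { resp = G.resp ; 0-closed = G.0-closed ; 1-closed = G.1-closed ; +-closed = G.+-closed
      ; *-closed = G.*-closed ; neg-closed = G.neg-closed ; inv-closed = G.inv-closed }
    K⊆ℚx : ∀ {y} → y ∈ K → y ∈ ℚ⟨ x ⟩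
    K⊆ℚx y∈K =
      let p , q , r , y≃ = representation x∈K irr y∈K in
      G.resp (unwrap (R.sym y≃)) (G.+-closed
        (G.+-closed (fromℚ∈ generated p) (G.*-closed (fromℚ∈ generated q) G.gen))
        (G.*-closed (fromℚ∈ generated r) (G.*-closed G.gen G.gen)))
    ℚx⊆K : ∀ {y} → y ∈ ℚ⟨ x ⟩ → y ∈ K
    ℚx⊆K G.gen = x∈K
    ℚx⊆K (G.resp eq y∈) = K.resp eq (ℚx⊆K y∈)
    ℚx⊆K G.0-closed = K.0-closed
    ℚx⊆K G.1-closed = K.1-closed
    ℚx⊆K (G.+-closed y∈ z∈) = K.+-closed (ℚx⊆K y∈) (ℚx⊆K z∈)
    ℚx⊆K (G.*-closed y∈ z∈) = K.*-closed (ℚx⊆K y∈) (ℚx⊆K z∈)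
    ℚx⊆K (G.neg-closed y∈) = K.neg-closed (ℚx⊆K y∈)
    ℚx⊆K (G.inv-closed y∈ eq) = K.inv-closed (ℚx⊆K y∈) eq

  -- The relation x³ = p + q x + r x² reads x (x² - r x - q) = p. Here p is nonzero, for otherwise
  -- the cofactor would vanish and give a monic quadratic relation. Dividing by p exhibits an
  -- inverse of x, and `unit⇒sign` applies.
  sign : ∀ {x} → x ∈ K → Irrational x → Pos x ⊎ Pos (- x)
  sign {x} x∈K irr =
    let p , q , r , x³≃ = representation x∈K irr (K.*-closed x∈K (K.*-closed x∈K x∈K))
    in invert p q r x³≃ (p ℚ.≟ 0ℚ)
    where
    open ℝ-Solver
    factor : ∀ p q r x → x * (- q + - r * x + 1ℝ * (x * x)) ≃
      (p + (x * (x * x) + - (p + q * x + r * (x * x))))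
    factor = solve 4 (λ p q r x → x :* ((:- q) :+ (:- r) :* x :+ con 1ℚ :* (x :* x)) :=
      (p :+ (x :* (x :* x) :+ (:- (p :+ q :* x :+ r :* (x :* x)))))) R.refl
    invert : ∀ p q r → x * (x * x) ≃ quadratic p q r x → Dec (p ≡ 0ℚ) → Pos x ⊎ Pos (- x)
    invert p q r x³≃ p≟0 = go p≟0
      where
      cofactor = - fromℚ q + - fromℚ r * x + 1ℝ * (x * x)
      x*cofactor≃p : x * cofactor ≃ fromℚ p
      x*cofactor≃p = R.trans (factor (fromℚ p) (fromℚ q) (fromℚ r) x)
        (R.trans (R.+-congˡ (≃⇒-≃0 x³≃)) (R.+-identityʳ _))
      go : Dec (p ≡ 0ℚ) → Pos x ⊎ Pos (- x)
      go (yes p≡0) =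
        let _ , _ , 1≡0 = quadratic-independent {p = ℚ.- q} {ℚ.- r} {1ℚ} x∈K irr (R.trans
              (pointwise {_} {cofactor} (λ _ → refl))
              (x*y≃0⇒y≃0 (R.trans x*cofactor≃p (fromℚ-cong p≡0)) (irr 0ℚ)))
        in case 1≡0 of λ ()
      go (no p≢0) =
        let s , ps≡1 = recip p≢0 in
        unit⇒sign {y = cofactor * fromℚ s} (R.trans (R.sym (R.*-assoc x cofactor (fromℚ s)))
          (R.trans (R.*-congʳ x*cofactor≃p) (pointwise (λ _ → ps≡1))))

-- Integral elements of trace 0

irrational-affine : ∀ {x a c} → Irrational x → a ≢ 0ℚ → Irrational (fromℚ a * x + fromℚ c)
irrational-affine {x} {a} {c} irr a≢0 q eq = a≢0 (proj₂ (linear-independent irr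
  (R.trans regroup (≃⇒-≃0 eq))))
  where
  open ℝ-Solver
  solver : ∀ a c q x → (c + - q) + a * x ≃ (a * x + c) + - q
  solver = solve 4 (λ a c q x → (c :+ (:- q)) :+ a :* x := (a :* x :+ c) :+ (:- q)) R.refl
  regroup : fromℚ (c ℚ.- q) + fromℚ a * x ≃ (fromℚ a * x + fromℚ c) + - fromℚ q
  regroup = R.trans
    (R.+-congʳ (pointwise {y = fromℚ c + - fromℚ q} (λ _ → refl)))
    (solver (fromℚ a) (fromℚ c) (fromℚ q) x)

-- Coefficients of polynomials can thus be written as real expressions, as the solver requires, and
-- their integrality read off from closure under the ring operations.
Integer : Pred ℝ 0ℓ
Integer x = ∃[ i ] x ≃ fromℤ i

integer-+ : ∀ {x y} → x ∈ Integer → y ∈ Integer → x + y ∈ Integer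
integer-+ (i , x≃) (j , y≃) = i ℤ.+ j , R.trans (R.+-cong x≃ y≃) (R.sym (fromℤ-+ i j))

integer-* : ∀ {x y} → x ∈ Integer → y ∈ Integer → x * y ∈ Integer
integer-* (i , x≃) (j , y≃) = i ℤ.* j , R.trans (R.*-cong x≃ y≃) (R.sym (fromℤ-* i j))

integer-neg : ∀ {x} → x ∈ Integer → - x ∈ Integer
integer-neg (i , x≃) = ℤ.- i , R.trans (R.-‿cong x≃) (R.sym (fromℤ-neg i))

integer-fromℤ : ∀ i → fromℤ i ∈ Integer
integer-fromℤ i = i , R.refl

clear-denominator : ∀ q → fromℤ (ℚ.↧ q) * fromℚ q ∈ Integer
clear-denominator q = ℚ.↥ q , R.trans
  (R.*-comm (fromℤ (ℚ.↧ q)) (fromℚ q))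
  (R.trans (R.sym (fromℚ-* q (ℚ.↧ q ℚ./ 1))) (fromℚ-cong (*-↧ q)))

-- The missing square term expresses trace 0, and is the condition m = 0.
TraceZeroIntegral : Pred ℝ 0ℓ
TraceZeroIntegral x = ∃[ n ] ∃[ d ] x * (x * x) + fromℤ n * x + fromℤ d ≃ 0ℝ

traceZeroIntegral : ∀ {x n d} → n ∈ Integer → d ∈ Integer →
                    x * (x * x) + n * x + d ≃ 0ℝ → x ∈ TraceZeroIntegral
traceZeroIntegral {x} (i , n≃) (j , d≃) eq =
  i , j , R.trans (R.sym (R.+-cong (R.+-congˡ (R.*-congʳ n≃)) d≃)) eq

-- For x³ = p + q x + r x² and a common denominator D of p, q, r, the element
-- D x is integral with trace D r, so 3 D x - D r is integral with trace 0.
depress : ∀ {x p q r} → Irrational x → x * (x * x) ≃ quadratic p q r x →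
  ∃[ a ] ∃[ c ] (a ≢ 0ℚ × fromℚ a * x + fromℚ c ∈ TraceZeroIntegral)
depress {x} {p} {q} {r} irr x³≃ =
  a , c , a≢0 , traceZeroIntegral
    (integer-+ (integer-* ℤ-3 (integer-* Dr∈ Dr∈)) (integer-* ℤ-9 (integer-* D∈ Dq∈)))
    (integer-+ (integer-+ (integer-* ℤ-2 (integer-* Dr∈ (integer-* Dr∈ Dr∈)))
                          (integer-* ℤ-9 (integer-* Dr∈ (integer-* D∈ Dq∈))))
               (integer-* ℤ-27 (integer-* D∈ (integer-* D∈ Dp∈))))
    (R.trans (cubic-cong (pointwise {y = con3 * D * x + - (D * fromℚ r)} (λ _ → refl)))
      (R.trans (identity (fromℚ p) (fromℚ q) (fromℚ r) D x)
      (R.trans (R.*-congˡ (≃⇒-≃0 x³≃)) (R.zeroʳ _))))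
  where
  open ℝ-Solver
  con3 = fromℤ (+ 3)
  e₀ e₁ e₂ : ℚ
  e₀ = ℚ.↧ p ℚ./ 1
  e₁ = ℚ.↧ q ℚ./ 1
  e₂ = ℚ.↧ r ℚ./ 1
  E : ℚ
  E = e₀ ℚ.* (e₁ ℚ.* e₂)
  D = fromℚ e₀ * (fromℚ e₁ * fromℚ e₂)
  a c : ℚ
  a = (+ 3 ℚ./ 1) ℚ.* E
  c = ℚ.- (E ℚ.* r)
  a≢0 : a ≢ 0ℚ
  a≢0 eq = ↧≢0 r (p*q≡0⇒q≡0 (↧≢0 q) (p*q≡0⇒q≡0 (↧≢0 p) (p*q≡0⇒q≡0 {+ 3 ℚ./ 1} (λ ()) eq)))
  E₀ = integer-fromℤ (ℚ.↧ p)
  E₁ = integer-fromℤ (ℚ.↧ q)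
  E₂ = integer-fromℤ (ℚ.↧ r)
  ℤ-2 = integer-fromℤ (ℤ.- + 2)
  ℤ-3 = integer-fromℤ (ℤ.- + 3)
  ℤ-9 = integer-fromℤ (ℤ.- + 9)
  ℤ-27 = integer-fromℤ (ℤ.- + 27)
  D∈ : D ∈ Integer
  D∈ = integer-* E₀ (integer-* E₁ E₂)
  Dp∈ : D * fromℚ p ∈ Integer
  Dp∈ = let i , eq = integer-* (integer-* E₁ E₂) (clear-denominator p)
    in i , R.trans (solve 4 (λ e₀ e₁ e₂ p → e₀ :* (e₁ :* e₂) :* p := (e₁ :* e₂) :* (e₀ :* p)) R.refl (fromℚ e₀) (fromℚ e₁) (fromℚ e₂) (fromℚ p)) eq
  Dq∈ : D * fromℚ q ∈ Integer
  Dq∈ = let i , eq = integer-* (integer-* E₀ E₂) (clear-denominator q)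
    in i , R.trans (solve 4 (λ e₀ e₁ e₂ p → e₀ :* (e₁ :* e₂) :* p := (e₀ :* e₂) :* (e₁ :* p)) R.refl (fromℚ e₀) (fromℚ e₁) (fromℚ e₂) (fromℚ q)) eq
  Dr∈ : D * fromℚ r ∈ Integer
  Dr∈ = let i , eq = integer-* (integer-* E₀ E₁) (clear-denominator r)
    in i , R.trans (solve 4 (λ e₀ e₁ e₂ p → e₀ :* (e₁ :* e₂) :* p := (e₀ :* e₁) :* (e₂ :* p)) R.refl (fromℚ e₀) (fromℚ e₁) (fromℚ e₂) (fromℚ r)) eq
  cubic-cong : ∀ {x y n d} → x ≃ y → x * (x * x) + n * x + d ≃ y * (y * y) + n * y + d
  cubic-cong x≃y = R.+-congʳ (R.+-cong (R.*-cong x≃y (R.*-cong x≃y x≃y)) (R.*-congˡ x≃y))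
  -- With X = D x and T = D r, the relation becomes X³ - T X² - D²q X - D³p = 0. The coefficients
  -- are those of the depressed cubic for y = 3X - T, that is, 27 times the left side.
  identity : ∀ p q r D x → let y = con3 * D * x + - (D * r) in
    y * (y * y)
      + (fromℤ (ℤ.- + 3) * ((D * r) * (D * r)) + fromℤ (ℤ.- + 9) * (D * (D * q))) * y
      + (fromℤ (ℤ.- + 2) * ((D * r) * ((D * r) * (D * r)))
          + fromℤ (ℤ.- + 9) * ((D * r) * (D * (D * q)))
          + fromℤ (ℤ.- + 27) * (D * (D * (D * p)))) ≃
    (fromℤ (+ 27) * (D * (D * D))) * (x * (x * x) + - (p + q * x + r * (x * x)))
  identity = solve 5 (λ p q r D x → let y = con (+ 3 ℚ./ 1) :* D :* x :+ (:- (D :* r)) in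
    y :* (y :* y)
      :+ (con ((ℤ.- + 3) ℚ./ 1) :* ((D :* r) :* (D :* r)) :+ con ((ℤ.- + 9) ℚ./ 1) :* (D :* (D :* q))) :* y
      :+ (con ((ℤ.- + 2) ℚ./ 1) :* ((D :* r) :* ((D :* r) :* (D :* r)))
          :+ con ((ℤ.- + 9) ℚ./ 1) :* ((D :* r) :* (D :* (D :* q)))
          :+ con ((ℤ.- + 27) ℚ./ 1) :* (D :* (D :* (D :* p)))) :=
    (con (+ 27 ℚ./ 1) :* (D :* (D :* D))) :* (x :* (x :* x) :+ (:- (p :+ q :* x :+ r :* (x :* x))))) R.refl

-- 3θ² - Tr θ², which has trace 0.
η : ℤ → ℝ → ℝ
η n θ = fromℤ (+ 3) * (θ * θ) + fromℤ (+ 2) * fromℤ n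

-- The coefficients are those of the characteristic polynomial of multiplication
-- by aθ + bη on ℚ(θ); its value at aθ + bη is divisible by θ³ + nθ + d.
lattice-integral : ∀ {n d θ} → θ * (θ * θ) + fromℤ n * θ + fromℤ d ≃ 0ℝ →
  ∀ a b → fromℤ a * θ + fromℤ b * η n θ ∈ TraceZeroIntegral
lattice-integral {n} {d} {θ} eq a b = traceZeroIntegral
  (integer-+ (integer-+ (integer-* n∈ (integer-* a∈ a∈))
      (integer-* (integer-fromℤ (+ 9)) (integer-* d∈ (integer-* a∈ b∈))))
    (integer-* (integer-fromℤ (ℤ.- + 3)) (integer-* (integer-* n∈ n∈) (integer-* b∈ b∈))))
  (integer-+ (integer-+ (integer-+
      (integer-* d∈ (integer-* a∈ (integer-* a∈ a∈)))
      (integer-* (integer-fromℤ (ℤ.- + 2)) (integer-* (integer-* n∈ n∈) (integer-* a∈ (integer-* a∈ b∈)))))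
      (integer-* (integer-fromℤ (ℤ.- + 9)) (integer-* (integer-* n∈ d∈) (integer-* a∈ (integer-* b∈ b∈)))))
    (integer-* (integer-+ (integer-* (integer-fromℤ (ℤ.- + 2)) (integer-* n∈ (integer-* n∈ n∈)))
                          (integer-* (integer-fromℤ (ℤ.- + 27)) (integer-* d∈ d∈)))
               (integer-* b∈ (integer-* b∈ b∈))))
  (R.trans (identity (fromℤ a) (fromℤ b) (fromℤ n) (fromℤ d) θ)
    (R.trans (R.*-congʳ eq) (R.zeroˡ _)))
  where
  open ℝ-Solver
  a∈ = integer-fromℤ a
  b∈ = integer-fromℤ b
  n∈ = integer-fromℤ n
  d∈ = integer-fromℤ d
  k : ∀ {m} → ℤ → Polynomial m
  k i = con (i ℚ./ 1)
  identity : ∀ a b n d t → let w = a * t + b * (fromℤ (+ 3) * (t * t) + fromℤ (+ 2) * n) in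
    w * (w * w)
      + (n * (a * a) + fromℤ (+ 9) * (d * (a * b)) + fromℤ (ℤ.- + 3) * (n * n * (b * b))) * w
      + (d * (a * (a * a)) + fromℤ (ℤ.- + 2) * (n * n * (a * (a * b)))
          + fromℤ (ℤ.- + 9) * (n * d * (a * (b * b)))
          + (fromℤ (ℤ.- + 2) * (n * (n * n)) + fromℤ (ℤ.- + 27) * (d * d)) * (b * (b * b))) ≃
    (t * (t * t) + n * t + d) *
      (fromℤ (+ 27) * (b * b * b * (t * t * t)) + fromℤ (+ 27) * (a * b * b * (t * t))
        + (fromℤ (+ 9) * (a * a * b) + fromℤ (+ 27) * (b * b * b * n)) * t
        + (a * a * a + fromℤ (+ 9) * (a * b * b * n) + fromℤ (ℤ.- + 27) * (b * b * b * d)))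
  identity = solve 5 (λ a b n d t → let w = a :* t :+ b :* (k (+ 3) :* (t :* t) :+ k (+ 2) :* n) in
    w :* (w :* w)
      :+ (n :* (a :* a) :+ k (+ 9) :* (d :* (a :* b)) :+ k (ℤ.- + 3) :* (n :* n :* (b :* b))) :* w
      :+ (d :* (a :* (a :* a)) :+ k (ℤ.- + 2) :* (n :* n :* (a :* (a :* b)))
          :+ k (ℤ.- + 9) :* (n :* d :* (a :* (b :* b)))
          :+ (k (ℤ.- + 2) :* (n :* (n :* n)) :+ k (ℤ.- + 27) :* (d :* d)) :* (b :* (b :* b))) :=
    (t :* (t :* t) :+ n :* t :+ d) :*
      (k (+ 27) :* (b :* b :* b :* (t :* t :* t)) :+ k (+ 27) :* (a :* b :* b :* (t :* t))
        :+ (k (+ 9) :* (a :* a :* b) :+ k (+ 27) :* (b :* b :* b :* n)) :* t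
        :+ (a :* a :* a :+ k (+ 9) :* (a :* b :* b :* n) :+ k (ℤ.- + 27) :* (b :* b :* b :* d)))) R.refl

-- Descent in a lattice of rank 2

archimedean-multiple : ∀ {u} v → Pos u → ∃[ m ] Pos (fromℤ (+ m) * u + - v)
archimedean-multiple {u} v (mkPos ε 0<ε ε≤u) =
  let δ , 0<δ , δ+δ≡ε = halve ε 0<ε
      s , _ , δs≡1 = divide δ 1ℚ 0<δ (ℚ.positive⁻¹ 1ℚ)
      m , m>vs = archimedean (v * fromℚ s)
      u>δ : Pos (u + - fromℚ δ)
      u>δ = mkPos δ 0<δ (eventually-map (λ n le → ≤-by le (split (seq u n) δ ε δ+δ≡ε)) ε≤u)
      1+m>vs : Pos (fromℤ (+ suc m) + - (v * fromℚ s))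
      1+m>vs = pos-resp (R.trans (R.sym (R.+-assoc _ _ _)) (R.+-congʳ (R.sym (fromℤ-+ (+ 1) (+ m)))))
        (pos-+ pos-1 m>vs)
  -- The successor makes the multiplier strictly positive, as the product with u - δ demands even if
  -- the Archimedean bound is 0.
  in suc m , pos-resp
    (≃0⇒≃ (≃⇒-≃0 {fromℚ δ * fromℚ s} {1ℝ} (pointwise (λ _ → δs≡1)))
      (regroup (fromℤ (+ suc m)) u v (fromℚ δ) (fromℚ s)))
    (pos-+ (pos-* (pos-fromℤ {+ suc m} (ℤ.+<+ (ℕ.s≤s ℕ.z≤n))) u>δ)
           (pos-* (pos-fromℚ 0<δ) 1+m>vs))
  where
  open ℝ-Solver
  module S = +-*-Solver
  split : ∀ u δ ε → δ ℚ.+ δ ≡ ε → u ℚ.+ (ℚ.- δ) ≡ δ ℚ.+ (u ℚ.- ε)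
  split u δ _ refl = S.solve 2 (λ u δ → u S.:+ (S.:- δ) S.:= δ S.:+ (u S.:- (δ S.:+ δ))) refl u δ
  regroup : ∀ m u v δ s →
    m * (u + - δ) + δ * (m + - (v * s)) ≃ (m * u + - v) + - v * (δ * s + - 1ℝ)
  regroup = solve 5 (λ m u v δ s →
    m :* (u :+ (:- δ)) :+ δ :* (m :+ (:- (v :* s))) :=
    (m :* u :+ (:- v)) :+ (:- v) :* (δ :* s :+ (:- con 1ℚ))) R.refl

pos-+ℕ : ∀ {x} n → Pos x → Pos (x + fromℤ (+ n))
pos-+ℕ zero    px = pos-resp (R.sym (R.+-identityʳ _)) px
pos-+ℕ (suc n) px = pos-+ px (pos-fromℤ {+ suc n} (ℤ.+<+ (ℕ.s≤s ℕ.z≤n)))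

-- Euclid's algorithm: a remainder r of v by u, or its complement u - r, is at
-- most u / 2.
module Descent (L : Pred ℝ 0ℓ)
  (sub-closed : ∀ {u v} → u ∈ L → v ∈ L → u + - v ∈ L)
  (L-sign : ∀ {u} → u ∈ L → ¬ u ≃ 0ℝ → Pos u ⊎ Pos (- u)) where

  open ℝ-Solver

  -- The invariant of the algorithm: it survives subtraction, swapping and negation, and keeps
  -- remainders away from 0, so that `L-sign` can be applied to them.
  Independent : ℝ → ℝ → Set
  Independent u v = ∀ i j → fromℤ i * u + fromℤ j * v ≃ 0ℝ → i ≡ + 0 × j ≡ + 0

  independent-≄0 : ∀ {u v} → Independent u v → ¬ v ≃ 0ℝ
  independent-≄0 {u} {v} ind v≃0 = case proj₂ (ind (+ 0) (+ 1)
    (R.trans (R.+-congˡ (R.*-congˡ {x = fromℤ (+ 1)} v≃0))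
      (solve 1 (λ u → con 0ℚ :* u :+ con 1ℚ :* con 0ℚ := con 0ℚ) R.refl u))) of λ ()

  independent-swap : ∀ {u v} → Independent u v → Independent v u
  independent-swap ind i j eq =
    let j≡0 , i≡0 = ind j i (R.trans (R.+-comm _ _) eq) in i≡0 , j≡0

  independent-shear : ∀ {u v} → Independent u v → Independent u (v + - u)
  independent-shear {u} {v} ind i j eq =
    let i-j≡0 , j≡0 = ind (i ℤ.- j) j (R.trans
          (R.+-congʳ (R.*-congʳ (R.trans (fromℤ-+ i (ℤ.- j)) (R.+-congˡ (fromℤ-neg j)))))
          (R.trans (regroup (fromℤ i) (fromℤ j) u v) eq))
    in trans (ℤ.i-j≡0⇒i≡j i j i-j≡0) j≡0 , j≡0
    where
    regroup : ∀ i j u v → (i + - j) * u + j * v ≃ i * u + j * (v + - u)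
    regroup = solve 4 (λ i j u v → (i :+ (:- j)) :* u :+ j :* v := i :* u :+ j :* (v :+ (:- u))) R.refl

  independent-neg : ∀ {u v} → Independent u v → Independent u (- v)
  independent-neg {u} {v} ind i j eq =
    let i≡0 , -j≡0 = ind i (ℤ.- j) (R.trans
          (R.+-congˡ (R.trans (R.*-congʳ (fromℤ-neg j)) (regroup (fromℤ j) v))) eq)
    in i≡0 , ℤ.neg-injective -j≡0
    where
    regroup : ∀ j v → - j * v ≃ j * - v
    regroup = solve 2 (λ j v → (:- j) :* v := j :* (:- v)) R.refl

  independent-resp : ∀ {u v w} → v ≃ w → Independent u v → Independent u w
  independent-resp v≃w ind i j eq = ind i j (R.trans (R.+-congˡ (R.*-congˡ v≃w)) eq)

  -- Division by repeated subtraction. The number m bounds how often u can be subtracted, and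
  -- `L-sign` decides on which side of u the current v lies.
  remainder : ∀ m {u v} → u ∈ L → v ∈ L → Independent u v → Pos v →
    Pos (fromℤ (+ m) * u + - v) →
    ∃[ r ] (r ∈ L × Independent u r × Pos r × Pos (u + - r))
  remainder zero {u} {v} u∈L v∈L ind v>0 mu>v = ⊥-elim (pos-asym v>0 (pos-resp (zero-multiple u v) mu>v))
    where
    zero-multiple : ∀ u v → fromℤ (+ 0) * u + - v ≃ - v
    zero-multiple = solve 2 (λ u v → con 0ℚ :* u :+ (:- v) := :- v) R.refl
  remainder (suc m) {u} {v} u∈L v∈L ind v>0 mu>v =
    [ (λ v>u → remainder m u∈L (sub-closed v∈L u∈L) ind′ v>u (pos-resp step mu>v))
    , (λ v<u → v , v∈L , ind , v>0 , pos-resp (flip u v) v<u) ]′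
    (L-sign (sub-closed v∈L u∈L) (independent-≄0 ind′))
    where
    ind′ = independent-shear ind
    flip : ∀ u v → - (v + - u) ≃ u + - v
    flip = solve 2 (λ u v → :- (v :+ (:- u)) := u :+ (:- v)) R.refl
    regroup : ∀ m u v → (fromℤ (+ 1) + m) * u + - v ≃ m * u + - (v + - u)
    regroup = solve 3 (λ m u v → (con 1ℚ :+ m) :* u :+ (:- v) := m :* u :+ (:- (v :+ (:- u)))) R.refl
    step : fromℤ (+ suc m) * u + - v ≃ fromℤ (+ m) * u + - (v + - u)
    step = R.trans (R.+-congʳ (R.*-congʳ (fromℤ-+ (+ 1) (+ m)))) (regroup (fromℤ (+ m)) u v)

  SmallElement : Set
  SmallElement = ∃[ w ] (w ∈ L × Pos w × Pos (1ℝ + - w))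

  descend-pos : ∀ N {u v} → u ∈ L → v ∈ L → Independent u v → Pos u → Pos v →
    Pos (fromℤ (+ suc N) + - u) → SmallElement
  descend-pos zero {u} u∈L v∈L ind u>0 v>0 u<1 = u , u∈L , u>0 , u<1
  descend-pos (suc N) {u} {v} u∈L v∈L ind u>0 v>0 u<2+N =
    let m , mu>v = archimedean-multiple v u>0
        r , r∈L , ind-r , r>0 , r<u = remainder m u∈L v∈L ind v>0 mu>v
    -- Which of r and u - r is the smaller cannot be decided, but (N + 1 - r) + (N + 1 - (u - r)) =
    -- (N + 2 - u) + N is positive, so one of the two is known to be below N + 1. The integer bound
    -- drops by one, which is the measure of the recursion.
    in [ (λ r<1+N → descend-pos N r∈L u∈L (independent-swap ind-r) r>0 u>0 r<1+N)
       , (λ u-r<1+N → descend-pos N (sub-closed u∈L r∈L) u∈L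
           (independent-swap (independent-resp (flip u r) (independent-neg (independent-shear ind-r))))
           r<u u>0 u-r<1+N) ]′
       (pos-cotrans (pos-resp (split r) (pos-+ℕ N u<2+N)))
    where
    flip : ∀ u r → - (r + - u) ≃ u + - r
    flip = solve 2 (λ u r → :- (r :+ (:- u)) := u :+ (:- r)) R.refl
    regroup : ∀ n u r → (fromℤ (+ 1) + (fromℤ (+ 1) + n) + - u) + n ≃
      ((fromℤ (+ 1) + n) + - r) + ((fromℤ (+ 1) + n) + - (u + - r))
    regroup = solve 3 (λ n u r → (con 1ℚ :+ (con 1ℚ :+ n) :+ (:- u)) :+ n :=
      ((con 1ℚ :+ n) :+ (:- r)) :+ ((con 1ℚ :+ n) :+ (:- (u :+ (:- r))))) R.refl
    split : ∀ r → (fromℤ (+ suc (suc N)) + - u) + fromℤ (+ N) ≃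
                  (fromℤ (+ suc N) + - r) + (fromℤ (+ suc N) + - (u + - r))
    split r = R.trans
      (R.+-congʳ (R.+-congʳ (R.trans (fromℤ-+ (+ 1) (+ suc N)) (R.+-congˡ 1+N))))
      (R.trans (regroup (fromℤ (+ N)) u r)
        (R.sym (R.+-cong (R.+-congʳ 1+N) (R.+-congʳ 1+N))))
      where
      1+N = fromℤ-+ (+ 1) (+ N)

  small-element : ∀ {u v} → 0ℝ ∈ L → u ∈ L → v ∈ L → Independent u v → SmallElement
  small-element {u} {v} 0∈L u∈L v∈L ind =
    let u′ , u′∈L , ind₁ , u′>0 = positive v u∈L (independent-swap ind)
        v′ , v′∈L , ind₂ , v′>0 = positive u′ v∈L (independent-swap ind₁)
        N , u′<N = archimedean u′
    in descend-pos N u′∈L v′∈L ind₂ u′>0 v′>0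
         (pos-resp (R.trans (R.+-comm _ _) (R.trans (R.sym (R.+-assoc (fromℤ (+ 1)) _ _)) (R.+-congʳ (R.sym (fromℤ-+ (+ 1) (+ N))))))
           (pos-+ℕ 1 u′<N))
    where
    0-u : ∀ u → 0ℝ + - u ≃ - u
    0-u u = R.+-identityˡ (- u)
    positive : ∀ {u} v → u ∈ L → Independent v u →
      ∃[ w ] (w ∈ L × Independent v w × Pos w)
    positive {u} v u∈L ind =
      [ (λ u>0 → u , u∈L , ind , u>0)
      -- Closure of L is given for differences, so the negative of u enters as 0 - u.
      , (λ -u>0 → 0ℝ + - u , sub-closed 0∈L u∈L ,
          independent-resp (R.sym (0-u u)) (independent-neg ind) , pos-resp (R.sym (0-u u)) -u>0) ]′
      (L-sign u∈L (independent-≄0 ind))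

-- An irrational integral element of trace 0 in the unit interval

module SmallIntegral {ℓ} (K : Pred ℝ ℓ) (isSubfield : IsSubfield K)
                     (b : Vector ℝ 3) (isBasis : IsℚBasis K b) where
  private
    module K = IsSubfield isSubfield
  open CubicField K isSubfield b isBasis
  open ℝ-Solver

  integral-generator : ∃[ θ ] (θ ∈ K × Irrational θ × θ ∈ TraceZeroIntegral)
  integral-generator =
    let x , x∈K , irr = irrational-element
        p , q , r , x³≃ = representation x∈K irr (K.*-closed x∈K (K.*-closed x∈K x∈K))
        a , c , a≢0 , integral = depress {x} {p} {q} {r} irr x³≃
    in fromℚ a * x + fromℚ c ,
       K.+-closed (K.*-closed (ℚ⊆K a) x∈K) (ℚ⊆K c) ,
       irrational-affine irr a≢0 , integral

  small-integral : ∃[ w ] (w ∈ K × Irrational w × w ∈ TraceZeroIntegral × Pos w × Pos (1ℝ + - w))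
  small-integral =
    let θ , θ∈K , irr , n , d , eq = integral-generator in search θ∈K irr n d eq
    where
    search : ∀ {θ} → θ ∈ K → Irrational θ → ∀ n d →
      θ * (θ * θ) + fromℤ n * θ + fromℤ d ≃ 0ℝ →
      ∃[ w ] (w ∈ K × Irrational w × w ∈ TraceZeroIntegral × Pos w × Pos (1ℝ + - w))
    search {θ} θ∈K irr n d eq =
      conclude (D.small-element 0∈L θ∈L η∈L basis-independent)
      where
      L : Pred ℝ 0ℓ
      L w = ∃[ i ] ∃[ j ] w ≃ fromℤ i * θ + fromℤ j * η n θ
      as-quadratic : ∀ i j → fromℤ i * θ + fromℤ j * η n θ ≃
        quadratic ((j ℚ./ 1) ℚ.* ((+ 2 ℚ./ 1) ℚ.* (n ℚ./ 1))) (i ℚ./ 1) ((j ℚ./ 1) ℚ.* (+ 3 ℚ./ 1)) θ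
      as-quadratic i j = R.trans (regroup (fromℤ i) (fromℤ j) (fromℤ n) θ) (pointwise (λ _ → refl))
        where
        regroup : ∀ i j n t → i * t + j * (fromℤ (+ 3) * (t * t) + fromℤ (+ 2) * n) ≃
          j * (fromℤ (+ 2) * n) + i * t + (j * fromℤ (+ 3)) * (t * t)
        regroup = solve 4 (λ i j n t →
          i :* t :+ j :* (con (+ 3 ℚ./ 1) :* (t :* t) :+ con (+ 2 ℚ./ 1) :* n) :=
          j :* (con (+ 2 ℚ./ 1) :* n) :+ i :* t :+ (j :* con (+ 3 ℚ./ 1)) :* (t :* t)) R.refl
      -- The coefficients of θ and θ² in iθ + jη are i and 3j, and both must vanish. This serves
      -- twice: for q = 0 it is the independence of θ and η, and for general q it makes every
      -- nonzero lattice element irrational.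
      rational⇒0 : ∀ i j q → fromℤ i * θ + fromℤ j * η n θ ≃ fromℚ q → i ≡ + 0 × j ≡ + 0
      rational⇒0 i j q eq =
        let _ , i≡0 , 3j≡0 = quadratic-independent {p = c₀ ℚ.- q} θ∈K irr (R.trans
              (R.trans (R.+-congʳ (R.+-congʳ (pointwise {y = fromℚ c₀ + - fromℚ q} (λ _ → refl))))
                (shift (fromℚ c₀) (fromℚ q) _ _))
              (R.trans (R.+-congʳ (R.sym (as-quadratic i j))) (≃⇒-≃0 eq)))
        in /1-injective {i} {+ 0} i≡0 ,
           /1-injective {j} {+ 0} (p*q≡0⇒q≡0 {+ 3 ℚ./ 1} (λ ()) (trans (ℚ.*-comm (+ 3 ℚ./ 1) (j ℚ./ 1)) 3j≡0))
        where
        c₀ = (j ℚ./ 1) ℚ.* ((+ 2 ℚ./ 1) ℚ.* (n ℚ./ 1))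
        shift : ∀ p q s t → (p + - q) + s + t ≃ (p + s + t) + - q
        shift = solve 4 (λ p q s t → (p :+ (:- q)) :+ s :+ t := (p :+ s :+ t) :+ (:- q)) R.refl
      L⊆K : ∀ {w} → w ∈ L → w ∈ K
      L⊆K (i , j , w≃) = K.resp (unwrap (R.sym w≃))
        (K.+-closed (K.*-closed (ℚ⊆K (i ℚ./ 1)) θ∈K) (K.*-closed (ℚ⊆K (j ℚ./ 1))
          (K.+-closed (K.*-closed (ℚ⊆K (+ 3 ℚ./ 1)) (K.*-closed θ∈K θ∈K))
                      (K.*-closed (ℚ⊆K (+ 2 ℚ./ 1)) (ℚ⊆K (n ℚ./ 1))))))
      L-irrational : ∀ {w} → w ∈ L → ¬ w ≃ 0ℝ → Irrational w
      L-irrational (i , j , w≃) w≄0 q w≃q =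
        let i≡0 , j≡0 = rational⇒0 i j q (R.trans (R.sym w≃) w≃q) in
        w≄0 (R.trans w≃ (R.trans
          (R.+-cong (R.*-congʳ (fromℚ-cong (cong (ℚ._/ 1) i≡0))) (R.*-congʳ (fromℚ-cong (cong (ℚ._/ 1) j≡0))))
          (solve 2 (λ u v → con 0ℚ :* u :+ con 0ℚ :* v := con 0ℚ) R.refl θ (η n θ))))
      L-integral : ∀ {w} → w ∈ L → w ∈ TraceZeroIntegral
      L-integral (i , j , w≃) =
        let n′ , d′ , eq′ = lattice-integral {n} {d} eq i j in
        n′ , d′ , R.trans (R.+-congʳ (R.+-cong (R.*-cong w≃ (R.*-cong w≃ w≃)) (R.*-congˡ w≃))) eq′
      L-sub : ∀ {u v} → u ∈ L → v ∈ L → u + - v ∈ L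
      L-sub (i , j , u≃) (k , l , v≃) = i ℤ.- k , j ℤ.- l , R.trans
        (R.+-cong u≃ (R.-‿cong v≃))
        (R.trans (regroup (fromℤ i) (fromℤ j) (fromℤ k) (fromℤ l) θ (η n θ))
          (R.sym (R.+-cong (R.*-congʳ (difference i k)) (R.*-congʳ (difference j l)))))
        where
        difference : ∀ i k → fromℤ (i ℤ.- k) ≃ fromℤ i + - fromℤ k
        difference i k = R.trans (fromℤ-+ i (ℤ.- k)) (R.+-congˡ (fromℤ-neg k))
        regroup : ∀ i j k l s t → (i * s + j * t) + - (k * s + l * t) ≃ (i + - k) * s + (j + - l) * t
        regroup = solve 6 (λ i j k l s t →
          (i :* s :+ j :* t) :+ (:- (k :* s :+ l :* t)) := (i :+ (:- k)) :* s :+ (j :+ (:- l)) :* t) R.refl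
      module D = Descent L L-sub (λ u∈L u≄0 → sign (L⊆K u∈L) (L-irrational u∈L u≄0))
      basis-independent : D.Independent θ (η n θ)
      basis-independent i j eq = rational⇒0 i j 0ℚ eq
      0∈L : 0ℝ ∈ L
      0∈L = + 0 , + 0 , solve 2 (λ u v → con 0ℚ := con 0ℚ :* u :+ con 0ℚ :* v) R.refl θ (η n θ)
      θ∈L : θ ∈ L
      θ∈L = + 1 , + 0 , solve 2 (λ u v → u := con 1ℚ :* u :+ con 0ℚ :* v) R.refl θ (η n θ)
      η∈L : η n θ ∈ L
      η∈L = + 0 , + 1 , solve 2 (λ u v → v := con 0ℚ :* u :+ con 1ℚ :* v) R.refl θ (η n θ)
      conclude : D.SmallElement →
        ∃[ w ] (w ∈ K × Irrational w × w ∈ TraceZeroIntegral × Pos w × Pos (1ℝ + - w))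
      conclude (w , w∈L , w>0 , w<1) =
        w , L⊆K w∈L , L-irrational w∈L (pos⇒≄0 w>0) , L-integral w∈L , w>0 , w<1

-- Square roots

*-nonNeg : ∀ {p q} → 0ℚ ℚ.≤ p → 0ℚ ℚ.≤ q → 0ℚ ℚ.≤ p ℚ.* q
*-nonNeg {p} {q} 0≤p 0≤q = subst (ℚ._≤ p ℚ.* q) (ℚ.*-zeroˡ q)
  (ℚ.*-monoʳ-≤-nonNeg q {{ℚ.nonNegative 0≤q}} 0≤p)

1≤t*t⇒1≤t : ∀ {t} → 0ℚ ℚ.< t → 1ℚ ℚ.≤ t ℚ.* t → 1ℚ ℚ.≤ t
1≤t*t⇒1≤t {t} 0<t 1≤t² = ℚ.≮⇒≥ λ t<1 → ℚ.<-irrefl refl (ℚ.<-≤-trans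
  (ℚ.<-trans (subst (t ℚ.* t ℚ.<_) (ℚ.*-identityʳ t) (ℚ.*-monoʳ-<-pos t {{ℚ.positive 0<t}} t<1)) t<1)
  1≤t²)

-- Newton's iteration: with u = t - s/t, the error t² - s = t u becomes u²/4.
newton-step : ∀ {s t} → 0ℚ ℚ.≤ s → 0ℚ ℚ.< t → s ℚ.≤ t ℚ.* t →
  ∃[ t′ ] (0ℚ ℚ.< t′ × s ℚ.≤ t′ ℚ.* t′ ×
           (t′ ℚ.* t′ ℚ.- s) ℚ.+ (t′ ℚ.* t′ ℚ.- s) ℚ.≤ t ℚ.* t ℚ.- s)
newton-step {s} {t} 0≤s 0<t s≤t² =
  let r , 0<r , tr≡1 = divide t 1ℚ 0<t (ℚ.positive⁻¹ 1ℚ)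
      0≤r = ℚ.<⇒≤ 0<r
      0≤sr = *-nonNeg 0≤s 0≤r
      0≤u : 0ℚ ℚ.≤ t ℚ.- s ℚ.* r
      0≤u = ≤-by (*-nonNeg 0≤r (≤-by s≤t² (sym (ℚ.+-identityˡ _))))
        (trans (u-identity s t r) (modulo tr≡1 (ℚ.- t)))
  in ½ ℚ.* (t ℚ.+ s ℚ.* r) ,
     subst (ℚ._< ½ ℚ.* (t ℚ.+ s ℚ.* r)) (ℚ.*-zeroʳ ½)
       (ℚ.*-monoʳ-<-pos ½ (ℚ.+-mono-<-≤ 0<t 0≤sr)) ,
     ≤-by (*-nonNeg (*-nonNeg (ℚ.nonNegative⁻¹ ½) 0≤u) (*-nonNeg (ℚ.nonNegative⁻¹ ½) 0≤u))
       (trans (lower s t r) (modulo tr≡1 s)) ,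
     ≤-by (ℚ.+-mono-≤ (*-nonNeg 0≤u 0≤sr) (*-nonNeg (*-nonNeg (ℚ.nonNegative⁻¹ ½) 0≤u) 0≤u))
       (trans (upper s t r) (modulo tr≡1 (ℚ.- s)))
  where
  open +-*-Solver
  modulo : ∀ {x k} → k ≡ 1ℚ → ∀ y → x ℚ.+ y ℚ.* (k ℚ.- 1ℚ) ≡ x
  modulo {x} refl y = solve 2 (λ x y → x :+ y :* (con 1ℚ :- con 1ℚ) := x) refl x y
  u-identity : ∀ s t r → t ℚ.- s ℚ.* r ≡
    (0ℚ ℚ.+ (r ℚ.* (t ℚ.* t ℚ.- s) ℚ.- 0ℚ)) ℚ.+ (ℚ.- t) ℚ.* (t ℚ.* r ℚ.- 1ℚ)
  u-identity = solve 3 (λ s t r → t :- s :* r :=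
    (con 0ℚ :+ (r :* (t :* t :- s) :- con 0ℚ)) :+ (:- t) :* (t :* r :- con 1ℚ)) refl
  lower : ∀ s t r → let t′ = ½ ℚ.* (t ℚ.+ s ℚ.* r); u = t ℚ.- s ℚ.* r in
    t′ ℚ.* t′ ≡ (s ℚ.+ ((½ ℚ.* u) ℚ.* (½ ℚ.* u) ℚ.- 0ℚ)) ℚ.+ s ℚ.* (t ℚ.* r ℚ.- 1ℚ)
  lower = solve 3 (λ s t r → let t′ = con ½ :* (t :+ s :* r); u = t :- s :* r in
    t′ :* t′ := (s :+ ((con ½ :* u) :* (con ½ :* u) :- con 0ℚ)) :+ s :* (t :* r :- con 1ℚ)) refl
  upper : ∀ s t r → let t′ = ½ ℚ.* (t ℚ.+ s ℚ.* r); u = t ℚ.- s ℚ.* r in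
    t ℚ.* t ℚ.- s ≡
    ((t′ ℚ.* t′ ℚ.- s) ℚ.+ (t′ ℚ.* t′ ℚ.- s)
      ℚ.+ ((u ℚ.* (s ℚ.* r) ℚ.+ (½ ℚ.* u) ℚ.* u) ℚ.- (0ℚ ℚ.+ 0ℚ)))
    ℚ.+ (ℚ.- s) ℚ.* (t ℚ.* r ℚ.- 1ℚ)
  upper = solve 3 (λ s t r → let t′ = con ½ :* (t :+ s :* r); u = t :- s :* r in
    t :* t :- s :=
    ((t′ :* t′ :- s) :+ (t′ :* t′ :- s)
      :+ ((u :* (s :* r) :+ (con ½ :* u) :* u) :- (con 0ℚ :+ con 0ℚ)))
    :+ (:- s) :* (t :* r :- con 1ℚ)) refl

/1-suc : ∀ n → + suc n ℚ./ 1 ≡ 1ℚ ℚ.+ + n ℚ./ 1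
/1-suc n = trans
  (cong (ℚ._/ 1) (cong₂ ℤ._+_ (sym (ℤ.*-identityʳ (+ 1))) (sym (ℤ.*-identityʳ (+ n)))))
  (cong (1ℚ ℚ.+_) (sym (i/1≡mkℚ (+ n))))

-- A Newton step at least halves the error, which takes it from below (m + 2) ε to below (m + 1) ε
-- because m + 2 ≤ 2 (m + 1). Induction on a linear Archimedean bound therefore suffices.
sqrt-iterate : ∀ m {s t ε} → 0ℚ ℚ.≤ s → 0ℚ ℚ.< ε → 0ℚ ℚ.< t → s ℚ.≤ t ℚ.* t →
  t ℚ.* t ℚ.- s ℚ.< (+ suc m ℚ./ 1) ℚ.* ε →
  ∃[ t′ ] (0ℚ ℚ.< t′ × s ℚ.≤ t′ ℚ.* t′ × t′ ℚ.* t′ ℚ.- s ℚ.< ε)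
sqrt-iterate zero {t = t} {ε} 0≤s 0<ε 0<t s≤t² e<ε =
  t , 0<t , s≤t² , subst (t ℚ.* t ℚ.- _ ℚ.<_) (ℚ.*-identityˡ ε) e<ε
sqrt-iterate (suc m) {s} {t} {ε} 0≤s 0<ε 0<t s≤t² e<mε =
  let t′ , 0<t′ , s≤t′² , 2e′≤e = newton-step 0≤s 0<t s≤t² in
  sqrt-iterate m 0≤s 0<ε 0<t′ s≤t′² (halved (t′ ℚ.* t′ ℚ.- s) (ℚ.≤-<-trans 2e′≤e e<mε))
  where
  open +-*-Solver
  M = + suc m ℚ./ 1
  expand : ∀ m ε → (1ℚ ℚ.+ (1ℚ ℚ.+ m)) ℚ.* ε ℚ.+ m ℚ.* ε ≡ (1ℚ ℚ.+ m) ℚ.* ε ℚ.+ (1ℚ ℚ.+ m) ℚ.* ε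
  expand = solve 2 (λ m ε → (con 1ℚ :+ (con 1ℚ :+ m)) :* ε :+ m :* ε :=
    (con 1ℚ :+ m) :* ε :+ (con 1ℚ :+ m) :* ε) refl
  0≤mε : 0ℚ ℚ.≤ (+ m ℚ./ 1) ℚ.* ε
  0≤mε = *-nonNeg (subst (0ℚ ℚ.≤_) (sym (i/1≡mkℚ (+ m))) (ℚ.nonNegative⁻¹ _)) (ℚ.<⇒≤ 0<ε)
  total : (+ suc (suc m) ℚ./ 1) ℚ.* ε ℚ.+ (+ m ℚ./ 1) ℚ.* ε ≡ M ℚ.* ε ℚ.+ M ℚ.* ε
  total = trans (cong (λ k → k ℚ.* ε ℚ.+ (+ m ℚ./ 1) ℚ.* ε)
      (trans (/1-suc (suc m)) (cong (1ℚ ℚ.+_) (/1-suc m))))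
    (trans (expand (+ m ℚ./ 1) ε) (sym (cong (λ k → k ℚ.* ε ℚ.+ k ℚ.* ε) (/1-suc m))))
  halved : ∀ e → e ℚ.+ e ℚ.< (+ suc (suc m) ℚ./ 1) ℚ.* ε → e ℚ.< M ℚ.* ε
  halved e 2e<  = ℚ.≰⇒> λ Mε≤e → ℚ.<-irrefl refl (ℚ.<-≤-trans
    (subst (e ℚ.+ e ℚ.<_) total (subst (ℚ._< (+ suc (suc m) ℚ./ 1) ℚ.* ε ℚ.+ (+ m ℚ./ 1) ℚ.* ε)
      (ℚ.+-identityʳ (e ℚ.+ e)) (ℚ.+-mono-<-≤ 2e< 0≤mε)))
    (ℚ.+-mono-≤ Mε≤e Mε≤e))

sqrt-approximation : ∀ s ε → 1ℚ ℚ.≤ s → 0ℚ ℚ.< ε →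
  ∃[ t ] (1ℚ ℚ.≤ t × ∣ t ℚ.* t ℚ.- s ∣ ℚ.< ε)
sqrt-approximation s ε 1≤s 0<ε =
  let r , _ , εr≡1 = divide ε 1ℚ 0<ε (ℚ.positive⁻¹ 1ℚ)
      m , e₀r<m = archimedean-ℚ ((s ℚ.* s ℚ.- s) ℚ.* r)
      -- The iteration starts at s itself, which lies above the root since 1 ≤ s gives s ≤ s².
      t , 0<t , s≤t² , e<ε = sqrt-iterate m 0≤s 0<ε 0<s s≤s²
        (ℚ.<-trans (scale r εr≡1 e₀r<m) (grow m))
  in t , 1≤t*t⇒1≤t 0<t (ℚ.≤-trans 1≤s s≤t²) ,
     subst (ℚ._< ε) (sym (ℚ.0≤p⇒∣p∣≡p (≤-by s≤t² (sym (ℚ.+-identityˡ _))))) e<ε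
  where
  open +-*-Solver
  0<s = ℚ.<-≤-trans (ℚ.positive⁻¹ 1ℚ) 1≤s
  0≤s = ℚ.<⇒≤ 0<s
  s≤s² : s ℚ.≤ s ℚ.* s
  s≤s² = subst (ℚ._≤ s ℚ.* s) (ℚ.*-identityʳ s) (ℚ.*-monoˡ-≤-nonNeg s {{ℚ.nonNegative 0≤s}} 1≤s)
  cancel : ∀ e r → e ℚ.* r ℚ.* ε ≡ e ℚ.* (ε ℚ.* r)
  cancel e r = solve 3 (λ e r ε → e :* r :* ε := e :* (ε :* r)) refl e r ε
  scale : ∀ {e k} r → ε ℚ.* r ≡ 1ℚ → e ℚ.* r ℚ.< k → e ℚ.< k ℚ.* ε
  scale {e} {k} r εr≡1 er<k = subst (ℚ._< k ℚ.* ε)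
    (trans (cancel e r) (trans (cong (e ℚ.*_) εr≡1) (ℚ.*-identityʳ e)))
    (ℚ.*-monoˡ-<-pos ε {{ℚ.positive 0<ε}} er<k)
  grow : ∀ m → (+ m ℚ./ 1) ℚ.* ε ℚ.< (+ suc m ℚ./ 1) ℚ.* ε
  grow m = <-by 0<ε (trans (cong (ℚ._* ε) (/1-suc m))
    (solve 2 (λ m ε → (con 1ℚ :+ m) :* ε := m :* ε :+ (ε :- con 0ℚ)) refl (+ m ℚ./ 1) ε))

1/suc : ℕ → ℚ
1/suc n = mkℚ (+ 1) n (1-coprimeTo (suc n))

1/suc-eventually : ∀ ε → 0ℚ ℚ.< ε → Eventually (λ n → 1/suc n ℚ.< ε)
1/suc-eventually (mkℚ (+ suc i) d c) _ = suc d , λ n d<n →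
  ℚ.*<* (subst₂ ℤ._<_ (sym (ℤ.*-identityˡ (+ suc d))) (ℤ.pos-* (suc i) (suc n))
    (ℤ.+<+ (ℕ.≤-trans (ℕ.s≤s d<n) (ℕ.m≤m+n (suc n) (i ℕ.* suc n)))))
1/suc-eventually (mkℚ (+ zero) d c) (ℚ.*<* (ℤ.+<+ ()))
1/suc-eventually (mkℚ -[1+ _ ] d c) (ℚ.*<* ())

∣a-b∣≤∣a²-b²∣ : ∀ {a b} → 1ℚ ℚ.≤ a → 1ℚ ℚ.≤ b → ∣ a ℚ.- b ∣ ℚ.≤ ∣ a ℚ.* a ℚ.- b ℚ.* b ∣
∣a-b∣≤∣a²-b²∣ {a} {b} 1≤a 1≤b = begin
  ∣ a ℚ.- b ∣                      ≡⟨ sym (ℚ.*-identityʳ ∣ a ℚ.- b ∣) ⟩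
  ∣ a ℚ.- b ∣ ℚ.* 1ℚ               ≤⟨ ℚ.*-monoˡ-≤-nonNeg ∣ a ℚ.- b ∣ {{ℚ.nonNegative (ℚ.0≤∣p∣ (a ℚ.- b))}}
                                       (ℚ.≤-trans 1≤a+b (p≤∣p∣ (a ℚ.+ b))) ⟩
  ∣ a ℚ.- b ∣ ℚ.* ∣ a ℚ.+ b ∣      ≡⟨ sym (ℚ.∣p*q∣≡∣p∣*∣q∣ (a ℚ.- b) (a ℚ.+ b)) ⟩
  ∣ (a ℚ.- b) ℚ.* (a ℚ.+ b) ∣      ≡⟨ cong ∣_∣ (factor a b) ⟩
  ∣ a ℚ.* a ℚ.- b ℚ.* b ∣          ∎
  where
  open ℚ.≤-Reasoning
  1≤a+b : 1ℚ ℚ.≤ a ℚ.+ b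
  1≤a+b = ℚ.≤-trans 1≤a (subst (ℚ._≤ a ℚ.+ b) (ℚ.+-identityʳ a)
    (ℚ.+-monoʳ-≤ a (ℚ.≤-trans (ℚ.nonNegative⁻¹ 1ℚ) 1≤b)))
  factor : ∀ a b → (a ℚ.- b) ℚ.* (a ℚ.+ b) ≡ a ℚ.* a ℚ.- b ℚ.* b
  factor = solve 2 (λ a b → (a :- b) :* (a :+ b) := a :* a :- b :* b) refl
    where open +-*-Solver

-- For x > 1 all approximate roots can be kept at least 1, where |a - b| ≤ |a² - b²|. Closeness of
-- the squares then passes to the roots and makes them a Cauchy sequence.
sqrt : ∀ x → Pos (x + - 1ℝ) → ∃[ t ] (Pos t × t * t ≃ x)
sqrt x (mkPos g 0<g g≤) = t , mkPos 1ℚ (ℚ.positive⁻¹ 1ℚ) (0 , λ n _ → 1≤root n) , wrap t²-x-null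
  where
  1≤x⊔1 : ∀ n → 1ℚ ℚ.≤ seq x n ℚ.⊔ 1ℚ
  1≤x⊔1 n = ℚ.p≤q⊔p (seq x n) 1ℚ
  approximation : ∀ n → ∃[ r ] (1ℚ ℚ.≤ r × ∣ r ℚ.* r ℚ.- (seq x n ℚ.⊔ 1ℚ) ∣ ℚ.< 1/suc n)
  -- The maximum with 1 repairs early terms of x that may be below 1; it changes nothing eventually.
  approximation n = sqrt-approximation (seq x n ℚ.⊔ 1ℚ) (1/suc n) (1≤x⊔1 n) (ℚ.positive⁻¹ (1/suc n))
  root : ℕ → ℚ
  root n = proj₁ (approximation n)
  1≤root : ∀ n → 1ℚ ℚ.≤ root n
  1≤root n = proj₁ (proj₂ (approximation n))
  shift : ∀ x → x ≡ 1ℚ ℚ.+ ((x ℚ.+ (ℚ.- 1ℚ)) ℚ.- 0ℚ)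
  shift = solve 1 (λ x → x := con 1ℚ :+ ((x :+ (:- con 1ℚ)) :- con 0ℚ)) refl
    where open +-*-Solver
  close : ∀ n → g ℚ.≤ seq (x + - 1ℝ) n → ∣ root n ℚ.* root n ℚ.- seq x n ∣ ℚ.< 1/suc n
  close n g≤x-1 = subst (λ y → ∣ root n ℚ.* root n ℚ.- y ∣ ℚ.< 1/suc n)
    (ℚ.p≥q⇒p⊔q≡p (≤-by (ℚ.≤-trans (ℚ.<⇒≤ 0<g) g≤x-1) (shift (seq x n))))
    (proj₂ (proj₂ (approximation n)))
  t²-x-null : Null (λ n → root n ℚ.* root n ℚ.- seq x n)
  t²-x-null ε 0<ε = eventually-zip (λ n g≤x-1 1/n<ε → ℚ.<-trans (close n g≤x-1) 1/n<ε)
    g≤ (1/suc-eventually ε 0<ε)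
  regroup : ∀ a x y b → a ℚ.- b ≡ ((a ℚ.- x) ℚ.+ (ℚ.- (b ℚ.- y))) ℚ.+ (x ℚ.- y)
  regroup = solve 4 (λ a x y b → a :- b := ((a :- x) :+ (:- (b :- y))) :+ (x :- y)) refl
    where open +-*-Solver
  root-cauchy : IsCauchy root
  root-cauchy ε 0<ε =
    let δ , 0<δ , δ+δ≡ε = halve ε 0<ε
        η , 0<η , η+η≡δ = halve δ 0<δ
        M , near-x = cauchy x δ 0<δ
        N , near-t = t²-x-null η 0<η
    in M ⊔ N , λ m n ≤m ≤n → bound δ η δ+δ≡ε η+η≡δ m n
         (near-x m n (ℕ.m⊔n≤o⇒m≤o M N ≤m) (ℕ.m⊔n≤o⇒m≤o M N ≤n))
         (near-t m (ℕ.m⊔n≤o⇒n≤o M N ≤m)) (near-t n (ℕ.m⊔n≤o⇒n≤o M N ≤n))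
    where
    open ℚ.≤-Reasoning
    bound : ∀ δ η → δ ℚ.+ δ ≡ ε → η ℚ.+ η ≡ δ → ∀ m n → ∣ seq x m ℚ.- seq x n ∣ ℚ.< δ →
      ∣ root m ℚ.* root m ℚ.- seq x m ∣ ℚ.< η → ∣ root n ℚ.* root n ℚ.- seq x n ∣ ℚ.< η →
      ∣ root m ℚ.- root n ∣ ℚ.< ε
    bound δ η δ+δ≡ε η+η≡δ m n x<δ m<η n<η = begin-strict
      ∣ root m ℚ.- root n ∣    ≤⟨ ∣a-b∣≤∣a²-b²∣ (1≤root m) (1≤root n) ⟩
      ∣ a ℚ.- b ∣              ≡⟨ cong ∣_∣ (regroup a (seq x m) (seq x n) b) ⟩
      ∣ (p ℚ.+ (ℚ.- q)) ℚ.+ r ∣      ≤⟨ ℚ.∣p+q∣≤∣p∣+∣q∣ (p ℚ.+ (ℚ.- q)) r ⟩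
      ∣ p ℚ.+ (ℚ.- q) ∣ ℚ.+ ∣ r ∣    ≤⟨ ℚ.+-monoˡ-≤ ∣ r ∣ (ℚ.∣p-q∣≤∣p∣+∣q∣ p q) ⟩
      (∣ p ∣ ℚ.+ ∣ q ∣) ℚ.+ ∣ r ∣    <⟨ ℚ.+-mono-< (ℚ.+-mono-< m<η n<η) x<δ ⟩
      (η ℚ.+ η) ℚ.+ δ                ≡⟨ cong (ℚ._+ δ) η+η≡δ ⟩
      δ ℚ.+ δ                        ≡⟨ δ+δ≡ε ⟩
      ε                              ∎
      where
      a = root m ℚ.* root m
      b = root n ℚ.* root n
      p = a ℚ.- seq x m
      q = b ℚ.- seq x n
      r = seq x m ℚ.- seq x n
  t : ℝ
  t = record { seq = root ; cauchy = root-cauchy }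

-- Complex embeddings

p-q≡0⇒p≡q : ∀ {p q} → p ℚ.- q ≡ 0ℚ → p ≡ q
p-q≡0⇒p≡q {p} {q} eq = trans (solve 2 (λ p q → p := (p :- q) :+ q) refl p q)
  (trans (cong (ℚ._+ q) eq) (ℚ.+-identityˡ q))
  where open +-*-Solver

-- If α³ + nα + d = 0 and s² = 3α²/4 + n, then -α/2 + is is a complex root of
-- the cubic, and α ↦ -α/2 + is extends to an embedding of K.
module ComplexRoot {ℓ} (K : Pred ℝ ℓ) (isSubfield : IsSubfield K)
  (b : Vector ℝ 3) (isBasis : IsℚBasis K b)
  {α s : ℝ} (α∈K : α ∈ K) (irr : Irrational α) (n d : ℤ)
  (cubic : α * (α * α) + fromℤ n * α + fromℤ d ≃ 0ℝ)
  (s>0 : Pos s) (s² : s * s ≃ fromℚ (+ 3 ℚ./ 4) * (α * α) + fromℤ n) where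

  private
    module K = IsSubfield isSubfield
  open CubicField K isSubfield b isBasis
  open RingMorphisms K.rawRing ℂ-rawRing using (IsRingMonomorphism)
  open ℝ-Solver

  -- By the formula for s², the square of β = -α/2 + is is -(α²/2 + n) - iαs; this gives the
  -- coefficients of r.
  re-part im-part : ℝ → ℝ → ℝ → ℝ
  re-part p q r = p + - (fromℚ ½ * (q * α)) + - (r * (fromℚ ½ * (α * α) + fromℤ n))
  im-part p q r = (q + - (r * α)) * s

  -- p + qβ + rβ² for β = -α/2 + is.
  conjugate : ℚ → ℚ → ℚ → ℂ
  conjugate p q r = re-part (fromℚ p) (fromℚ q) (fromℚ r) +i im-part (fromℚ p) (fromℚ q) (fromℚ r)

  -- Abstract, since unfolding the elimination behind it blows up conversion checks.
  abstract
    coordinates : ∀ {x} → x ∈ K → ∃[ p ] ∃[ q ] ∃[ r ] x ≃ quadratic p q r α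
    coordinates x∈K = representation α∈K irr x∈K

  σ : Σ ℝ K → ℂ
  σ (x , x∈K) = let p , q , r , _ = coordinates x∈K in conjugate p q r

  quadratic-injective : ∀ {p q r p′ q′ r′} → quadratic p q r α ≃ quadratic p′ q′ r′ α →
                        p ≡ p′ × q ≡ q′ × r ≡ r′
  quadratic-injective {p} {q} {r} {p′} {q′} {r′} eq =
    let p≡ , q≡ , r≡ = quadratic-independent {p = p ℚ.- p′} {q ℚ.- q′} {r ℚ.- r′} α∈K irr
          (R.trans (pointwise {y = (P + - P′) + (Q + - Q′) * α + (T + - T′) * (α * α)} (λ _ → refl))
            (R.trans (regroup P Q T P′ Q′ T′ α) (≃⇒-≃0 eq)))
    in p-q≡0⇒p≡q p≡ , p-q≡0⇒p≡q q≡ , p-q≡0⇒p≡q r≡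
    where
    P = fromℚ p
    Q = fromℚ q
    T = fromℚ r
    P′ = fromℚ p′
    Q′ = fromℚ q′
    T′ = fromℚ r′
    regroup : ∀ p q r p′ q′ r′ x →
      (p + - p′) + (q + - q′) * x + (r + - r′) * (x * x) ≃
      (p + q * x + r * (x * x)) + - (p′ + q′ * x + r′ * (x * x))
    regroup = solve 7 (λ p q r p′ q′ r′ x →
      (p :+ (:- p′)) :+ (q :+ (:- q′)) :* x :+ (r :+ (:- r′)) :* (x :* x) :=
      (p :+ q :* x :+ r :* (x :* x)) :+ (:- (p′ :+ q′ :* x :+ r′ :* (x :* x)))) R.refl

  conjugate-cong : ∀ {p q r p′ q′ r′} → p ≡ p′ → q ≡ q′ → r ≡ r′ →
                   conjugate p q r ≡ conjugate p′ q′ r′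
  conjugate-cong refl refl refl = refl

  -- Coordinates with respect to 1, α, α² are unique rationals, so the value of σ depends neither on
  -- the membership proof nor on how the coordinates were found. Each homomorphism law may then be
  -- checked on any convenient coordinates.
  σ-conjugate : ∀ {x} (x∈K : x ∈ K) {p q r} → x ≃ quadratic p q r α →
                σ (x , x∈K) ≡ conjugate p q r
  σ-conjugate {x} x∈K {p} {q} {r} eq = go (coordinates x∈K)
    where
    go : (c : ∃[ p ] ∃[ q ] ∃[ r ] x ≃ quadratic p q r α) →
         conjugate (proj₁ c) (proj₁ (proj₂ c)) (proj₁ (proj₂ (proj₂ c))) ≡ conjugate p q r
    go (p′ , q′ , r′ , eq′) =
      let p≡ , q≡ , r≡ = quadratic-injective {p′} {q′} {r′} {p} {q} {r} (R.trans (R.sym eq′) eq)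
      in conjugate-cong p≡ q≡ r≡

  infix 4 _≅_
  record _≅_ (z w : ℂ) : Set where
    constructor _,_
    field
      re≃ : re z ≃ re w
      im≃ : im z ≃ im w
  open _≅_

  _⊕_ _⊗_ : ℂ → ℂ → ℂ
  z ⊕ w = (re z + re w) +i (im z + im w)
  z ⊗ w = (re z * re w + - (im z * im w)) +i (re z * im w + im z * re w)

  conjugate-+ : ∀ p q r p′ q′ r′ →
    conjugate (p ℚ.+ p′) (q ℚ.+ q′) (r ℚ.+ r′) ≅ conjugate p q r ⊕ conjugate p′ q′ r′
  conjugate-+ p q r p′ q′ r′ =
    R.trans (pointwise {y = re-part (fromℚ p + fromℚ p′) (fromℚ q + fromℚ q′) (fromℚ r + fromℚ r′)} (λ _ → refl))
      (re-+ (fromℚ p) (fromℚ q) (fromℚ r) (fromℚ p′) (fromℚ q′) (fromℚ r′) α (fromℤ n)) ,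
    R.trans (pointwise {y = im-part (fromℚ p + fromℚ p′) (fromℚ q + fromℚ q′) (fromℚ r + fromℚ r′)} (λ _ → refl))
      (im-+ (fromℚ q) (fromℚ r) (fromℚ q′) (fromℚ r′) α s)
    where
    re-+ : ∀ p q r p′ q′ r′ α n →
      (p + p′) + - (fromℚ ½ * ((q + q′) * α)) + - ((r + r′) * (fromℚ ½ * (α * α) + n)) ≃
      (p + - (fromℚ ½ * (q * α)) + - (r * (fromℚ ½ * (α * α) + n))) +
      (p′ + - (fromℚ ½ * (q′ * α)) + - (r′ * (fromℚ ½ * (α * α) + n)))
    re-+ = solve 8 (λ p q r p′ q′ r′ α n →
      (p :+ p′) :+ (:- (con ½ :* ((q :+ q′) :* α))) :+ (:- ((r :+ r′) :* (con ½ :* (α :* α) :+ n))) :=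
      (p :+ (:- (con ½ :* (q :* α))) :+ (:- (r :* (con ½ :* (α :* α) :+ n)))) :+
      (p′ :+ (:- (con ½ :* (q′ :* α))) :+ (:- (r′ :* (con ½ :* (α :* α) :+ n))))) R.refl
    im-+ : ∀ q r q′ r′ α s → ((q + q′) + - ((r + r′) * α)) * s ≃
      (q + - (r * α)) * s + (q′ + - (r′ * α)) * s
    im-+ = solve 6 (λ q r q′ r′ α s → ((q :+ q′) :+ (:- ((r :+ r′) :* α))) :* s :=
      (q :+ (:- (r :* α))) :* s :+ (q′ :+ (:- (r′ :* α))) :* s) R.refl

  conjugate-neg : ∀ p q r → conjugate (ℚ.- p) (ℚ.- q) (ℚ.- r) ≅ (- re (conjugate p q r)) +i (- im (conjugate p q r))
  conjugate-neg p q r =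
    R.trans (pointwise {y = re-part (- fromℚ p) (- fromℚ q) (- fromℚ r)} (λ _ → refl))
      (solve 5 (λ p q r α n →
        (:- p) :+ (:- (con ½ :* ((:- q) :* α))) :+ (:- ((:- r) :* (con ½ :* (α :* α) :+ n))) :=
        :- (p :+ (:- (con ½ :* (q :* α))) :+ (:- (r :* (con ½ :* (α :* α) :+ n))))) R.refl
        (fromℚ p) (fromℚ q) (fromℚ r) α (fromℤ n)) ,
    R.trans (pointwise {y = im-part (- fromℚ p) (- fromℚ q) (- fromℚ r)} (λ _ → refl))
      (solve 4 (λ q r α s → ((:- q) :+ (:- ((:- r) :* α))) :* s := :- ((q :+ (:- (r :* α))) :* s)) R.refl
        (fromℚ q) (fromℚ r) α s)

  -- Multiplication modulo X³ + nX + d: the coefficients c₃ and c₄ of degrees 3 and 4 are folded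
  -- back by α³ = -nα - d and α⁴ = -nα² - dα. `C₀`, `C₁`, `C₂` are the same formulas over ℝ, for the
  -- solver.
  module Product (p q r p′ q′ r′ : ℚ) where
    n/1 d/1 c₃ c₄ c₀ c₁ c₂ : ℚ
    n/1 = n ℚ./ 1
    d/1 = d ℚ./ 1
    c₃ = q ℚ.* r′ ℚ.+ r ℚ.* q′
    c₄ = r ℚ.* r′
    c₀ = p ℚ.* p′ ℚ.+ (ℚ.- (d/1 ℚ.* c₃))
    c₁ = p ℚ.* q′ ℚ.+ q ℚ.* p′ ℚ.+ (ℚ.- (n/1 ℚ.* c₃)) ℚ.+ (ℚ.- (d/1 ℚ.* c₄))
    c₂ = p ℚ.* r′ ℚ.+ q ℚ.* q′ ℚ.+ r ℚ.* p′ ℚ.+ (ℚ.- (n/1 ℚ.* c₄))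

    C₀ C₁ C₂ : (p q r p′ q′ r′ n d : ℝ) → ℝ
    C₀ p q r p′ q′ r′ n d = p * p′ + - (d * (q * r′ + r * q′))
    C₁ p q r p′ q′ r′ n d = p * q′ + q * p′ + - (n * (q * r′ + r * q′)) + - (d * (r * r′))
    C₂ p q r p′ q′ r′ n d = p * r′ + q * q′ + r * p′ + - (n * (r * r′))

    P = fromℚ p
    Q = fromℚ q
    T = fromℚ r
    P′ = fromℚ p′
    Q′ = fromℚ q′
    T′ = fromℚ r′
    N = fromℤ n
    D = fromℤ d

    real-product : quadratic p q r α * quadratic p′ q′ r′ α ≃ quadratic c₀ c₁ c₂ α
    real-product = R.trans (≃0⇒≃ cubic (identity P Q T P′ Q′ T′ N D α)) (pointwise (λ _ → refl))
      where
      identity : ∀ p q r p′ q′ r′ n d α →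
        (p + q * α + r * (α * α)) * (p′ + q′ * α + r′ * (α * α)) ≃
        (C₀ p q r p′ q′ r′ n d + C₁ p q r p′ q′ r′ n d * α + C₂ p q r p′ q′ r′ n d * (α * α))
          + (r * r′ * α + r * q′ + q * r′) * (α * (α * α) + n * α + d)
      identity = solve 9 (λ p q r p′ q′ r′ n d α →
        (p :+ q :* α :+ r :* (α :* α)) :* (p′ :+ q′ :* α :+ r′ :* (α :* α)) :=
        ((p :* p′ :+ (:- (d :* (q :* r′ :+ r :* q′))))
          :+ (p :* q′ :+ q :* p′ :+ (:- (n :* (q :* r′ :+ r :* q′))) :+ (:- (d :* (r :* r′)))) :* α
          :+ (p :* r′ :+ q :* q′ :+ r :* p′ :+ (:- (n :* (r :* r′)))) :* (α :* α))
          :+ (r :* r′ :* α :+ r :* q′ :+ q :* r′) :* (α :* (α :* α) :+ n :* α :+ d)) R.refl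

    conjugate-* : conjugate c₀ c₁ c₂ ≅ conjugate p q r ⊗ conjugate p′ q′ r′
    conjugate-* =
      R.trans (pointwise {y = re-part (C₀ P Q T P′ Q′ T′ N D) (C₁ P Q T P′ Q′ T′ N D) (C₂ P Q T P′ Q′ T′ N D)} (λ _ → refl))
        (R.trans (≃0⇒≃ cubic (re-identity P Q T P′ Q′ T′ N D α s)) (≃0⇒≃ (≃⇒-≃0 s²) R.refl)) ,
      R.trans (pointwise {y = im-part (C₀ P Q T P′ Q′ T′ N D) (C₁ P Q T P′ Q′ T′ N D) (C₂ P Q T P′ Q′ T′ N D)} (λ _ → refl))
        (≃0⇒≃ cubic (im-identity P Q T P′ Q′ T′ N D α s))
      where
      re-identity : ∀ p q r p′ q′ r′ n d α s →
        C₀ p q r p′ q′ r′ n d + - (fromℚ ½ * (C₁ p q r p′ q′ r′ n d * α))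
          + - (C₂ p q r p′ q′ r′ n d * (fromℚ ½ * (α * α) + n)) ≃
        (((p + - (fromℚ ½ * (q * α)) + - (r * (fromℚ ½ * (α * α) + n)))
           * (p′ + - (fromℚ ½ * (q′ * α)) + - (r′ * (fromℚ ½ * (α * α) + n)))
          + - ((q + - (r * α)) * s * ((q′ + - (r′ * α)) * s)))
          + ((q + - (r * α)) * (q′ + - (r′ * α))) * (s * s + - (fromℚ (+ 3 ℚ./ 4) * (α * α) + n)))
        + (fromℚ ½ * (r * r′ * α) + - (r * q′) + - (q * r′)) * (α * (α * α) + n * α + d)
      re-identity = solve 10 (λ p q r p′ q′ r′ n d α s →
        (p :* p′ :+ (:- (d :* (q :* r′ :+ r :* q′))))
          :+ (:- (con ½ :* ((p :* q′ :+ q :* p′ :+ (:- (n :* (q :* r′ :+ r :* q′))) :+ (:- (d :* (r :* r′)))) :* α)))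
          :+ (:- ((p :* r′ :+ q :* q′ :+ r :* p′ :+ (:- (n :* (r :* r′)))) :* (con ½ :* (α :* α) :+ n))) :=
        (((p :+ (:- (con ½ :* (q :* α))) :+ (:- (r :* (con ½ :* (α :* α) :+ n))))
           :* (p′ :+ (:- (con ½ :* (q′ :* α))) :+ (:- (r′ :* (con ½ :* (α :* α) :+ n))))
          :+ (:- ((q :+ (:- (r :* α))) :* s :* ((q′ :+ (:- (r′ :* α))) :* s))))
          :+ ((q :+ (:- (r :* α))) :* (q′ :+ (:- (r′ :* α)))) :* (s :* s :+ (:- (con (+ 3 ℚ./ 4) :* (α :* α) :+ n))))
        :+ (con ½ :* (r :* r′ :* α) :+ (:- (r :* q′)) :+ (:- (q :* r′))) :* (α :* (α :* α) :+ n :* α :+ d)) R.refl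
      im-identity : ∀ p q r p′ q′ r′ n d α s →
        (C₁ p q r p′ q′ r′ n d + - (C₂ p q r p′ q′ r′ n d * α)) * s ≃
        ((p + - (fromℚ ½ * (q * α)) + - (r * (fromℚ ½ * (α * α) + n))) * ((q′ + - (r′ * α)) * s)
          + (q + - (r * α)) * s * (p′ + - (fromℚ ½ * (q′ * α)) + - (r′ * (fromℚ ½ * (α * α) + n))))
        + - (r * r′ * s) * (α * (α * α) + n * α + d)
      im-identity = solve 10 (λ p q r p′ q′ r′ n d α s →
        ((p :* q′ :+ q :* p′ :+ (:- (n :* (q :* r′ :+ r :* q′))) :+ (:- (d :* (r :* r′))))
          :+ (:- ((p :* r′ :+ q :* q′ :+ r :* p′ :+ (:- (n :* (r :* r′)))) :* α))) :* s :=
        ((p :+ (:- (con ½ :* (q :* α))) :+ (:- (r :* (con ½ :* (α :* α) :+ n)))) :* ((q′ :+ (:- (r′ :* α))) :* s)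
          :+ (q :+ (:- (r :* α))) :* s :* (p′ :+ (:- (con ½ :* (q′ :* α))) :+ (:- (r′ :* (con ½ :* (α :* α) :+ n)))))
        :+ (:- (r :* r′ :* s)) :* (α :* (α :* α) :+ n :* α :+ d)) R.refl

  -- The imaginary parts differ by s ((q - q′) + (r′ - r) α). Since s is not 0 and α is irrational,
  -- q = q′ and r = r′; the real parts then give p = p′.
  conjugate-injective : ∀ p q r p′ q′ r′ → conjugate p q r ≅ conjugate p′ q′ r′ →
    p ≡ p′ × q ≡ q′ × r ≡ r′
  conjugate-injective p q r p′ q′ r′ (re≃ , im≃) =
    let q≡ , r≡ = linear-independent {a = q ℚ.- q′} {r′ ℚ.- r} irr
          (R.trans (pointwise {y = (Q + - Q′) + (T′ + - T) * α} (λ _ → refl))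
            (x*y≃0⇒y≃0 (R.trans (im-difference Q T Q′ T′ α s) (≃⇒-≃0 im≃)) (pos⇒≄0 s>0)))
        q≡q′ = p-q≡0⇒p≡q q≡
        r≡r′ = sym (p-q≡0⇒p≡q r≡)
        p-p′≃0 = R.trans
          (R.trans (pointwise {fromℚ (p ℚ.- p′)} {P + - P′} (λ _ → refl))
            (≃0⇒≃ (≃⇒-≃0 (fromℚ-cong r≡r′)) (≃0⇒≃ (≃⇒-≃0 (fromℚ-cong q≡q′))
              (re-difference P Q T P′ Q′ T′ α (fromℤ n)))))
          (≃⇒-≃0 re≃)
    in p-q≡0⇒p≡q (fromℚ≃0 p-p′≃0) , q≡q′ , r≡r′
    where
    P = fromℚ p
    Q = fromℚ q
    T = fromℚ r
    P′ = fromℚ p′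
    Q′ = fromℚ q′
    T′ = fromℚ r′
    im-difference : ∀ q r q′ r′ α s → s * ((q + - q′) + (r′ + - r) * α) ≃
      (q + - (r * α)) * s + - ((q′ + - (r′ * α)) * s)
    im-difference = solve 6 (λ q r q′ r′ α s → s :* ((q :+ (:- q′)) :+ (r′ :+ (:- r)) :* α) :=
      (q :+ (:- (r :* α))) :* s :+ (:- ((q′ :+ (:- (r′ :* α))) :* s))) R.refl
    re-difference : ∀ p q r p′ q′ r′ α n → p + - p′ ≃
      (((p + - (fromℚ ½ * (q * α)) + - (r * (fromℚ ½ * (α * α) + n)))
        + - (p′ + - (fromℚ ½ * (q′ * α)) + - (r′ * (fromℚ ½ * (α * α) + n))))
        + (fromℚ ½ * (α * α) + n) * (r + - r′)) + (fromℚ ½ * α) * (q + - q′)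
    re-difference = solve 8 (λ p q r p′ q′ r′ α n → p :+ (:- p′) :=
      (((p :+ (:- (con ½ :* (q :* α))) :+ (:- (r :* (con ½ :* (α :* α) :+ n))))
        :+ (:- (p′ :+ (:- (con ½ :* (q′ :* α))) :+ (:- (r′ :* (con ½ :* (α :* α) :+ n))))))
        :+ (con ½ :* (α :* α) :+ n) :* (r :+ (:- r′))) :+ (con ½ :* α) :* (q :+ (:- q′))) R.refl

  ≡⇒≅ : ∀ {z w} → z ≡ w → z ≅ w
  ≡⇒≅ refl = R.refl , R.refl

  ≅-trans : ∀ {z w v} → z ≅ w → w ≅ v → z ≅ v
  ≅-trans (re≃ , im≃) (re≃′ , im≃′) = R.trans re≃ re≃′ , R.trans im≃ im≃′

  unwrap-≅ : ∀ {z w} → z ≅ w → re z ≈ re w × im z ≈ im w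
  unwrap-≅ (re≃ , im≃) = unwrap re≃ , unwrap im≃

  Coordinates : ℝ → Set
  Coordinates x = ∃[ p ] ∃[ q ] ∃[ r ] x ≃ quadratic p q r α

  σ-cong : ∀ {x y} (x∈K : x ∈ K) (y∈K : y ∈ K) → x ≃ y → σ (x , x∈K) ≅ σ (y , y∈K)
  σ-cong x∈K y∈K x≃y = go (coordinates y∈K)
    where
    go : Coordinates _ → σ (_ , x∈K) ≅ σ (_ , y∈K)
    go (p , q , r , y≃) =
      ≡⇒≅ (trans (σ-conjugate x∈K {p} {q} {r} (R.trans x≃y y≃)) (sym (σ-conjugate y∈K y≃)))

  σ-injective : ∀ {x y} (x∈K : x ∈ K) (y∈K : y ∈ K) → σ (x , x∈K) ≅ σ (y , y∈K) → x ≃ y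
  σ-injective {x} {y} x∈K y∈K eq = go (coordinates x∈K) (coordinates y∈K)
    where
    go : Coordinates x → Coordinates y → x ≃ y
    go (p , q , r , x≃) (p′ , q′ , r′ , y≃) = finish
      (conjugate-injective p q r p′ q′ r′ (≅-trans (≡⇒≅ (sym (σ-conjugate x∈K x≃)))
        (≅-trans eq (≡⇒≅ (σ-conjugate y∈K y≃)))))
      where
      finish : p ≡ p′ × q ≡ q′ × r ≡ r′ → x ≃ y
      finish (p≡ , q≡ , r≡) = R.trans x≃ (R.trans
        (R.+-cong (R.+-cong (fromℚ-cong p≡) (R.*-congʳ (fromℚ-cong q≡))) (R.*-congʳ (fromℚ-cong r≡)))
        (R.sym y≃))

  σ-+ : ∀ {x y} (x∈K : x ∈ K) (y∈K : y ∈ K) →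
        σ (x + y , K.+-closed x∈K y∈K) ≅ σ (x , x∈K) ⊕ σ (y , y∈K)
  σ-+ {x} {y} x∈K y∈K = go (coordinates x∈K) (coordinates y∈K)
    where
    regroup : ∀ p q r p′ q′ r′ α →
      (p + q * α + r * (α * α)) + (p′ + q′ * α + r′ * (α * α)) ≃
      (p + p′) + (q + q′) * α + (r + r′) * (α * α)
    regroup = solve 7 (λ p q r p′ q′ r′ α →
      (p :+ q :* α :+ r :* (α :* α)) :+ (p′ :+ q′ :* α :+ r′ :* (α :* α)) :=
      (p :+ p′) :+ (q :+ q′) :* α :+ (r :+ r′) :* (α :* α)) R.refl
    go : Coordinates x → Coordinates y → σ (x + y , K.+-closed x∈K y∈K) ≅ σ (x , x∈K) ⊕ σ (y , y∈K)
    go (p , q , r , x≃) (p′ , q′ , r′ , y≃) = ≅-trans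
      (≡⇒≅ (σ-conjugate (K.+-closed x∈K y∈K) {p ℚ.+ p′} {q ℚ.+ q′} {r ℚ.+ r′} (R.trans (R.+-cong x≃ y≃)
        (R.trans (regroup (fromℚ p) (fromℚ q) (fromℚ r) (fromℚ p′) (fromℚ q′) (fromℚ r′) α)
          (pointwise (λ _ → refl))))))
      (≅-trans (conjugate-+ p q r p′ q′ r′)
        (≡⇒≅ (sym (cong₂ _⊕_ (σ-conjugate x∈K x≃) (σ-conjugate y∈K y≃)))))

  σ-* : ∀ {x y} (x∈K : x ∈ K) (y∈K : y ∈ K) →
        σ (x * y , K.*-closed x∈K y∈K) ≅ σ (x , x∈K) ⊗ σ (y , y∈K)
  σ-* {x} {y} x∈K y∈K = go (coordinates x∈K) (coordinates y∈K)
    where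
    go : Coordinates x → Coordinates y → σ (x * y , K.*-closed x∈K y∈K) ≅ σ (x , x∈K) ⊗ σ (y , y∈K)
    go (p , q , r , x≃) (p′ , q′ , r′ , y≃) = ≅-trans
      (≡⇒≅ (σ-conjugate (K.*-closed x∈K y∈K) {c₀} {c₁} {c₂} (R.trans (R.*-cong x≃ y≃) real-product)))
      (≅-trans conjugate-*
        (≡⇒≅ (sym (cong₂ _⊗_ (σ-conjugate x∈K x≃) (σ-conjugate y∈K y≃)))))
      where open Product p q r p′ q′ r′

  σ-neg : ∀ {x} (x∈K : x ∈ K) →
    σ (- x , K.neg-closed x∈K) ≅ (- re (σ (x , x∈K))) +i (- im (σ (x , x∈K)))
  σ-neg {x} x∈K = go (coordinates x∈K)
    where
    regroup : ∀ p q r α → - (p + q * α + r * (α * α)) ≃ - p + - q * α + - r * (α * α)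
    regroup = solve 4 (λ p q r α → :- (p :+ q :* α :+ r :* (α :* α)) :=
      (:- p) :+ (:- q) :* α :+ (:- r) :* (α :* α)) R.refl
    go : Coordinates x → σ (- x , K.neg-closed x∈K) ≅ (- re (σ (x , x∈K))) +i (- im (σ (x , x∈K)))
    go (p , q , r , x≃) = ≅-trans
      (≡⇒≅ (σ-conjugate (K.neg-closed x∈K) {ℚ.- p} {ℚ.- q} {ℚ.- r} (R.trans (R.-‿cong x≃)
        (R.trans (regroup (fromℚ p) (fromℚ q) (fromℚ r) α) (pointwise (λ _ → refl))))))
      (≅-trans (conjugate-neg p q r)
        (≡⇒≅ (sym (cong (λ z → (- re z) +i (- im z)) (σ-conjugate x∈K x≃)))))

  σ-0 : σ (0ℝ , K.0-closed) ≅ (0ℝ +i 0ℝ)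
  σ-0 = ≅-trans
    (≡⇒≅ (σ-conjugate K.0-closed {0ℚ} {0ℚ} {0ℚ}
      (solve 1 (λ α → con 0ℚ := con 0ℚ :+ con 0ℚ :* α :+ con 0ℚ :* (α :* α)) R.refl α)))
    (solve 2 (λ α n → con 0ℚ :+ (:- (con ½ :* (con 0ℚ :* α))) :+ (:- (con 0ℚ :* (con ½ :* (α :* α) :+ n))) := con 0ℚ)
       R.refl α (fromℤ n) ,
     solve 2 (λ α s → (con 0ℚ :+ (:- (con 0ℚ :* α))) :* s := con 0ℚ) R.refl α s)

  σ-1 : σ (1ℝ , K.1-closed) ≅ (1ℝ +i 0ℝ)
  σ-1 = ≅-trans
    (≡⇒≅ (σ-conjugate K.1-closed {1ℚ} {0ℚ} {0ℚ}
      (solve 1 (λ α → con 1ℚ := con 1ℚ :+ con 0ℚ :* α :+ con 0ℚ :* (α :* α)) R.refl α)))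
    (solve 2 (λ α n → con 1ℚ :+ (:- (con ½ :* (con 0ℚ :* α))) :+ (:- (con 0ℚ :* (con ½ :* (α :* α) :+ n))) := con 1ℚ)
       R.refl α (fromℤ n) ,
     solve 2 (λ α s → (con 0ℚ :+ (:- (con 0ℚ :* α))) :* s := con 0ℚ) R.refl α s)

  σ-monomorphism : IsRingMonomorphism σ
  σ-monomorphism = record
    { isRingHomomorphism = record
      { isSemiringHomomorphism = record
        { isNearSemiringHomomorphism = record
          { +-isMonoidHomomorphism = record
            { isMagmaHomomorphism = record
              { isRelHomomorphism = record
                { cong = λ { {x , x∈K} {y , y∈K} x≈y → unwrap-≅ (σ-cong x∈K y∈K (wrap x≈y)) } }
              ; homo = λ { (x , x∈K) (y , y∈K) → unwrap-≅ (σ-+ x∈K y∈K) }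
              }
            ; ε-homo = unwrap-≅ σ-0
            }
          ; *-homo = λ { (x , x∈K) (y , y∈K) → unwrap-≅ (σ-* x∈K y∈K) }
          }
        ; 1#-homo = unwrap-≅ σ-1
        }
      ; -‿homo = λ { (x , x∈K) → unwrap-≅ (σ-neg x∈K) }
      }
    ; injective = λ { {x , x∈K} {y , y∈K} (re≈ , im≈) → unwrap (σ-injective x∈K y∈K (wrap re≈ , wrap im≈)) }
    }

  σα-not-real : ¬ im (σ (α , α∈K)) ≃ 0ℝ
  σα-not-real eq = pos⇒≄0 s>0 (R.trans
    (solve 2 (λ α s → s := (con 1ℚ :+ (:- (con 0ℚ :* α))) :* s) R.refl α s)
    (R.trans (im≃ (≡⇒≅ (sym (σ-conjugate α∈K {0ℚ} {1ℚ} {0ℚ}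
      (solve 1 (λ α → α := con 0ℚ :+ con 1ℚ :* α :+ con 0ℚ :* (α :* α)) R.refl α))))) eq))

-- The location of the roots

0<i⇒1≤i : ∀ {i} → + 0 ℤ.< i → + 1 ℤ.≤ i
0<i⇒1≤i = ℤ.i<j⇒suc[i]≤j

no-integer-between-0-and-1 : ∀ {x} → x ∈ Integer → Pos x → ¬ Pos (1ℝ + - x)
no-integer-between-0-and-1 {x} (i , x≃i) x>0 x<1 = ℤ.<-irrefl refl (ℤ.<-≤-trans
  (pos-fromℤ⁻¹ {+ 1 ℤ.- i} (pos-resp 1-x≃ x<1))
  (ℤ.i≤j⇒i-j≤0 (0<i⇒1≤i (pos-fromℤ⁻¹ {i} (pos-resp x≃i x>0)))))
  where
  1-x≃ : 1ℝ + - x ≃ fromℤ (+ 1 ℤ.- i)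
  1-x≃ = R.trans (R.+-congˡ (R.-‿cong x≃i))
    (R.sym (R.trans (fromℤ-+ (+ 1) (ℤ.- i)) (R.+-congˡ (fromℤ-neg i))))

module TotallyRealCubic {ℓ} (K : Pred ℝ ℓ) (isSubfield : IsSubfield K)
  (b : Vector ℝ 3) (isBasis : IsℚBasis K b)
  (embeddings-real : ∀ (σ : Σ ℝ K → ℂ) →
    RingMorphisms.IsRingMonomorphism (IsSubfield.rawRing isSubfield) ℂ-rawRing σ →
    ∀ x → im (σ x) ≈ 0ℝ) where

  private
    module K = IsSubfield isSubfield
  open CubicField K isSubfield b isBasis
  open SmallIntegral K isSubfield b isBasis using (small-integral)
  open ℝ-Solver

  module Root {w : ℝ} (w∈K : w ∈ K) (irr : Irrational w)
              (w>0 : Pos w) (w<1 : Pos (1ℝ + - w)) where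

    1+w>0 : Pos (1ℝ + w)
    1+w>0 = pos-+ pos-1 w>0

    -- The cofactor of X - w is X² + wX + w² + n, of discriminant -4 (3w²/4 + n). For n = k + 1 the
    -- number 3w²/4 + n exceeds 1, as `sqrt` demands, and its root is the imaginary part of a
    -- nonreal conjugate of w.
    n≱1 : ∀ k d → ¬ w * (w * w) + fromℤ (+ suc k) * w + fromℤ d ≃ 0ℝ
    n≱1 k d eq = contradicts (sqrt (fromℚ (+ 3 ℚ./ 4) * (w * w) + fromℤ (+ suc k))
      (pos-resp (R.trans (regroup w (fromℤ (+ k)))
          (R.+-congʳ (R.+-congˡ (R.sym (fromℤ-+ (+ 1) (+ k))))))
        (pos-+ℕ k (pos-* (pos-fromℚ (ℚ.positive⁻¹ (+ 3 ℚ./ 4))) (pos-* w>0 w>0)))))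
      where
      regroup : ∀ w k → fromℚ (+ 3 ℚ./ 4) * (w * w) + k ≃
                        fromℚ (+ 3 ℚ./ 4) * (w * w) + (1ℝ + k) + - 1ℝ
      regroup = solve 2 (λ w k → con (+ 3 ℚ./ 4) :* (w :* w) :+ k :=
        con (+ 3 ℚ./ 4) :* (w :* w) :+ (con 1ℚ :+ k) :+ (:- con 1ℚ)) R.refl
      contradicts : ¬ (∃[ s ] (Pos s × s * s ≃ fromℚ (+ 3 ℚ./ 4) * (w * w) + fromℤ (+ suc k)))
      contradicts (s , s>0 , s²) =
        C.σα-not-real (wrap (embeddings-real C.σ C.σ-monomorphism (w , w∈K)))
        where module C = ComplexRoot K isSubfield b isBasis w∈K irr (+ suc k) d eq s>0 s²

    -- The integer -d would equal w³, strictly between 0 and 1.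
    n≢0 : ∀ d → ¬ w * (w * w) + fromℤ (+ 0) * w + fromℤ d ≃ 0ℝ
    n≢0 d eq = no-integer-between-0-and-1 (integer-neg (integer-fromℤ d))
      (pos-resp (≃0⇒≃ eq (lower w (fromℤ d))) (pos-* w>0 (pos-* w>0 w>0)))
      (pos-resp (≃0⇒≃ eq (upper w (fromℤ d)))
        (pos-+ w<1 (pos-* w>0 (pos-* w<1 1+w>0))))
      where
      lower : ∀ w d → w * (w * w) ≃ - d + 1ℝ * (w * (w * w) + fromℤ (+ 0) * w + d)
      lower = solve 2 (λ w d →
        w :* (w :* w) := (:- d) :+ con 1ℚ :* (w :* (w :* w) :+ con 0ℚ :* w :+ d)) R.refl
      upper : ∀ w d → (1ℝ + - w) + w * ((1ℝ + - w) * (1ℝ + w)) ≃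
        (1ℝ + - (- d)) + - 1ℝ * (w * (w * w) + fromℤ (+ 0) * w + d)
      upper = solve 2 (λ w d → (con 1ℚ :+ (:- w)) :+ w :* ((con 1ℚ :+ (:- w)) :* (con 1ℚ :+ w)) :=
        (con 1ℚ :+ (:- (:- d))) :+ (:- con 1ℚ) :* (w :* (w :* w) :+ con 0ℚ :* w :+ d)) R.refl

    -- The integer d would equal w (1 - w²), which is positive, and 1 - d would be w³ + (1 - w),
    -- positive too.
    n≢-1 : ∀ d → ¬ w * (w * w) + fromℤ (ℤ.- + 1) * w + fromℤ d ≃ 0ℝ
    n≢-1 d eq = no-integer-between-0-and-1 (integer-fromℤ d)
      (pos-resp (≃0⇒≃ eq (lower w (fromℤ d))) (pos-* w>0 (pos-* w<1 1+w>0)))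
      (pos-resp (≃0⇒≃ eq (upper w (fromℤ d))) (pos-+ (pos-* w>0 (pos-* w>0 w>0)) w<1))
      where
      lower : ∀ w d → w * ((1ℝ + - w) * (1ℝ + w)) ≃
        d + - 1ℝ * (w * (w * w) + fromℤ (ℤ.- + 1) * w + d)
      lower = solve 2 (λ w d → w :* ((con 1ℚ :+ (:- w)) :* (con 1ℚ :+ w)) :=
        d :+ (:- con 1ℚ) :* (w :* (w :* w) :+ con ((ℤ.- + 1) ℚ./ 1) :* w :+ d)) R.refl
      upper : ∀ w d → w * (w * w) + (1ℝ + - w) ≃
        (1ℝ + - d) + 1ℝ * (w * (w * w) + fromℤ (ℤ.- + 1) * w + d)
      upper = solve 2 (λ w d → w :* (w :* w) :+ (con 1ℚ :+ (:- w)) :=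
        (con 1ℚ :+ (:- d)) :+ con 1ℚ :* (w :* (w :* w) :+ con ((ℤ.- + 1) ℚ./ 1) :* w :+ d)) R.refl

    -- Here 0 < d < 2, and X³ - 2X + 1 = (X - 1)(X² + X - 1) is reducible.
    n≢-2 : ∀ d → ¬ w * (w * w) + fromℤ (ℤ.- + 2) * w + fromℤ d ≃ 0ℝ
    n≢-2 d eq = case proj₂ (proj₂ (quadratic-independent {p = ℚ.- 1ℚ} {1ℚ} {1ℚ} w∈K irr
        (R.trans (pointwise {y = - 1ℝ + 1ℝ * w + 1ℝ * (w * w)} (λ _ → refl))
          (x*y≃0⇒y≃0 (R.trans
            (≃0⇒≃ (≃⇒-≃0 (fromℚ-cong (cong (ℚ._/ 1) d≡1))) (factor w (fromℤ d)))
            (R.trans (R.-‿cong eq) (solve 0 (:- con 0ℚ := con 0ℚ) R.refl)))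
            (pos⇒≄0 w<1))))) of λ ()
      where
      lower : ∀ w d → w * ((1ℝ + - w) * (1ℝ + w)) + w ≃
        d + - 1ℝ * (w * (w * w) + fromℤ (ℤ.- + 2) * w + d)
      lower = solve 2 (λ w d → w :* ((con 1ℚ :+ (:- w)) :* (con 1ℚ :+ w)) :+ w :=
        d :+ (:- con 1ℚ) :* (w :* (w :* w) :+ con ((ℤ.- + 2) ℚ./ 1) :* w :+ d)) R.refl
      upper : ∀ w d → w * (w * w) + ((1ℝ + - w) + (1ℝ + - w)) ≃
        (fromℤ (+ 2) + - d) + 1ℝ * (w * (w * w) + fromℤ (ℤ.- + 2) * w + d)
      upper = solve 2 (λ w d → w :* (w :* w) :+ ((con 1ℚ :+ (:- w)) :+ (con 1ℚ :+ (:- w))) :=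
        (con (+ 2 ℚ./ 1) :+ (:- d)) :+ con 1ℚ :* (w :* (w :* w) :+ con ((ℤ.- + 2) ℚ./ 1) :* w :+ d)) R.refl
      factor : ∀ w d → (1ℝ + - w) * (- 1ℝ + 1ℝ * w + 1ℝ * (w * w)) ≃
        - (w * (w * w) + fromℤ (ℤ.- + 2) * w + d) + 1ℝ * (d + - fromℤ (+ 1))
      factor = solve 2 (λ w d → (con 1ℚ :+ (:- w)) :* ((:- con 1ℚ) :+ con 1ℚ :* w :+ con 1ℚ :* (w :* w)) :=
        (:- (w :* (w :* w) :+ con ((ℤ.- + 2) ℚ./ 1) :* w :+ d)) :+ con 1ℚ :* (d :+ (:- con 1ℚ))) R.refl
      2-d≃ : fromℤ (+ 2) + - fromℤ d ≃ fromℤ (+ 2 ℤ.- d)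
      2-d≃ = R.sym (R.trans (fromℤ-+ (+ 2) (ℤ.- d)) (R.+-congˡ (fromℤ-neg d)))
      1≤d : + 1 ℤ.≤ d
      1≤d = 0<i⇒1≤i (pos-fromℤ⁻¹ (pos-resp (≃0⇒≃ eq (lower w (fromℤ d)))
        (pos-+ (pos-* w>0 (pos-* w<1 1+w>0)) w>0)))
      1≤2-d : + 1 ℤ.≤ + 2 ℤ.- d
      1≤2-d = 0<i⇒1≤i (pos-fromℤ⁻¹ (pos-resp (R.trans (≃0⇒≃ eq (upper w (fromℤ d))) 2-d≃)
        (pos-+ (pos-* w>0 (pos-* w>0 w>0)) (pos-+ w<1 w<1))))
      d≡1 : d ≡ + 1
      d≡1 = ℤ.≤-antisym (ℤ.0≤i-j⇒j≤i (subst (+ 0 ℤ.≤_)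
        (ℤ-Solver.solve 1 (λ d → (ℤ-Solver.con (+ 2) ℤ-Solver.:- d) ℤ-Solver.:- ℤ-Solver.con (+ 1)
          ℤ-Solver.:= ℤ-Solver.con (+ 1) ℤ-Solver.:- d) refl d)
        (ℤ.i≤j⇒0≤j-i 1≤2-d))) 1≤d

    n≤-3 : ∀ n d → w * (w * w) + fromℤ n * w + fromℤ d ≃ 0ℝ → ∃[ k ] n ≡ -[1+ suc (suc k) ]
    n≤-3 (+ suc k) d eq = ⊥-elim (n≱1 k d eq)
    n≤-3 (+ 0) d eq = ⊥-elim (n≢0 d eq)
    n≤-3 -[1+ 0 ] d eq = ⊥-elim (n≢-1 d eq)
    n≤-3 -[1+ 1 ] d eq = ⊥-elim (n≢-2 d eq)
    n≤-3 -[1+ suc (suc k) ] d eq = k , refl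

  -- The constant terms of the two cubics and membership in the two sets

  module Conclusion {w : ℝ} (w∈K : w ∈ K) (irr : Irrational w) (w>0 : Pos w) (w<1 : Pos (1ℝ + - w))
    (k : ℕ) (d : ℤ) (eq : w * (w * w) + fromℤ -[1+ suc (suc k) ] * w + fromℤ d ≃ 0ℝ) where

    -- For f = X³ + nX + d, the number e is -f(1), which is also the constant term of -f(1 - X). The
    -- upper bound d ≤ -n - 2 is 1 ≤ e, and the upper bound on e for m = -3 is 1 ≤ d, so the two
    -- conditions change places under w ↦ 1 - w.
    n e : ℤ
    n = -[1+ suc (suc k) ]
    e = ℤ.- (+ 1 ℤ.+ n ℤ.+ d)

    n+3+k≃0 : fromℤ n + (fromℤ (+ 3) + fromℤ (+ k)) ≃ 0ℝ
    n+3+k≃0 = R.trans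
      (R.+-cong (fromℤ-neg (+ suc (suc (suc k)))) (R.sym (fromℤ-+ (+ 3) (+ k))))
      (R.-‿inverseˡ (fromℤ (+ suc (suc (suc k)))))

    e≃ : fromℤ e ≃ - (1ℝ + fromℤ n + fromℤ d)
    e≃ = R.trans (fromℤ-neg (+ 1 ℤ.+ n ℤ.+ d))
      (R.-‿cong (R.trans (fromℤ-+ (+ 1 ℤ.+ n) d) (R.+-congʳ (fromℤ-+ (+ 1) n))))

    n≤-3 : n ℤ.≤ ℤ.- + 3
    n≤-3 = ℤ.-≤- (ℕ.s≤s (ℕ.s≤s ℕ.z≤n))

    1-w²>0 : Pos ((1ℝ + - w) * (1ℝ + w))
    1-w²>0 = pos-* w<1 (pos-+ pos-1 w>0)

    -- Since -n = k + 3, the equation gives d = w (k + 3 - w²), and k + 3 - w² = (1 - w²) + 2 + k is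
    -- positive.
    1≤d : + 1 ℤ.≤ d
    1≤d = 0<i⇒1≤i (pos-fromℤ⁻¹ (pos-resp
      (≃0⇒≃ eq (≃0⇒≃ n+3+k≃0 (identity w (fromℤ n) (fromℤ d) (fromℤ (+ k)))))
      (pos-* w>0 (pos-+ℕ k (pos-+ 1-w²>0 (pos-fromℚ (ℚ.positive⁻¹ (+ 2 ℚ./ 1))))))))
      where
      identity : ∀ w n d k → w * ((1ℝ + - w) * (1ℝ + w) + fromℤ (+ 2) + k) ≃
        (d + - 1ℝ * (w * (w * w) + n * w + d)) + w * (n + (fromℤ (+ 3) + k))
      identity = solve 4 (λ w n d k →
        w :* ((con 1ℚ :+ (:- w)) :* (con 1ℚ :+ w) :+ con (+ 2 ℚ./ 1) :+ k) :=
        (d :+ (:- con 1ℚ) :* (w :* (w :* w) :+ n :* w :+ d)) :+ w :* (n :+ (con (+ 3 ℚ./ 1) :+ k))) R.refl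

    -- As f(w) = 0, e = f(w) - f(1), which is divisible by 1 - w with quotient k + 2 - w - w² = (1 -
    -- w) + (1 - w²) + k.
    1≤e : + 1 ℤ.≤ e
    1≤e = 0<i⇒1≤i (pos-fromℤ⁻¹ (pos-resp
      (R.trans (≃0⇒≃ eq (≃0⇒≃ n+3+k≃0 (identity w (fromℤ n) (fromℤ d) (fromℤ (+ k))))) (R.sym e≃))
      (pos-* w<1 (pos-+ℕ k (pos-+ w<1 1-w²>0)))))
      where
      identity : ∀ w n d k → (1ℝ + - w) * ((1ℝ + - w) + (1ℝ + - w) * (1ℝ + w) + k) ≃
        (- (1ℝ + n + d) + 1ℝ * (w * (w * w) + n * w + d)) + (1ℝ + - w) * (n + (fromℤ (+ 3) + k))
      identity = solve 4 (λ w n d k →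
        (con 1ℚ :+ (:- w)) :* ((con 1ℚ :+ (:- w)) :+ (con 1ℚ :+ (:- w)) :* (con 1ℚ :+ w) :+ k) :=
        ((:- (con 1ℚ :+ n :+ d)) :+ con 1ℚ :* (w :* (w :* w) :+ n :* w :+ d))
          :+ (con 1ℚ :+ (:- w)) :* (n :+ (con (+ 3 ℚ./ 1) :+ k))) R.refl

    w∈S₀ : w ∈ S³ᵗʳ (+ 0)
    w∈S₀ = n , n≤-3 ,
      (pos⇒< (pos-resp (solve 1 (λ w → w := w :+ (:- con 0ℚ)) R.refl w) w>0) , pos⇒< w<1) ,
      d , 1≤d ,
      ℤ.0≤i-j⇒j≤i (subst (+ 0 ℤ.≤_) (rearrange n d) (ℤ.i≤j⇒0≤j-i 1≤e)) ,
      unwrap (R.trans (powers w (fromℤ n) (fromℤ d)) eq)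
      where
      rearrange : ∀ n d → ℤ.- (+ 1 ℤ.+ n ℤ.+ d) ℤ.- + 1 ≡ (ℤ.- + 0 ℤ.- n ℤ.- + 2) ℤ.- d
      rearrange = Z.solve 2 (λ n d → (Z.:- (Z.con (+ 1) Z.:+ n Z.:+ d)) Z.:- Z.con (+ 1) Z.:=
        (Z.con (ℤ.- + 0) Z.:- n Z.:- Z.con (+ 2)) Z.:- d) refl
        where module Z = ℤ-Solver
      powers : ∀ w n d → w ^ 3 + fromℤ (+ 0) * w ^ 2 + n * w + d ≃ w * (w * w) + n * w + d
      powers = solve 3 (λ w n d →
        w :* (w :* (w :* con 1ℚ)) :+ con 0ℚ :* (w :* (w :* con 1ℚ)) :+ n :* w :+ d :=
        w :* (w :* w) :+ n :* w :+ d) R.refl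

    1-w∈S₋₃ : 1ℝ + - w ∈ S³ᵗʳ (ℤ.- + 3)
    1-w∈S₋₃ = n ℤ.+ + 3 , ℤ.+-monoˡ-≤ (+ 3) n≤-3 ,
      (pos⇒< (pos-resp (solve 1 (λ w → con 1ℚ :+ (:- w) := (con 1ℚ :+ (:- w)) :+ (:- con 0ℚ)) R.refl w) w<1) ,
       pos⇒< (pos-resp (solve 1 (λ w → w := con 1ℚ :+ (:- (con 1ℚ :+ (:- w)))) R.refl w) w>0)) ,
      e , 1≤e ,
      ℤ.0≤i-j⇒j≤i (subst (+ 0 ℤ.≤_) (rearrange n d) (ℤ.i≤j⇒0≤j-i 1≤d)) ,
      unwrap (R.trans (R.+-cong (R.+-congˡ (R.*-congʳ (fromℤ-+ n (+ 3)))) e≃)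
        (R.trans (powers w (fromℤ n) (fromℤ d)) (R.trans (R.-‿cong eq) (solve 0 (:- con 0ℚ := con 0ℚ) R.refl))))
      where
      rearrange : ∀ n d → d ℤ.- + 1 ≡ (ℤ.- (ℤ.- + 3) ℤ.- (n ℤ.+ + 3) ℤ.- + 2) ℤ.- (ℤ.- (+ 1 ℤ.+ n ℤ.+ d))
      rearrange = Z.solve 2 (λ n d → d Z.:- Z.con (+ 1) Z.:=
        (Z.con (ℤ.- (ℤ.- + 3)) Z.:- (n Z.:+ Z.con (+ 3)) Z.:- Z.con (+ 2)) Z.:- (Z.:- (Z.con (+ 1) Z.:+ n Z.:+ d))) refl
        where module Z = ℤ-Solver
      powers : ∀ w n d → let v = 1ℝ + - w in
        v ^ 3 + fromℤ (ℤ.- + 3) * v ^ 2 + (n + fromℤ (+ 3)) * v + - (1ℝ + n + d) ≃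
        - (w * (w * w) + n * w + d)
      powers = solve 3 (λ w n d → let v = con 1ℚ :+ (:- w) in
        v :* (v :* (v :* con 1ℚ)) :+ con ((ℤ.- + 3) ℚ./ 1) :* (v :* (v :* con 1ℚ))
          :+ (n :+ con (+ 3 ℚ./ 1)) :* v :+ (:- (con 1ℚ :+ n :+ d)) :=
        :- (w :* (w :* w) :+ n :* w :+ d)) R.refl

    1-w∈K : 1ℝ + - w ∈ K
    1-w∈K = K.+-closed K.1-closed (K.neg-closed w∈K)

    1-w-irrational : Irrational (1ℝ + - w)
    1-w-irrational q 1-w≃q = irrational-affine {a = ℚ.- 1ℚ} {1ℚ} irr (λ ()) q
      (R.trans (R.trans (R.+-congʳ {y = - 1ℝ * w} (R.*-congʳ (fromℚ-neg 1ℚ)))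
        (solve 1 (λ w → (:- con 1ℚ) :* w :+ con 1ℚ := con 1ℚ :+ (:- w)) R.refl w)) 1-w≃q)

    conclusion : (∃[ α ] (α ∈ S³ᵗʳ (+ 0) × IsPrimitiveElement K α)) ×
                 (∃[ α ] (α ∈ S³ᵗʳ (ℤ.- + 3) × IsPrimitiveElement K α))
    conclusion = (w , w∈S₀ , primitive-element w∈K irr) ,
                 (1ℝ + - w , 1-w∈S₋₃ , primitive-element 1-w∈K 1-w-irrational)

  primitive-elements : (∃[ α ] (α ∈ S³ᵗʳ (+ 0) × IsPrimitiveElement K α)) ×
                       (∃[ α ] (α ∈ S³ᵗʳ (ℤ.- + 3) × IsPrimitiveElement K α))
  primitive-elements = from-root small-integral
    where
    from-root : ∃[ w ] (w ∈ K × Irrational w × w ∈ TraceZeroIntegral × Pos w × Pos (1ℝ + - w)) → _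
    from-root (w , w∈K , irr , (n , d , eq) , w>0 , w<1) = go (Root.n≤-3 w∈K irr w>0 w<1 n d eq)
      where
      go : ∃[ k ] n ≡ -[1+ suc (suc k) ] → _
      go (k , n≡) = Conclusion.conclusion w∈K irr w>0 w<1 k d
        (subst (λ n → w * (w * w) + fromℤ n * w + fromℤ d ≃ 0ℝ) n≡ eq)

theorem16 : ∀ {ℓ} (K : Pred ℝ ℓ) → IsTotallyRealCubic K →
    (∃[ α ] (α ∈ S³ᵗʳ (+ 0) × IsPrimitiveElement K α)) ×
    (∃[ α ] (α ∈ S³ᵗʳ (ℤ.- + 3) × IsPrimitiveElement K α))
theorem16 K totallyRealCubic =
  TotallyRealCubic.primitive-elements K T.isSubfield (proj₁ T.degree) (proj₂ T.degree) T.embeddings-real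
  where module T = IsTotallyRealCubic totallyRealCubic
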